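{- For every constant $\delta>0$, the problem $\mathrm{LabelCover}(1,\delta)$ is NP-hard.
   Context: A projection game $G$ is given by finite vertex sets $U,V$, a finite alphabet $\Sigma$, and a (weighted) bipartite multigraph between $U$ and $V$ whose edges carry constraints $\pi\subseteq\Sigma\times\Sigma$ such that for every $\beta\in\Sigma$ there is at most one $\alpha\in\Sigma$ with $(\alpha,\beta)\in\pi$. Its value is $\mathrm{val}(G)=\max_{f:U\to\Sigma,\,g:V\to\Sigma}\Pr_{(u,v,\pi)}[(f(u),g(v))\in\pi]$, where $(u,v,\pi)$ is a random edge chosen with probability proportional to its weight. $\mathrm{LabelCover}(1,\delta)$ is the gap problem of deciding whether the value of a given projection game is $1$ or at most $\delta$. The PCP theorem, in the form "there is a constant $\varepsilon>0$ such that $\mathrm{LabelCover}(1,1-\varepsilon)$ is NP-hard (with constant alphabet size)", may be assumed. -}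

module Defs where

open import Data.Bool.Base using (Bool; true; false)
open import Data.Fin.Base using (Fin; toℕ; finToFun)
open import Data.Fin.Subset using (Subset; _∈_)
open import Data.Fin.Subset.Properties using (_∈?_)
open import Data.Integer.Base using (+_)
open import Data.List.Base
  using (List; []; _∷_; _++_; map; foldr; filter; length; concatMap; replicate;
         allFin; cartesianProductWith)
open import Data.Maybe.Base using (Maybe; just; nothing)
open import Data.Nat.Base as ℕ using (ℕ; zero; suc; NonZero)
open import Data.Nat.Binary.Base as ℕᵇ using (ℕᵇ; 2[1+_]; 1+[2_])
open import Data.Product.Base using (Σ; ∃-syntax; _×_; _,_)
open import Data.Rational.Base as ℚ using (ℚ; 0ℚ; 1ℚ; Positive; _÷_)
open import Data.Rational.Properties using (pos⇒nonZero; ≤-decTotalOrder)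
open import Data.Vec.Base as Vec using (Vec; lookup; toList; zipWith)
open import Function.Bundles using (_↔_; _⇔_)
open import Level using (0ℓ)
open import Relation.Binary.Bundles using (DecTotalOrder)
open import Relation.Binary.PropositionalEquality using (_≡_)
open import Relation.Nullary using (¬_; Dec)
open import Relation.Unary using (Pred)

import Data.List.Extrema (DecTotalOrder.totalOrder ≤-decTotalOrder) as Extrema

------------------------------------------------------------------------
-- Projection games

-- The relation π ⊆ Σ × Σ, for Σ = Fin q, is stored by columns:
-- (α , β) ∈ π  iff  α ∈ lookup rel β.
record Constraint (q : ℕ) : Set where
  field
    rel        : Vec (Subset q) q
    functional : ∀ β {α α′} → α ∈ lookup rel β → α′ ∈ lookup rel β → α ≡ α′

-- The weight is the non-negative rational num / den, not necessarily in
-- lowest terms.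
record Edge (nU nV q : ℕ) : Set where
  field
    u           : Fin nU
    v           : Fin nV
    num den     : ℕ
    .{{den≢0}}  : NonZero den
    constraint  : Constraint q

  open Constraint constraint public

  weight : ℚ
  weight = + num ℚ./ den

totalWeight : ∀ {nU nV q} → List (Edge nU nV q) → ℚ
totalWeight es = foldr ℚ._+_ 0ℚ (map Edge.weight es)

-- The alphabet is nonempty and the total weight is positive, so that
-- there are assignments and a random edge to speak of.
record Game : Set where
  field
    nU nV q    : ℕ
    .{{q≢0}}   : NonZero q
    edges      : List (Edge nU nV q)
    .{{total}} : Positive (totalWeight edges)

  Satisfied : (Fin nU → Fin q) → (Fin nV → Fin q) → Edge nU nV q → Set
  Satisfied f g e = f (Edge.u e) ∈ lookup (Edge.rel e) (g (Edge.v e))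

  satisfied? : ∀ f g e → Dec (Satisfied f g e)
  satisfied? f g e = f (Edge.u e) ∈? lookup (Edge.rel e) (g (Edge.v e))

  Pr[satisfied] : (Fin nU → Fin q) → (Fin nV → Fin q) → ℚ
  Pr[satisfied] f g =
    (totalWeight (filter (satisfied? f g) edges) ÷ totalWeight edges)
      {{pos⇒nonZero (totalWeight edges)}}

  -- finToFun enumerates all functions.  The 0ℚ is the default value that
  -- Extrema.max asks for; it is harmless since all the values are ≥ 0.
  val : ℚ
  val = Extrema.max 0ℚ
    (cartesianProductWith (λ i j → Pr[satisfied] (finToFun i) (finToFun j))
       (allFin (q ℕ.^ nU)) (allFin (q ℕ.^ nV)))

open Game using (val)

------------------------------------------------------------------------
-- Games as bit strings

Word : Set
Word = List Bool

-- Self-delimiting unary (vertices, alphabet) and binary (weights).  The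
-- latter is the bijective base-2 notation of ℕᵇ, with digits 1 and 2, each
-- digit being preceded by a continuation bit.
unary : ℕ → Word
unary n = replicate n true ++ false ∷ []

encodeℕᵇ : ℕᵇ → Word
encodeℕᵇ ℕᵇ.zero   = false ∷ []
encodeℕᵇ 2[1+ b ] = true ∷ true ∷ encodeℕᵇ b
encodeℕᵇ 1+[2 b ] = true ∷ false ∷ encodeℕᵇ b

binary : ℕ → Word
binary n = encodeℕᵇ (ℕᵇ.fromℕ n)

encodeEdge : ∀ {nU nV q} → Edge nU nV q → Word
encodeEdge e =
  unary (toℕ u) ++ unary (toℕ v) ++ binary num ++ binary den ++
  concatMap toList (toList rel)
  where open Edge e

encode : Game → Word
encode G =
  unary nU ++ unary nV ++ unary q ++
  concatMap (λ e → true ∷ encodeEdge e) edges ++ false ∷ []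
  where open Game G

------------------------------------------------------------------------
-- Polynomial time: deterministic multitape Turing machines

-- The tape alphabet is 0, 1 and blank; a machine over a larger finite
-- alphabet can be coded in this one with a constant-factor slowdown.
Symbol : Set
Symbol = Maybe Bool

pattern blank = nothing

-- A two-way infinite tape: the cells left of the head, nearest first, and
-- the cells from the head on; everything beyond the lists is blank.
record Tape : Set where
  constructor _◂_
  field
    left right : List Symbol

data Move : Set where
  L S R : Move

read : Tape → Symbol
read (l ◂ [])      = blank
read (l ◂ (s ∷ r)) = s

write : Symbol → Tape → Tape
write s (l ◂ [])      = l ◂ (s ∷ [])
write s (l ◂ (_ ∷ r)) = l ◂ (s ∷ r)

move : Move → Tape → Tape
move L ([]      ◂ r)       = [] ◂ (blank ∷ r)
move L ((s ∷ l) ◂ r)       = l ◂ (s ∷ r)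
move S t                   = t
move R (l ◂ [])            = (blank ∷ l) ◂ []
move R (l ◂ (s ∷ r))       = (s ∷ l) ◂ r

-- The transition function returns nothing to halt.
record TM : Set₁ where
  field
    extraTapes : ℕ
    State      : Set
    #states    : ℕ
    finite     : State ↔ Fin #states
    start      : State
    δ          : State → Vec Symbol (suc extraTapes) →
                 Maybe (State × Vec (Symbol × Move) (suc extraTapes))

  Config : Set
  Config = State × Vec Tape (suc extraTapes)

  step : Config → Maybe Config
  step (s , ts) with δ s (Vec.map read ts)
  ... | nothing         = nothing
  ... | just (s′ , acts) =
    just (s′ , zipWith (λ (a , m) t → move m (write a t)) acts ts)

  initial : Word → Config
  initial w = start , (([] ◂ map just w) Vec.∷ Vec.replicate extraTapes ([] ◂ []))

  readWord : List Symbol → Word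
  readWord []           = []
  readWord (blank ∷ _)  = []
  readWord (just b ∷ r) = b ∷ readWord r

  -- The output is the word on the first tape that starts at the head and
  -- extends up to the first blank.
  output : Config → Word
  output (_ , t Vec.∷ _) = readWord (Tape.right t)

  -- The output if the machine halts within the given number of steps.
  run : ℕ → Config → Maybe Word
  run n c with step c
  run n       c | nothing = just (output c)
  run zero    c | just c′ = nothing
  run (suc n) c | just c′ = run n c′

-- Coefficients, the constant one first.
Polynomial : Set
Polynomial = List ℕ

eval : Polynomial → ℕ → ℕ
eval []      n = 0
eval (a ∷ p) n = a ℕ.+ n ℕ.* eval p n

record PolyTime (f : Word → Word) : Set₁ where
  field
    machine  : TM
    time     : Polynomial
    computes : let open TM machine in
               ∀ w → run (eval time (length w)) (initial w) ≡ just (f w)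

------------------------------------------------------------------------
-- NP and NP-hardness of promise problems

Language : Set₁
Language = Pred Word 0ℓ

⟨_,_⟩ : Word → Word → Word
⟨ x , y ⟩ = concatMap (λ b → true ∷ b ∷ []) x ++ false ∷ y

record NP (A : Language) : Set₁ where
  field
    verify      : Word → Word
    polyTime    : PolyTime verify
    certificate : Polynomial
    correct     : ∀ x → A x ⇔
                  (∃[ y ] length y ℕ.≤ eval certificate (length x) ×
                          verify ⟨ x , y ⟩ ≡ true ∷ [])

record PromiseProblem : Set₁ where
  field
    Yes No : Language

record _≤ₚ_ (A : Language) (Π : PromiseProblem) : Set₁ where
  open PromiseProblem Π
  field
    reduce   : Word → Word
    polyTime : PolyTime reduce
    yes      : ∀ x → A x → Yes (reduce x)
    no       : ∀ x → ¬ A x → No (reduce x)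

NPHard : PromiseProblem → Set₁
NPHard Π = ∀ A → NP A → A ≤ₚ Π

------------------------------------------------------------------------
-- Label cover

LabelCover⟨1,_⟩ : ℚ → PromiseProblem
LabelCover⟨1, δ ⟩ = record
  { Yes = λ w → ∃[ G ] w ≡ encode G × val G ≡ 1ℚ
  ; No  = λ w → ∃[ G ] w ≡ encode G × val G ℚ.≤ δ
  }

-- The restriction to games whose alphabet has size q.
LabelCover[_]⟨1,_⟩ : ℕ → ℚ → PromiseProblem
LabelCover[ q ]⟨1, δ ⟩ = record
  { Yes = λ w → ∃[ G ] Game.q G ≡ q × w ≡ encode G × val G ≡ 1ℚ
  ; No  = λ w → ∃[ G ] Game.q G ≡ q × w ≡ encode G × val G ℚ.≤ δ
  }

PCPTheorem : Set₁
PCPTheorem = Σ ℚ λ ε → 0ℚ ℚ.< ε × Σ ℕ λ q → NPHard LabelCover[ q ]⟨1, 1ℚ ℚ.- ε ⟩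

{-# OPTIONS --safe #-}

-- Round the weights of a game of value at most 1 - ε to powers of two, which
-- costs a constant factor in ε, and add a star: a new vertex that is joined to
-- every v, checks nothing, and carries half of the total weight.  For
-- nonnegative x on U × Σ and f on V × Σ let B x f be the sum of
-- w x(u,α) f(v,β) over all edges and allowed pairs (α,β), and let F v be the
-- mass ∑ f(v,β) over β.  If F varies, then averaging over the star loses; if F
-- is nearly constant, then f is nearly a multiple of a randomised assignment
-- and the game itself loses.  So the starred game contracts:
-- 2 B x f ≤ ‖x‖² + c ∑ w (F v)² for some constant c < 1.  As the right side
-- sees only the masses F v, the constants c multiply in products of games, as
-- in the proof of Dinur and Steurer for expanding games.  After l squarings the
-- square of the value is at most c ^ 2 ^ l.
--
-- For the running time, every step is a nest of loops over suffixes of its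
-- input which never reads its own output, and such a program stops in
-- polynomial time for syntactic reasons.
module Submission where

-- The value of a game speaks only of assignments with mass one at every vertex, whereas a
-- contraction that multiplies must hold for f of arbitrary masses. This is the obstacle: if one
-- component of a game is satisfiable, an f that lives there alone contracts by no constant below 1.
-- Hence the star, which couples all vertices v and leaves satisfiable games satisfiable. The
-- inequality is quadratic and additive because it then needs no roots, which keeps it in the
-- rationals, and because it can be summed over the slices of a product.
--
-- Multiplying binary weights is beyond programs that cannot read their own output. Exponents of
-- powers of two, kept in unary, are added by writing one after the other; the price is a bounded
-- factor for each weight. The number of squarings depends on ε and δ only, so the alphabet stays of
-- constant size and its constraint tables are unrolled in the program text, while vertices and
-- edges are handled by loops.

open import Defs

-- Multitape machines for programs made of nested scans

module Machines where

  open import Data.Bool.Base using (Bool; true; false)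
  open import Data.Fin.Base using (Fin; zero; suc; _↑ʳ_)
  import Data.Fin.Properties as Fin
  open import Data.List.Base as List using ([]; _∷_; List; _++_; length; _ʳ++_)
  import Data.List.Properties as List
  open import Data.Maybe.Base as Maybe using (Maybe; just; nothing; maybe′)
  open import Data.Nat.Base as ℕ using (ℕ; zero; suc; _+_; _*_; _≤_; z≤n; s≤s)
  import Data.Nat.Properties as ℕ
  open import Data.Nat.Solver using (module +-*-Solver)
  open import Data.Product.Base using (∃; ∃-syntax; _×_; _,_; proj₁; proj₂)
  open import Data.Sum.Base using (_⊎_; inj₁; inj₂)
  open import Data.Sum.Function.Propositional using (_⊎-↔_)
  open import Data.Unit.Base using (⊤; tt)
  open import Data.Vec.Base as Vec using (Vec; []; _∷_; lookup; zipWith; _[_]≔_)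
  import Data.Vec.Properties as Vec
  open import Function.Base using (_∘_)
  open import Function.Bundles using (_↔_; Inverse; mk↔ₛ′)
  open import Function.Properties.Inverse using (↔-sym; ↔-trans; ↔-refl)
  open import Relation.Binary.PropositionalEquality
  open import Relation.Nullary using (yes; no)

  -- Stack programs

  -- A register is a tape read as a stack whose top is under the head; the
  -- stack ends at the first blank.  What lies beyond that blank or to the left
  -- of the head is irrelevant, so the output tape of any halted machine can
  -- serve as a register.
  data Prog (N : ℕ) : Set where
    skip : Prog N
    push : Fin N → Bool → Prog N
    _⨾_  : Prog N → Prog N → Prog N
    -- Pops register i until it is empty; every popped bit b runs body s b
    -- and changes the state s to next s b.
    loop : (i : Fin N) {k : ℕ} (s : Fin k) (next : Fin k → Bool → Fin k)
           (body : Fin k → Bool → Prog N) → Prog N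

  infixr 5 _⨾_

  Ctrl : ∀ {N} → Prog N → Set
  Ctrl skip                  = ⊤
  Ctrl (push _ _)            = Bool
  Ctrl (p ⨾ q)               = Ctrl p ⊎ Ctrl q
  Ctrl (loop _ {k} _ _ body) = Fin k ⊎ ∃ λ s → ∃ λ b → Ctrl (body s b)

  entry : ∀ {N} (p : Prog N) → Ctrl p
  entry skip           = tt
  entry (push _ _)     = false
  entry (p ⨾ q)        = inj₁ (entry p)
  entry (loop _ s _ _) = inj₁ s

  Tapes : ℕ → Set
  Tapes = Vec Tape

  Actions : ℕ → Set
  Actions = Vec (Symbol × Move)

  keep : ∀ {N} → Vec Symbol N → Actions N
  keep = Vec.map (_, S)

  apply : ∀ {N} → Actions N → Tapes N → Tapes N
  apply = zipWith (λ (a , m) t → move m (write a t))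

  reads : ∀ {N} → Tapes N → Vec Symbol N
  reads = Vec.map read

  -- The new control is nothing when the program is finished.
  transition : ∀ {N} (p : Prog N) → Ctrl p → Vec Symbol N → Maybe (Ctrl p) × Actions N
  transition skip       _     σ = nothing , keep σ
  -- An action writes before it moves, so a push takes two steps: the head goes left, rewriting what
  -- it read, and then the bit overwrites whatever the cell reached contains.
  transition (push i b) false σ = just true , keep σ [ i ]≔ (lookup σ i , L)
  transition (push i b) true  σ = nothing , keep σ [ i ]≔ (just b , S)
  -- The last action of p already hands over to q, so that running times simply add.
  transition (p ⨾ q) (inj₁ s) σ =
    just (maybe′ inj₁ (inj₂ (entry q)) (proj₁ (transition p s σ))) , proj₂ (transition p s σ)
  transition (p ⨾ q) (inj₂ s) σ =
    Maybe.map inj₂ (proj₁ (transition q s σ)) , proj₂ (transition q s σ)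
  transition (loop i _ next body) (inj₁ s) σ =
    maybe′ (λ b → just (inj₂ (s , b , entry (body s b))) , keep σ [ i ]≔ (just b , R))
          (nothing , keep σ) (lookup σ i)
  transition (loop i _ next body) (inj₂ (s , b , c)) σ =
    just (maybe′ (λ c′ → inj₂ (s , b , c′)) (inj₁ (next s b)) (proj₁ (transition (body s b) c σ))) ,
    proj₂ (transition (body s b) c σ)

  module _ {N : ℕ} where

    after : (p : Prog N) → Ctrl p → Tapes N → Tapes N
    after p c ts = apply (proj₂ (transition p c (reads ts))) ts

    -- The final transition acts on the tapes too and is counted, so every run has at least one
    -- step.
    data Exec (p : Prog N) (c : Ctrl p) (ts : Tapes N) : ℕ → Tapes N → Set where
      stop : proj₁ (transition p c (reads ts)) ≡ nothing → Exec p c ts 1 (after p c ts)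
      more : ∀ {c′ n ts′} → proj₁ (transition p c (reads ts)) ≡ just c′ →
             Exec p c′ (after p c ts) n ts′ → Exec p c ts (suc n) ts′

    exec-⨾ʳ : ∀ {p q : Prog N} {c ts n ts′} → Exec q c ts n ts′ → Exec (p ⨾ q) (inj₂ c) ts n ts′
    exec-⨾ʳ (stop eq)   = stop (cong (Maybe.map inj₂) eq)
    exec-⨾ʳ (more eq e) = more (cong (Maybe.map inj₂) eq) (exec-⨾ʳ e)

    exec-⨾ : ∀ {p q : Prog N} {c ts m ts′ n ts″} → Exec p c ts m ts′ →
             Exec q (entry q) ts′ n ts″ → Exec (p ⨾ q) (inj₁ c) ts (m + n) ts″
    exec-⨾ (stop eq)   f = more (cong (just ∘ maybe′ inj₁ (inj₂ _)) eq) (exec-⨾ʳ f)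
    exec-⨾ (more eq e) f = more (cong (just ∘ maybe′ inj₁ (inj₂ _)) eq) (exec-⨾ e f)

    exec-body : ∀ {i : Fin N} {k} {s₀ : Fin k} {next body s b c ts m ts′ n ts″} →
                Exec (body s b) c ts m ts′ →
                Exec (loop i s₀ next body) (inj₁ (next s b)) ts′ n ts″ →
                Exec (loop i s₀ next body) (inj₂ (s , b , c)) ts (m + n) ts″
    exec-body (stop eq)   f = more (cong (just ∘ maybe′ (λ c′ → inj₂ (_ , _ , c′)) (inj₁ _)) eq) f
    exec-body (more eq e) f = more (cong (just ∘ maybe′ (λ c′ → inj₂ (_ , _ , c′)) (inj₁ _)) eq) (exec-body e f)

  -- Registers

  -- The same recursion as `readWord`, which belongs to a particular machine; registers are
  -- discussed before there is one.
  content : List Symbol → Word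
  content []           = []
  content (blank ∷ _)  = []
  content (just b ∷ r) = b ∷ content r

  top : Tape → Word
  top = content ∘ Tape.right

  -- Rewriting the symbol under the head can lengthen an empty list by a blank. Idle tapes are
  -- therefore preserved as registers only, and all specifications compare `reg`.
  top-keep : ∀ t → top (move S (write (read t) t)) ≡ top t
  top-keep (l ◂ [])      = refl
  top-keep (l ◂ (_ ∷ _)) = refl

  top-push : ∀ b t → top (move S (write (just b) (move L (write (read t) t)))) ≡ b ∷ top t
  top-push b ([]      ◂ [])      = refl
  top-push b ([]      ◂ (_ ∷ _)) = refl
  top-push b ((_ ∷ _) ◂ [])      = refl
  top-push b ((_ ∷ _) ◂ (_ ∷ _)) = refl

  read-empty : ∀ t → top t ≡ [] → read t ≡ blank
  read-empty (l ◂ [])          _ = refl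
  read-empty (l ◂ (blank ∷ _)) _ = refl

  read-top : ∀ {b w} t → top t ≡ b ∷ w → read t ≡ just b
  read-top (l ◂ (just _ ∷ r)) refl = refl

  top-pop : ∀ {b w} t → top t ≡ b ∷ w → top (move R (write (just b) t)) ≡ w
  top-pop (l ◂ (just _ ∷ r)) refl = refl

  module _ {N : ℕ} where

    reg : Tapes N → Fin N → Word
    reg ts i = top (lookup ts i)

    lookup-apply : ∀ (a : Actions N) ts j →
      lookup (apply a ts) j ≡ move (proj₂ (lookup a j)) (write (proj₁ (lookup a j)) (lookup ts j))
    lookup-apply a ts j = Vec.lookup-zipWith _ j a ts

    lookup-keep : ∀ (ts : Tapes N) j → lookup (keep (reads ts)) j ≡ (read (lookup ts j) , S)
    lookup-keep ts j = trans (Vec.lookup-map j _ (reads ts)) (cong (_, S) (Vec.lookup-map j read ts))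

    reg-kept : ∀ (a : Actions N) ts j → lookup a j ≡ (read (lookup ts j) , S) →
               reg (apply a ts) j ≡ reg ts j
    reg-kept a ts j eq rewrite lookup-apply a ts j | eq = top-keep (lookup ts j)

    reg-keep : ∀ (ts : Tapes N) j → reg (apply (keep (reads ts)) ts) j ≡ reg ts j
    reg-keep ts j = reg-kept (keep (reads ts)) ts j (lookup-keep ts j)

    act : Tapes N → Fin N → Symbol × Move → Tapes N
    act ts i x = apply (keep (reads ts) [ i ]≔ x) ts

    reg-other : ∀ (ts : Tapes N) i x j → j ≢ i → reg (act ts i x) j ≡ reg ts j
    reg-other ts i x j j≢i = reg-kept (keep (reads ts) [ i ]≔ x) ts j
      (trans (Vec.lookup∘update′ j≢i (keep (reads ts)) x) (lookup-keep ts j))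

    act-at : ∀ (ts : Tapes N) i x →
      lookup (act ts i x) i ≡ move (proj₂ x) (write (proj₁ x) (lookup ts i))
    act-at ts i x rewrite lookup-apply (keep (reads ts) [ i ]≔ x) ts i
                        | Vec.lookup∘update i (keep (reads ts)) x = refl

    -- A Hoare triple for total correctness with a bound on the time.
    Run : (p : Prog N) → Ctrl p → Tapes N → ℕ → (Tapes N → Set) → Set
    Run p c ts n Post = ∃[ ts′ ] ∃[ m ] Exec p c ts m ts′ × m ≤ n × Post ts′

    run-push : ∀ i b ts → Run (push i b) false ts 2 λ ts′ →
      reg ts′ i ≡ b ∷ reg ts i × (∀ j → j ≢ i → reg ts′ j ≡ reg ts j)
    run-push i b ts = _ , 2 , more refl (stop refl) , ℕ.≤-refl , at , other
      where
      ts₁ : Tapes N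
      ts₁ = act ts i (lookup (reads ts) i , L)
      at : reg (act ts₁ i (just b , S)) i ≡ b ∷ reg ts i
      at rewrite act-at ts₁ i (just b , S) | act-at ts i (lookup (reads ts) i , L)
               | Vec.lookup-map i read ts = top-push b (lookup ts i)
      other : ∀ j → j ≢ i → reg (act ts₁ i (just b , S)) j ≡ reg ts j
      other j j≢i = trans (reg-other ts₁ i _ j j≢i) (reg-other ts i _ j j≢i)

    run-skip : ∀ ts → Run skip tt ts 1 λ ts′ → ∀ j → reg ts′ j ≡ reg ts j
    run-skip ts = _ , 1 , stop refl , ℕ.≤-refl , reg-keep ts

    run-⨾ : ∀ {p q : Prog N} {ts m n P Q} → Run p (entry p) ts m P →
            (∀ ts′ → P ts′ → Run q (entry q) ts′ n Q) → Run (p ⨾ q) (inj₁ (entry p)) ts (m + n) Q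
    run-⨾ (ts′ , _ , e , le , post) k with k ts′ post
    ... | ts″ , _ , f , le′ , post′ = ts″ , _ , exec-⨾ e f , ℕ.+-mono-≤ le le′ , post′

    weaken : ∀ {p : Prog N} {c ts m n P Q} → Run p c ts m P → m ≤ n →
             (∀ ts′ → P ts′ → Q ts′) → Run p c ts n Q
    weaken (ts′ , _ , e , le , post) m≤n f = ts′ , _ , e , ℕ.≤-trans le m≤n , f ts′ post

    module _ {i : Fin N} {k} {s₀ : Fin k} {next : Fin k → Bool → Fin k}
             {body : Fin k → Bool → Prog N} where

      private
        p = loop i s₀ next body

      run-loop-[] : ∀ s ts → reg ts i ≡ [] →
        Run p (inj₁ s) ts 1 λ ts′ → ∀ j → reg ts′ j ≡ reg ts j
      run-loop-[] s ts eq = _ , 1 , stop (cong proj₁ step≡) , ℕ.≤-refl , unchanged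
        where
        step≡ : transition p (inj₁ s) (reads ts) ≡ (nothing , keep (reads ts))
        step≡ rewrite Vec.lookup-map i read ts | read-empty (lookup ts i) eq = refl
        unchanged : ∀ j → reg (after p (inj₁ s) ts) j ≡ reg ts j
        unchanged j rewrite step≡ = reg-keep ts j

      private
        pop≡ : ∀ s ts {b w} → reg ts i ≡ b ∷ w → transition p (inj₁ s) (reads ts) ≡
               (just (inj₂ (s , b , entry (body s b))) , keep (reads ts) [ i ]≔ (just b , R))
        pop≡ s ts eq rewrite Vec.lookup-map i read ts | read-top (lookup ts i) eq = refl

      run-loop-∷ : ∀ s ts {b w m n P Q} → reg ts i ≡ b ∷ w →
        (∀ ts′ → reg ts′ i ≡ w → (∀ j → j ≢ i → reg ts′ j ≡ reg ts j) →
          Run (body s b) (entry (body s b)) ts′ m P) →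
        (∀ ts′ → P ts′ → Run p (inj₁ (next s b)) ts′ n Q) →
        Run p (inj₁ s) ts (suc (m + n)) Q
      run-loop-∷ s ts {b} {w} eq f g = result
        where
        popped : reg (after p (inj₁ s) ts) i ≡ w
        popped rewrite pop≡ s ts eq | act-at ts i (just b , R) = top-pop (lookup ts i) eq
        other : ∀ j → j ≢ i → reg (after p (inj₁ s) ts) j ≡ reg ts j
        other j j≢i rewrite pop≡ s ts eq = reg-other ts i (just b , R) j j≢i
        result : Run p (inj₁ s) ts _ _
        result with f (after p (inj₁ s) ts) popped other
        ... | ts′ , _ , e , le , post with g ts′ post
        ...   | ts″ , _ , e′ , le′ , post′ =
          ts″ , _ , more (cong proj₁ (pop≡ s ts eq)) (exec-body e e′) ,
          s≤s (ℕ.+-mono-≤ le le′) , post′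

  -- Polynomials

  infixl 6 _⊕_
  infixl 7 _⊙_

  _⊕_ : Polynomial → Polynomial → Polynomial
  []      ⊕ q       = q
  (a ∷ p) ⊕ []      = a ∷ p
  (a ∷ p) ⊕ (b ∷ q) = (a + b) ∷ (p ⊕ q)

  eval-⊕ : ∀ p q n → eval (p ⊕ q) n ≡ eval p n + eval q n
  eval-⊕ []      q       n = refl
  eval-⊕ (a ∷ p) []      n = sym (ℕ.+-identityʳ _)
  eval-⊕ (a ∷ p) (b ∷ q) n rewrite eval-⊕ p q n =
    solve 5 (λ a b n x y → a :+ b :+ n :* (x :+ y) := a :+ n :* x :+ (b :+ n :* y)) refl
      a b n (eval p n) (eval q n)
    where open +-*-Solver

  scale : ℕ → Polynomial → Polynomial
  scale a []      = []
  scale a (b ∷ q) = a * b ∷ scale a q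

  eval-scale : ∀ a q n → eval (scale a q) n ≡ a * eval q n
  eval-scale a []      n = sym (ℕ.*-zeroʳ a)
  eval-scale a (b ∷ q) n rewrite eval-scale a q n =
    solve 4 (λ a b n x → a :* b :+ n :* (a :* x) := a :* (b :+ n :* x)) refl a b n (eval q n)
    where open +-*-Solver

  _⊙_ : Polynomial → Polynomial → Polynomial
  []      ⊙ q = []
  (a ∷ p) ⊙ q = scale a q ⊕ (0 ∷ p ⊙ q)

  eval-⊙ : ∀ p q n → eval (p ⊙ q) n ≡ eval p n * eval q n
  eval-⊙ []      q n = refl
  eval-⊙ (a ∷ p) q n
    rewrite eval-⊕ (scale a q) (0 ∷ p ⊙ q) n | eval-scale a q n | eval-⊙ p q n =
    solve 4 (λ a n x y → a :* y :+ n :* (x :* y) := (a :+ n :* x) :* y) refl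
      a n (eval p n) (eval q n)
    where open +-*-Solver

  compose : Polynomial → Polynomial → Polynomial
  compose []      q = []
  compose (a ∷ p) q = (a ∷ []) ⊕ q ⊙ compose p q

  eval-compose : ∀ p q n → eval (compose p q) n ≡ eval p (eval q n)
  eval-compose []      q n = refl
  eval-compose (a ∷ p) q n
    rewrite eval-⊕ (a ∷ []) (q ⊙ compose p q) n | eval-⊙ q (compose p q) n
          | eval-compose p q n | ℕ.*-zeroʳ n | ℕ.+-identityʳ a = refl

  -- Stands in for a maximum: coefficients are natural numbers, so the sum bounds the cost of a loop
  -- body in whichever state it is run.
  ⨁ : ∀ {k} → (Fin k → Polynomial) → Polynomial
  ⨁ {zero}  P = []
  ⨁ {suc k} P = P zero ⊕ ⨁ (P ∘ suc)

  eval-≤-⨁ : ∀ {k} (P : Fin k → Polynomial) s n → eval (P s) n ≤ eval (⨁ P) n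
  eval-≤-⨁ P zero    n rewrite eval-⊕ (P zero) (⨁ (P ∘ suc)) n = ℕ.m≤m+n _ _
  eval-≤-⨁ P (suc s) n rewrite eval-⊕ (P zero) (⨁ (P ∘ suc)) n =
    ℕ.≤-trans (eval-≤-⨁ (P ∘ suc) s n) (ℕ.m≤n+m _ _)

  -- Scanning programs

  -- n words are in scope, of which the newest has index zero, and scans can be
  -- nested d deep.  The words are suffixes of the input and never change, and
  -- the output is never read, so that every program runs in polynomial time.
  data Cmd : ℕ → ℕ → Set where
    nop  : ∀ {d n} → Cmd d n
    emit : ∀ {d n} → Bool → Cmd d n
    _⨾_  : ∀ {d n} → Cmd d n → Cmd d n → Cmd d n
    -- For every bit b of word i, in order, runs body s b with the remaining
    -- suffix in scope, and changes the state s to next s b.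
    scan : ∀ {d n} (i : Fin n) {k : ℕ} (s : Fin k) (next : Fin k → Bool → Fin k)
           (body : Fin k → Bool → Cmd d (suc n)) → Cmd (suc d) n

  module _ {n : ℕ} {k : ℕ} (next : Fin k → Bool → Fin k)
           (body : Fin k → Bool → Vec Word (suc n) → Word) where

    scanning : Fin k → Vec Word n → Word → Word
    scanning s ρ []      = []
    scanning s ρ (b ∷ w) = body s b (w ∷ ρ) ++ scanning (next s b) ρ w

  ⟦_⟧ : ∀ {d n} → Cmd d n → Vec Word n → Word
  ⟦ nop ⟧                  ρ = []
  ⟦ emit b ⟧               ρ = b ∷ []
  ⟦ c ⨾ c′ ⟧               ρ = ⟦ c ⟧ ρ ++ ⟦ c′ ⟧ ρ
  ⟦ scan i s next body ⟧   ρ = scanning next (λ s b → ⟦ body s b ⟧) s ρ (lookup ρ i)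

  -- The argument bounds the lengths of all words in scope. A scan spends nine steps per bit outside
  -- its body: three to pour the word into `tmp`, five to pour it back into two registers, one to
  -- pop it. Its three loops end with one step each.
  cost : ∀ {d n} → Cmd d n → Polynomial
  cost nop               = 1 ∷ []
  cost (emit _)          = 2 ∷ []
  cost (c ⨾ c′)          = cost c ⊕ cost c′
  cost (scan _ _ _ body) = 3 ∷ ((9 ∷ []) ⊕ ⨁ λ s → cost (body s true) ⊕ cost (body s false))

  cost-body : ∀ {d n k} (body : Fin k → Bool → Cmd d n) s b m →
    eval (cost (body s b)) m ≤ eval (⨁ λ s → cost (body s true) ⊕ cost (body s false)) m
  cost-body body s b m = ℕ.≤-trans (summand b) (eval-≤-⨁ _ s m)
    where
    summand : ∀ b → eval (cost (body s b)) m ≤ eval (cost (body s true) ⊕ cost (body s false)) m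
    summand true  rewrite eval-⊕ (cost (body s true)) (cost (body s false)) m = ℕ.m≤m+n _ _
    summand false rewrite eval-⊕ (cost (body s true)) (cost (body s false)) m = ℕ.m≤n+m _ _

  module _ {N : ℕ} where

    each : Fin N → (Bool → Prog N) → Prog N
    each i body = loop i {1} zero (λ s _ → s) (λ _ → body)

    -- `P ts w ts′` is the effect of the loop on the word w still to be popped, from `ts` to the
    -- final `ts′`. The effect of the body need not be named: it only has to turn the effect of the
    -- remaining loop into that of the whole.
    run-each : ∀ i (body : Bool → Prog N) m (P : Tapes N → Word → Tapes N → Set) →
      (∀ ts ts′ → reg ts i ≡ [] → (∀ j → reg ts′ j ≡ reg ts j) → P ts [] ts′) →
      (∀ ts b w → reg ts i ≡ b ∷ w → ∀ ts₁ → reg ts₁ i ≡ w →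
        (∀ j → j ≢ i → reg ts₁ j ≡ reg ts j) →
        Run (body b) (entry (body b)) ts₁ m λ ts₂ →
          reg ts₂ i ≡ w × (∀ ts′ → P ts₂ w ts′ → P ts (b ∷ w) ts′)) →
      ∀ w ts → reg ts i ≡ w →
      Run (each i body) (entry (each i body)) ts (suc (length w * suc m)) (P ts w)
    run-each i body m P nil cons []      ts eq =
      weaken {p = each i body} (run-loop-[] zero ts eq) ℕ.≤-refl λ ts′ → nil ts ts′ eq
    run-each i body m P nil cons (b ∷ w) ts eq =
      weaken {p = each i body}
        (run-loop-∷ zero ts eq (cons ts b w eq) λ ts₂ (eq₂ , f) →
          weaken {p = each i body} (run-each i body m P nil cons w ts₂ eq₂) ℕ.≤-refl f)
        (ℕ.≤-reflexive (cong suc (ℕ.+-suc m (length w * suc m)))) λ _ p → p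

    run-pour : ∀ {a c} → a ≢ c → ∀ w ts → reg ts a ≡ w →
      Run (each a (push c)) (entry (each a (push c))) ts (suc (length w * 3)) λ ts′ →
        reg ts′ a ≡ [] × reg ts′ c ≡ w ʳ++ reg ts c ×
        (∀ j → j ≢ a → j ≢ c → reg ts′ j ≡ reg ts j)
    run-pour {a} {c} a≢c = run-each a (push c) 2
      (λ ts w ts′ → reg ts′ a ≡ [] × reg ts′ c ≡ w ʳ++ reg ts c ×
        (∀ j → j ≢ a → j ≢ c → reg ts′ j ≡ reg ts j))
      (λ ts ts′ eq same → trans (same a) eq , same c , λ j _ _ → same j)
      λ ts b w eq ts₁ eq₁ same₁ →
        weaken {p = push c b} (run-push c b ts₁) ℕ.≤-refl λ ts₂ (at , same₂) →
          trans (same₂ a a≢c) eq₁ , λ ts′ (a≡ , c≡ , same) →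
            a≡ ,
            trans c≡ (cong (w ʳ++_) (trans at (cong (b ∷_) (same₁ c (a≢c ∘ sym))))) ,
            λ j j≢a j≢c → trans (same j j≢a j≢c) (trans (same₂ j j≢c) (same₁ j j≢a))

    run-pour₂ : ∀ {a c e} → a ≢ c → a ≢ e → c ≢ e → ∀ w ts → reg ts a ≡ w →
      let p = each a (λ b → push c b ⨾ push e b) in
      Run p (entry p) ts (suc (length w * 5)) λ ts′ →
        reg ts′ a ≡ [] × reg ts′ c ≡ w ʳ++ reg ts c × reg ts′ e ≡ w ʳ++ reg ts e ×
        (∀ j → j ≢ a → j ≢ c → j ≢ e → reg ts′ j ≡ reg ts j)
    run-pour₂ {a} {c} {e} a≢c a≢e c≢e = run-each a (λ b → push c b ⨾ push e b) 4
      (λ ts w ts′ → reg ts′ a ≡ [] × reg ts′ c ≡ w ʳ++ reg ts c × reg ts′ e ≡ w ʳ++ reg ts e ×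
        (∀ j → j ≢ a → j ≢ c → j ≢ e → reg ts′ j ≡ reg ts j))
      (λ ts ts′ eq same → trans (same a) eq , same c , same e , λ j _ _ _ → same j)
      λ ts b w eq ts₁ eq₁ same₁ →
        run-⨾ {p = push c b} {q = push e b} (run-push c b ts₁) λ ts₂ (at₂ , same₂) →
        weaken {p = push e b} (run-push e b ts₂) ℕ.≤-refl λ ts₃ (at₃ , same₃) →
          trans (same₃ a a≢e) (trans (same₂ a a≢c) eq₁) , λ ts′ (a≡ , c≡ , e≡ , same) →
            a≡ ,
            trans c≡ (cong (w ʳ++_) (trans (same₃ c c≢e)
              (trans at₂ (cong (b ∷_) (same₁ c (a≢c ∘ sym)))))) ,
            trans e≡ (cong (w ʳ++_) (trans at₃
              (cong (b ∷_) (trans (same₂ e (c≢e ∘ sym)) (same₁ e (a≢e ∘ sym)))))) ,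
            λ j j≢a j≢c j≢e → trans (same j j≢a j≢c j≢e)
              (trans (same₃ j j≢e) (trans (same₂ j j≢c) (same₁ j j≢a)))

  ʳ++-reverse : ∀ (w : Word) → (w ʳ++ []) ʳ++ [] ≡ w
  ʳ++-reverse w = trans (List.ʳ++-ʳ++ w) (List.++-identityʳ w)

  length-ʳ++[] : ∀ (w : Word) → length (w ʳ++ []) ≡ length w
  length-ʳ++[] w = trans (List.length-ʳ++ w) (ℕ.+-identityʳ _)

  -- Compilation: out receives the output in reverse, and tmp is empty between
  -- the instructions.
  module Compile {N : ℕ} {out tmp : Fin N} (out≢tmp : out ≢ tmp) where

    -- Popping destroys v and pouring reverses it; pouring back from `tmp` restores v and yields a
    -- second copy, both in the original order.
    copy : Fin N → Fin N → Prog N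
    copy v f = each v (push tmp) ⨾ each tmp (λ b → push v b ⨾ push f b)

    compile : ∀ {d n} → Cmd d n → Vec (Fin N) n → Vec (Fin N) d → Prog N
    compile nop                  vars free       = skip
    compile (emit b)             vars free       = push out b
    compile (c ⨾ c′)             vars free       = compile c vars free ⨾ compile c′ vars free
    compile (scan i s next body) vars (f ∷ free) =
      copy (lookup vars i) f ⨾
      -- At every moment f holds exactly the suffix not yet read, so f itself is the register of the
      -- new word in scope. The body leaves it intact, as its own scans work on copies.
      loop f s next (λ s b → compile (body s b) (f ∷ vars) free)

    data Fresh {n} (vars : Vec (Fin N) n) : ∀ {d} → Vec (Fin N) d → Set where
      []  : Fresh vars []
      new : ∀ {d f} {free : Vec (Fin N) d} → f ≢ out → f ≢ tmp →
            (∀ i → lookup vars i ≢ f) → (∀ i → lookup free i ≢ f) →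
            Fresh (f ∷ vars) free → Fresh vars (f ∷ free)

    record Proper {n d} (vars : Vec (Fin N) n) (free : Vec (Fin N) d) : Set where
      field
        vars≢out : ∀ i → lookup vars i ≢ out
        vars≢tmp : ∀ i → lookup vars i ≢ tmp
        free≢out : ∀ i → lookup free i ≢ out
        free≢tmp : ∀ i → lookup free i ≢ tmp
        fresh    : Fresh vars free

    record Ready {n d} (vars : Vec (Fin N) n) (free : Vec (Fin N) d) (ρ : Vec Word n)
                 (ts : Tapes N) : Set where
      field
        vars≡ : ∀ i → reg ts (lookup vars i) ≡ lookup ρ i
        free≡ : ∀ i → reg ts (lookup free i) ≡ []
        tmp≡  : reg ts tmp ≡ []

    open Proper
    open Ready

    -- The free registers are included: they end empty as they began, so the next instruction can
    -- use them again.
    Done : Tapes N → Word → Tapes N → Set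
    Done ts w ts′ = reg ts′ out ≡ w ʳ++ reg ts out × (∀ j → j ≢ out → reg ts′ j ≡ reg ts j)

    stillReady : ∀ {n d} {vars : Vec (Fin N) n} {free : Vec (Fin N) d} {ρ ts ts′} →
      Proper vars free → Ready vars free ρ ts →
      (∀ j → j ≢ out → reg ts′ j ≡ reg ts j) → Ready vars free ρ ts′
    stillReady pr rd same .vars≡ i = trans (same _ (vars≢out pr i)) (vars≡ rd i)
    stillReady pr rd same .free≡ i = trans (same _ (free≢out pr i)) (free≡ rd i)
    stillReady pr rd same .tmp≡    = trans (same _ (out≢tmp ∘ sym)) (tmp≡ rd)

    run-copy : ∀ {v f} → v ≢ tmp → f ≢ tmp → v ≢ f → ∀ w ts →
      reg ts v ≡ w → reg ts f ≡ [] → reg ts tmp ≡ [] →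
      Run (copy v f) (entry (copy v f)) ts (suc (length w * 3) + suc (length w * 5)) λ ts′ →
        reg ts′ f ≡ w × (∀ j → j ≢ f → reg ts′ j ≡ reg ts j)
    run-copy {v} {f} v≢tmp f≢tmp v≢f w ts v≡ f≡ tmp≡[] =
      run-⨾ {p = each v (push tmp)} {q = each tmp (λ b → push v b ⨾ push f b)}
        (run-pour v≢tmp w ts v≡) λ ts₁ (v₁ , tmp₁ , same₁) →
      weaken {p = each tmp (λ b → push v b ⨾ push f b)}
        (run-pour₂ (v≢tmp ∘ sym) (f≢tmp ∘ sym) v≢f (w ʳ++ []) ts₁
          (trans tmp₁ (cong (w ʳ++_) tmp≡[])))
        (ℕ.≤-reflexive (cong (λ x → suc (x * 5)) (length-ʳ++[] w)))
        λ ts₂ (tmp₂ , v₂ , f₂ , same₂) →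
          restored f₂ (trans (same₁ f (v≢f ∘ sym) f≢tmp) f≡) ,
          others ts₁ ts₂ tmp₂ (restored v₂ v₁) same₁ same₂
      where
      restored : ∀ {x y} → x ≡ (w ʳ++ []) ʳ++ y → y ≡ [] → x ≡ w
      restored eq refl = trans eq (ʳ++-reverse w)
      others : ∀ ts₁ ts₂ → reg ts₂ tmp ≡ [] → reg ts₂ v ≡ w →
        (∀ j → j ≢ v → j ≢ tmp → reg ts₁ j ≡ reg ts j) →
        (∀ j → j ≢ tmp → j ≢ v → j ≢ f → reg ts₂ j ≡ reg ts₁ j) →
        ∀ j → j ≢ f → reg ts₂ j ≡ reg ts j
      others ts₁ ts₂ tmp₂ v₂ same₁ same₂ j j≢f with j Fin.≟ tmp | j Fin.≟ v
      ... | yes refl | _        = trans tmp₂ (sym tmp≡[])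
      ... | no _     | yes refl = trans v₂ (sym v≡)
      ... | no j≢tmp | no j≢v   = trans (same₂ j j≢tmp j≢v j≢f) (same₁ j j≢v j≢tmp)

    scan-cost : ∀ ℓ m T → ℓ ≤ m →
      suc (ℓ * 3) + suc (ℓ * 5) + suc (ℓ * suc T) ≤ 3 + m * (9 + m * 0 + T)
    scan-cost ℓ m T ℓ≤m = begin
      suc (ℓ * 3) + suc (ℓ * 5) + suc (ℓ * suc T)
        ≡⟨ solve 2 (λ ℓ T → con 1 :+ ℓ :* con 3 :+
                     (con 1 :+ ℓ :* con 5) :+ (con 1 :+ ℓ :* (con 1 :+ T))
                   := con 3 :+ ℓ :* (con 9 :+ T)) refl ℓ T ⟩
      3 + ℓ * (9 + T)           ≤⟨ ℕ.+-monoʳ-≤ 3 (ℕ.*-monoˡ-≤ (9 + T) ℓ≤m) ⟩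
      3 + m * (9 + T)           ≡⟨ cong (λ x → 3 + m * (9 + x + T)) (ℕ.*-zeroʳ m) ⟨
      3 + m * (9 + m * 0 + T)   ∎
      where open ℕ.≤-Reasoning
            open +-*-Solver

    correct : ∀ {d n} (c : Cmd d n) {vars free ρ m} → Proper vars free →
      (∀ i → length (lookup ρ i) ≤ m) → ∀ ts → Ready vars free ρ ts →
      Run (compile c vars free) (entry (compile c vars free)) ts (eval (cost c) m)
        (Done ts (⟦ c ⟧ ρ))
    correct nop {m = m} pr len ts rd =
      weaken {p = skip} (run-skip ts) (ℕ.m≤m+n 1 (m * 0)) λ ts′ same → same out , λ j _ → same j
    correct (emit b) {m = m} pr len ts rd =
      weaken {p = push out b} (run-push out b ts) (ℕ.m≤m+n 2 (m * 0)) λ ts′ post → post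
    correct (c ⨾ c′) {vars} {free} {ρ} {m} pr len ts rd
      rewrite eval-⊕ (cost c) (cost c′) m =
      run-⨾ {p = compile c vars free} {q = compile c′ vars free}
        (correct c pr len ts rd) λ ts₁ (out₁ , same₁) →
        weaken {p = compile c′ vars free}
          (correct c′ pr len ts₁ (stillReady pr rd same₁)) ℕ.≤-refl λ ts₂ (out₂ , same₂) →
            trans out₂ (trans (cong (⟦ c′ ⟧ ρ ʳ++_) out₁) (sym (List.++-ʳ++ (⟦ c ⟧ ρ)))) ,
            λ j j≢out → trans (same₂ j j≢out) (same₁ j j≢out)
    correct {n = n} (scan {d} i {k} s next body) {vars} {f ∷ free} {ρ} {m} pr len ts rd
      with fresh pr
    ... | new f≢out f≢tmp vars≢f free≢f fr
      rewrite eval-⊕ (9 ∷ []) (⨁ λ s → cost (body s true) ⊕ cost (body s false)) m =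
      weaken {p = prog}
        (run-⨾ {p = copy (lookup vars i) f} {q = p₃}
          (run-copy (vars≢tmp pr i) f≢tmp (vars≢f i) w₀ ts
            (vars≡ rd i) (free≡ rd zero) (tmp≡ rd))
          λ ts₂ (f₂ , others) →
         weaken {p = p₃}
           (main w₀ s ts₂ f₂
             (λ j → trans (others _ (vars≢f j)) (vars≡ rd j))
             (λ j → trans (others _ (free≢f j)) (free≡ rd (suc j)))
             (trans (others tmp (f≢tmp ∘ sym)) (tmp≡ rd)) (len i))
           ℕ.≤-refl λ ts₃ (out₃ , fᵉ , same₃) →
             trans out₃ (cong (output s w₀ ʳ++_) (others out (f≢out ∘ sym))) ,
             unchanged ts₂ ts₃ fᵉ same₃ others)
        (scan-cost (length w₀) m T (len i))
        λ _ post → post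
      where
      w₀ : Word
      w₀ = lookup ρ i
      T : ℕ
      T = eval (⨁ λ s → cost (body s true) ⊕ cost (body s false)) m
      output : Fin k → Word → Word
      output s = scanning next (λ s b → ⟦ body s b ⟧) s ρ
      code : Fin k → Bool → Prog N
      code s b = compile (body s b) (f ∷ vars) free
      p₃ prog : Prog N
      p₃ = loop f s next code
      prog = copy (lookup vars i) f ⨾ p₃

      unchanged : ∀ ts₂ ts₃ → reg ts₃ f ≡ [] →
        (∀ j → j ≢ out → j ≢ f → reg ts₃ j ≡ reg ts₂ j) →
        (∀ j → j ≢ f → reg ts₂ j ≡ reg ts j) → ∀ j → j ≢ out → reg ts₃ j ≡ reg ts j
      unchanged ts₂ ts₃ fᵉ same others j j≢out with j Fin.≟ f
      ... | yes refl = trans fᵉ (sym (free≡ rd zero))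
      ... | no j≢f   = trans (same j j≢out j≢f) (others j j≢f)

      pr′ : Proper (f ∷ vars) free
      pr′ .vars≢out zero    = f≢out
      pr′ .vars≢out (suc j) = vars≢out pr j
      pr′ .vars≢tmp zero    = f≢tmp
      pr′ .vars≢tmp (suc j) = vars≢tmp pr j
      pr′ .free≢out j       = free≢out pr (suc j)
      pr′ .free≢tmp j       = free≢tmp pr (suc j)
      pr′ .fresh            = fr

      -- The induction is on the suffix left in f, for every state of the scan. Only f and `out` are
      -- exempt from being preserved, f because the loop consumes it.
      main : ∀ w s ts → reg ts f ≡ w → (∀ j → reg ts (lookup vars j) ≡ lookup ρ j) →
        (∀ j → reg ts (lookup free j) ≡ []) → reg ts tmp ≡ [] → length w ≤ m →
        Run p₃ (inj₁ s) ts (suc (length w * suc T)) λ ts′ →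
          reg ts′ out ≡ output s w ʳ++ reg ts out ×
          reg ts′ f ≡ [] × (∀ j → j ≢ out → j ≢ f → reg ts′ j ≡ reg ts j)
      main [] s ts eq vs fs te _ =
        weaken {p = p₃} (run-loop-[] s ts eq) ℕ.≤-refl λ ts′ same →
          same out , trans (same f) eq , λ j _ _ → same j
      main (b ∷ w) s ts eq vs fs te le =
        weaken {p = p₃}
          (run-loop-∷ s ts eq
            (λ ts₁ f₁ same₁ →
              weaken {p = code s b}
                (correct (body s b) {ρ = w ∷ ρ} {m = m} pr′
                  (λ { zero → ℕ.<⇒≤ le ; (suc j) → len j }) ts₁ record
                  { vars≡ = λ { zero → f₁ ; (suc j) → trans (same₁ _ (vars≢f j)) (vs j) }
                  ; free≡ = λ j → trans (same₁ _ (free≢f j)) (fs j)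
                  ; tmp≡  = trans (same₁ tmp (f≢tmp ∘ sym)) te })
                (cost-body body s b m)
                λ ts₂ (out₂ , same₂) →
                  trans out₂ (cong (⟦ body s b ⟧ (w ∷ ρ) ʳ++_) (same₁ out (f≢out ∘ sym))) ,
                  trans (same₂ f f≢out) f₁ ,
                  λ j j≢out j≢f → trans (same₂ j j≢out) (same₁ j j≢f))
            λ ts₂ (out₂ , f₂ , same₂) →
              weaken {p = p₃}
                (main w (next s b) ts₂ f₂
                  (λ j → trans (same₂ _ (vars≢out pr j) (vars≢f j)) (vs j))
                  (λ j → trans (same₂ _ (free≢out pr (suc j)) (free≢f j)) (fs j))
                  (trans (same₂ tmp (out≢tmp ∘ sym) (f≢tmp ∘ sym)) te)
                  (ℕ.<⇒≤ le))
                ℕ.≤-refl λ ts₃ (out₃ , f₃ , same₃) →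
                  trans out₃ (trans (cong (output (next s b) w ʳ++_) out₂)
                    (sym (List.++-ʳ++ (⟦ body s b ⟧ (w ∷ ρ)) {output (next s b) w}))) ,
                  f₃ , λ j j≢out j≢f → trans (same₃ j j≢out j≢f) (same₂ j j≢out j≢f))
          (ℕ.≤-reflexive (cong suc (ℕ.+-suc T (length w * suc T)))) λ _ post → post

  Finite : Set → Set
  Finite A = ∃ λ n → A ↔ Fin n

  finite-⊎ : ∀ {A B} → Finite A → Finite B → Finite (A ⊎ B)
  finite-⊎ (m , f) (n , g) = m + n , ↔-trans (f ⊎-↔ g) (↔-sym Fin.+↔⊎)

  finite-Maybe : ∀ {A} → Finite A → Finite (Maybe A)
  finite-Maybe (n , f) = suc n , mk↔ₛ′
    (λ { nothing → zero ; (just a) → suc (Inverse.to f a) })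
    (λ { zero → nothing ; (suc i) → just (Inverse.from f i) })
    (λ { zero → refl ; (suc i) → cong suc (Inverse.strictlyInverseˡ f i) })
    (λ { nothing → refl ; (just a) → cong just (Inverse.strictlyInverseʳ f a) })

  finite-↔ : ∀ {A B} → A ↔ B → Finite B → Finite A
  finite-↔ f (n , g) = n , ↔-trans f g

  finite-∃-Bool : ∀ {P : Bool → Set} → (∀ b → Finite (P b)) → Finite (∃ P)
  finite-∃-Bool fin = finite-↔
    (mk↔ₛ′ (λ { (false , x) → inj₁ x ; (true , x) → inj₂ x })
           (λ { (inj₁ x) → false , x ; (inj₂ x) → true , x })
           (λ { (inj₁ x) → refl ; (inj₂ x) → refl })
           (λ { (false , x) → refl ; (true , x) → refl }))
    (finite-⊎ (fin false) (fin true))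

  finite-∃-Fin : ∀ {k} {P : Fin k → Set} → (∀ i → Finite (P i)) → Finite (∃ P)
  finite-∃-Fin {zero}  fin = 0 , mk↔ₛ′ proj₁ (λ ()) (λ ()) (λ { (() , _) })
  finite-∃-Fin {suc k} fin = finite-↔
    (mk↔ₛ′ (λ { (zero , x) → inj₁ x ; (suc i , x) → inj₂ (i , x) })
           (λ { (inj₁ x) → zero , x ; (inj₂ (i , x)) → suc i , x })
           (λ { (inj₁ x) → refl ; (inj₂ x) → refl })
           (λ { (zero , x) → refl ; (suc i , x) → refl }))
    (finite-⊎ (fin zero) (finite-∃-Fin (fin ∘ suc)))

  finite-Ctrl : ∀ {N} (p : Prog N) → Finite (Ctrl p)
  finite-Ctrl skip                  = 1 , ↔-sym Fin.1↔⊤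
  finite-Ctrl (push _ _)            = 2 , ↔-sym Fin.2↔Bool
  finite-Ctrl (p ⨾ q)               = finite-⊎ (finite-Ctrl p) (finite-Ctrl q)
  finite-Ctrl (loop _ {k} _ _ body) =
    finite-⊎ (k , ↔-refl) (finite-∃-Fin λ s → finite-∃-Bool λ b → finite-Ctrl (body s b))

  -- Runs of a machine

  module _ (M : TM) where
    open TM M

    data Steps (c : Config) : ℕ → Config → Set where
      halt : Steps c 0 c
      then : ∀ {c′ n c″} → step c ≡ just c′ → Steps c′ n c″ → Steps c (suc n) c″

    steps-trans : ∀ {c m c′ n c″} → Steps c m c′ → Steps c′ n c″ → Steps c (m + n) c″
    steps-trans halt        t = t
    steps-trans (then eq s) t = then eq (steps-trans s t)

    run-complete : ∀ {c n c′ t} → Steps c n c′ → step c′ ≡ nothing → n ≤ t →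
                   run t c ≡ just (output c′)
    run-complete {t = t}     halt        stops _         rewrite stops = refl
    run-complete {t = suc t} (then eq s) stops (s≤s n≤t) rewrite eq = run-complete s stops n≤t

    run-sound : ∀ t {c w} → run t c ≡ just w →
      ∃[ n ] ∃[ c′ ] n ≤ t × Steps c n c′ × step c′ ≡ nothing × output c′ ≡ w
    run-sound t {c} eq with step c in step≡
    run-sound t       {c} refl | nothing = 0 , c , z≤n , halt , step≡ , refl
    run-sound (suc t) {c} eq   | just c₁ with run-sound t eq
    ... | n , c′ , n≤t , s , stops , out≡ =
      suc n , c′ , s≤s n≤t , then step≡ s , stops , out≡

    step-just : ∀ s ts {s′ a} → δ s (reads ts) ≡ just (s′ , a) → step (s , ts) ≡ just (s′ , apply a ts)
    step-just s ts eq rewrite eq = refl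

    step-nothing : ∀ s ts → δ s (reads ts) ≡ nothing → step (s , ts) ≡ nothing
    step-nothing s ts eq rewrite eq = refl

    step-just⁻¹ : ∀ s ts {c′} → step (s , ts) ≡ just c′ →
      ∃[ s′ ] ∃[ a ] δ s (reads ts) ≡ just (s′ , a) × c′ ≡ (s′ , apply a ts)
    step-just⁻¹ s ts eq with δ s (reads ts)
    step-just⁻¹ s ts refl | just (s′ , a) = s′ , a , refl , refl

    step-nothing⁻¹ : ∀ s ts → step (s , ts) ≡ nothing → δ s (reads ts) ≡ nothing
    step-nothing⁻¹ s ts eq with δ s (reads ts)
    ... | nothing = refl

    readWord≡content : ∀ r → readWord r ≡ content r
    readWord≡content []           = refl
    readWord≡content (blank ∷ _)  = refl
    readWord≡content (just b ∷ r) = cong (b ∷_) (readWord≡content r)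

    output≡reg : ∀ s ts → output (s , ts) ≡ reg ts zero
    output≡reg s (t ∷ _) = readWord≡content (Tape.right t)

    -- Bounds the length of the output, which stops at the first blank. A step adds at most two
    -- cells, one by writing beyond the end and one by moving left, so polynomial time forces
    -- outputs of polynomial length.
    extent : Config → ℕ
    extent (_ , t ∷ _) = length (Tape.right t)

    extent-effect : ∀ a m t → length (Tape.right (move m (write a t))) ≤ 2 + length (Tape.right t)
    extent-effect a L ([]      ◂ [])      = ℕ.≤-refl
    extent-effect a L ((_ ∷ _) ◂ [])      = ℕ.≤-refl
    extent-effect a L ([]      ◂ (_ ∷ r)) = ℕ.n≤1+n _
    extent-effect a L ((_ ∷ _) ◂ (_ ∷ r)) = ℕ.n≤1+n _
    extent-effect a S (_ ◂ [])            = s≤s z≤n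
    extent-effect a S (_ ◂ (_ ∷ r))       = ℕ.m≤n+m _ 2
    extent-effect a R (_ ◂ [])            = z≤n
    extent-effect a R (_ ◂ (_ ∷ r))       = ℕ.m≤n+m _ 3

    extent-step : ∀ {c c′} → step c ≡ just c′ → extent c′ ≤ 2 + extent c
    extent-step {s , ts@(t ∷ _)} eq with step-just⁻¹ s ts eq
    ... | _ , (x ∷ _) , _ , refl = extent-effect (proj₁ x) (proj₂ x) t

    extent-steps : ∀ {c n c′} → Steps c n c′ → extent c′ ≤ extent c + 2 * n
    extent-steps {c} halt = ℕ.m≤m+n _ _
    extent-steps {c} {suc n} {c″} (then {c′} eq s) = begin
      extent c″             ≤⟨ extent-steps s ⟩
      extent c′ + 2 * n     ≤⟨ ℕ.+-monoˡ-≤ (2 * n) (extent-step eq) ⟩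
      2 + extent c + 2 * n  ≡⟨ solve 2 (λ x n → con 2 :+ x :+ con 2 :* n
                                 := x :+ con 2 :* (con 1 :+ n)) refl (extent c) n ⟩
      extent c + 2 * suc n  ∎
      where open ℕ.≤-Reasoning
            open +-*-Solver

    length-content : ∀ r → length (content r) ≤ length r
    length-content []           = z≤n
    length-content (blank ∷ _)  = z≤n
    length-content (just _ ∷ r) = s≤s (length-content r)

    length-output : ∀ c → length (output c) ≤ extent c
    length-output (s , ts@(t ∷ _)) rewrite output≡reg s ts = length-content (Tape.right t)

  -- A stack program run on the output of a machine

  replicate-++ : ∀ m {n} {x : Tape} →
    Vec.replicate (m + n) x ≡ Vec.replicate m x Vec.++ Vec.replicate n x
  replicate-++ zero    = refl
  replicate-++ (suc m) = cong (_ ∷_) (replicate-++ m)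

  module Append (M : TM) {D : ℕ} (p : Prog (suc (TM.extraTapes M) + D)) where
    open TM M

    private
      N : ℕ
      N = suc extraTapes

    beside : Maybe (State × Actions N) → Vec Symbol D → Vec Symbol (N + D) →
             Maybe ((State ⊎ Maybe (Ctrl p)) × Actions (N + D))
    beside (just (s , a)) σ _ = just (inj₁ s , a Vec.++ keep σ)
    beside nothing        _ σ = just (inj₂ (just (entry p)) , keep σ)

    δ⁺ : State ⊎ Maybe (Ctrl p) → Vec Symbol (N + D) →
         Maybe ((State ⊎ Maybe (Ctrl p)) × Actions (N + D))
    δ⁺ (inj₁ s) σ = beside (δ s (Vec.take N {D} σ)) (Vec.drop N {D} σ) σ
    δ⁺ (inj₂ nothing)  σ = nothing
    δ⁺ (inj₂ (just c)) σ = just (inj₂ (proj₁ (transition p c σ)) , proj₂ (transition p c σ))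

    private
      finite⁺ : Finite (State ⊎ Maybe (Ctrl p))
      finite⁺ = finite-⊎ (#states , finite) (finite-Maybe (finite-Ctrl p))

    append : TM
    append = record
      { extraTapes = extraTapes + D
      ; State      = State ⊎ Maybe (Ctrl p)
      ; #states    = proj₁ finite⁺
      ; finite     = proj₂ finite⁺
      ; start      = inj₁ start
      ; δ          = δ⁺
      }

    reads-++ : ∀ (ts : Tapes N) (us : Tapes D) → reads {N + D} (ts Vec.++ us) ≡ reads ts Vec.++ reads us
    reads-++ = Vec.map-++ read

    take-reads : ∀ (ts : Tapes N) (us : Tapes D) →
      Vec.take N {D} (reads {N + D} (ts Vec.++ us)) ≡ reads ts
    take-reads ts us = trans (cong (Vec.take N {D}) (reads-++ ts us))
      (Vec.++-injectiveˡ _ (reads ts) (Vec.take++drop≡id N (reads ts Vec.++ reads us)))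

    drop-reads : ∀ (ts : Tapes N) (us : Tapes D) →
      Vec.drop N {D} (reads {N + D} (ts Vec.++ us)) ≡ reads us
    drop-reads ts us = trans (cong (Vec.drop N {D}) (reads-++ ts us))
      (Vec.++-injectiveʳ (Vec.take N {D} (reads ts Vec.++ reads us)) (reads ts)
        (Vec.take++drop≡id N (reads ts Vec.++ reads us)))

    Empty : Tapes D → Set
    Empty us = ∀ j → reg us j ≡ []

    simulate : ∀ {s ts n s′ ts′} → Steps M (s , ts) n (s′ , ts′) → ∀ us → Empty us →
      ∃[ us′ ] Empty us′ × Steps append (inj₁ s , ts Vec.++ us) n (inj₁ s′ , ts′ Vec.++ us′)
    simulate halt us emp = us , emp , halt
    simulate {s} {ts} (then eq st) us emp with step-just⁻¹ M s ts eq
    ... | s₁ , a , δ≡ , refl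
      with simulate st (apply (keep (reads us)) us) (λ j → trans (reg-keep us j) (emp j))
    ...   | us′ , emp′ , st′ = us′ , emp′ , then step≡ st′
      where
      δ⁺≡ : δ⁺ (inj₁ s) (reads {N + D} (ts Vec.++ us)) ≡ just (inj₁ s₁ , a Vec.++ keep (reads us))
      δ⁺≡ = cong₂ (λ x y → beside x y (reads {N + D} (ts Vec.++ us)))
        (trans (cong (δ s) (take-reads ts us)) δ≡) (drop-reads ts us)
      step≡ : TM.step append (inj₁ s , ts Vec.++ us) ≡
              just (inj₁ s₁ , apply a ts Vec.++ apply (keep (reads us)) us)
      step≡ = trans (step-just append (inj₁ s) (ts Vec.++ us) δ⁺≡)
        (cong (λ x → just (inj₁ s₁ , x)) (Vec.zipWith-++ _ a (keep (reads us)) ts us))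

    switch : ∀ s ts us → step (s , ts) ≡ nothing →
      TM.step append (inj₁ s , ts Vec.++ us) ≡
      just (inj₂ (just (entry p)) , apply (keep (reads {N + D} (ts Vec.++ us))) (ts Vec.++ us))
    switch s ts us eq = step-just append (inj₁ s) (ts Vec.++ us) δ⁺≡
      where
      δ⁺≡ : δ⁺ (inj₁ s) (reads {N + D} (ts Vec.++ us)) ≡
            just (inj₂ (just (entry p)) , keep (reads {N + D} (ts Vec.++ us)))
      δ⁺≡ = cong (λ x → beside x (Vec.drop N {D} (reads {N + D} (ts Vec.++ us))) (reads {N + D} (ts Vec.++ us)))
        (trans (cong (δ s) (take-reads ts us)) (step-nothing⁻¹ M s ts eq))

    exec : ∀ {c ts n ts′} → Exec p c ts n ts′ →
           Steps append (inj₂ (just c) , ts) n (inj₂ nothing , ts′)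
    exec {c} {ts} (stop eq) = then
      (trans (step-just append (inj₂ (just c)) ts refl) (cong (λ o → just (inj₂ o , after p c ts)) eq))
      halt
    exec {c} {ts} (more eq e) = then
      (trans (step-just append (inj₂ (just c)) ts refl) (cong (λ o → just (inj₂ o , after p c ts)) eq))
      (exec e)

    initial-append : ∀ w → TM.initial append w ≡
      (inj₁ start , proj₂ (initial w) Vec.++ Vec.replicate D ([] ◂ []))
    initial-append w = cong (λ ts → inj₁ start , ([] ◂ List.map just w) ∷ ts) (replicate-++ extraTapes)

    -- The hypothesis on p assumes nothing about the other tapes of the halted machine, which may
    -- hold anything. The additional step in `suc n` is the transition that hands over control.
    append-correct : ∀ t w {v n v′} → run t (initial w) ≡ just v →
      (∀ ts → reg ts zero ≡ v → (∀ j → reg ts (N ↑ʳ j) ≡ []) →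
        Run p (entry p) ts n λ ts′ → reg ts′ zero ≡ v′) →
      TM.run append (t + suc n) (TM.initial append w) ≡ just v′
    append-correct t w {v} {n} run≡ k with run-sound M t run≡
    ... | n₁ , (s , ts) , n₁≤t , st , stops , out≡
      with simulate st (Vec.replicate D ([] ◂ [])) (λ j → cong top (Vec.lookup-replicate j _))
    ...   | us , emp , st′
      with k (apply (keep (reads {N + D} (ts Vec.++ us))) (ts Vec.++ us)) reg₀ rest
      where
      reg₀ : reg (apply (keep (reads {N + D} (ts Vec.++ us))) (ts Vec.++ us)) zero ≡ v
      reg₀ = trans (reg-keep (ts Vec.++ us) zero)
        (trans (cong top (Vec.lookup-++ˡ ts us zero)) (trans (sym (output≡reg M s ts)) out≡))
      rest : ∀ j → reg (apply (keep (reads {N + D} (ts Vec.++ us))) (ts Vec.++ us)) (N ↑ʳ j) ≡ []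
      rest j = trans (reg-keep (ts Vec.++ us) (N ↑ʳ j))
        (trans (cong top (Vec.lookup-++ʳ ts us j)) (emp j))
    ...     | ts′ , n₂ , ex , n₂≤n , post =
      trans (cong (TM.run append (t + suc n)) (initial-append w))
        (trans (run-complete append all (step-nothing append (inj₂ nothing) ts′ refl)
              (ℕ.+-mono-≤ n₁≤t (s≤s n₂≤n)))
        (cong just (trans (output≡reg append (inj₂ nothing) ts′) post)))
      where
      all : Steps append (inj₁ start , proj₂ (initial w) Vec.++ Vec.replicate D ([] ◂ []))
              (n₁ + suc n₂) (inj₂ nothing , ts′)
      all = steps-trans append st′ (then (switch s ts us stops) (exec ex))

  -- Scanning programs run in polynomial time

  length-⟦⟧ : ∀ {d n} (c : Cmd d n) (ρ : Vec Word n) m → (∀ i → length (lookup ρ i) ≤ m) →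
              length (⟦ c ⟧ ρ) ≤ eval (cost c) m
  length-⟦⟧ nop      ρ m len = z≤n
  length-⟦⟧ (emit b) ρ m len = s≤s z≤n
  length-⟦⟧ (c ⨾ c′) ρ m len rewrite List.length-++ (⟦ c ⟧ ρ) {⟦ c′ ⟧ ρ} | eval-⊕ (cost c) (cost c′) m =
    ℕ.+-mono-≤ (length-⟦⟧ c ρ m len) (length-⟦⟧ c′ ρ m len)
  length-⟦⟧ (scan i s next body) ρ m len
    rewrite eval-⊕ (9 ∷ []) (⨁ λ s → cost (body s true) ⊕ cost (body s false)) m = begin
      length (scanning next (λ s b → ⟦ body s b ⟧) s ρ (lookup ρ i)) ≤⟨ bound (lookup ρ i) s (len i) ⟩
      length (lookup ρ i) * T   ≤⟨ ℕ.*-mono-≤ (len i) (ℕ.m≤n+m T (9 + m * 0)) ⟩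
      m * (9 + m * 0 + T)       ≤⟨ ℕ.m≤n+m _ 3 ⟩
      3 + m * (9 + m * 0 + T)   ∎
    where
    open ℕ.≤-Reasoning
    T : ℕ
    T = eval (⨁ λ s → cost (body s true) ⊕ cost (body s false)) m
    bound : ∀ w s → length w ≤ m →
            length (scanning next (λ s b → ⟦ body s b ⟧) s ρ w) ≤ length w * T
    bound []      s le = z≤n
    bound (b ∷ w) s le rewrite List.length-++ (⟦ body s b ⟧ (w ∷ ρ))
                                 {scanning next (λ s b → ⟦ body s b ⟧) (next s b) ρ w} =
      ℕ.+-mono-≤
        (ℕ.≤-trans (length-⟦⟧ (body s b) (w ∷ ρ) m λ { zero → ℕ.<⇒≤ le ; (suc j) → len j })
          (cost-body body s b m))
        (bound w (next s b) (ℕ.<⇒≤ le))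

  module _ {d : ℕ} (c : Cmd d 1) {f : Word → Word} (f-poly : PolyTime f) where
    private
      module F = PolyTime f-poly
      open TM F.machine using (extraTapes)

      N : ℕ
      N = suc extraTapes + (2 + d)

      out tmp : Fin N
      out = suc extraTapes ↑ʳ zero
      tmp = suc extraTapes ↑ʳ suc zero

      ↑ʳ-≢ : ∀ {i j : Fin (2 + d)} → i ≢ j → suc extraTapes ↑ʳ i ≢ suc extraTapes ↑ʳ j
      ↑ʳ-≢ i≢j eq = i≢j (Fin.↑ʳ-injective (suc extraTapes) _ _ eq)

      out≢tmp : out ≢ tmp
      out≢tmp = ↑ʳ-≢ λ ()

      open Compile out≢tmp

      spare : ∀ {k} → (Fin k → Fin (2 + d)) → Vec (Fin N) k
      spare h = Vec.tabulate λ j → suc extraTapes ↑ʳ h j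

      lookup-spare : ∀ {k} (h : Fin k → Fin (2 + d)) i → lookup (spare h) i ≡ suc extraTapes ↑ʳ h i
      lookup-spare h i = Vec.lookup∘tabulate _ i

      spare≢ : ∀ {k} (h : Fin k → Fin (2 + d)) {i j} → h j ≢ i → lookup (spare h) j ≢ suc extraTapes ↑ʳ i
      spare≢ h {j = j} h≢ eq = ↑ʳ-≢ h≢ (trans (sym (lookup-spare h j)) eq)

      fresh-spare : ∀ {n k} (vars : Vec (Fin N) n) (h : Fin k → Fin (2 + d)) →
        (∀ {i j} → h i ≡ h j → i ≡ j) → (∀ i → h i ≢ zero) → (∀ i → h i ≢ suc zero) →
        (∀ i j → lookup vars i ≢ suc extraTapes ↑ʳ h j) → Fresh vars (spare h)
      fresh-spare {k = zero}  vars h inj h≢0 h≢1 vars≢ = []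
      fresh-spare {k = suc k} vars h inj h≢0 h≢1 vars≢ = new
        (↑ʳ-≢ (h≢0 zero)) (↑ʳ-≢ (h≢1 zero)) (λ i → vars≢ i zero)
        (λ i → spare≢ (h ∘ suc) λ eq → Fin.0≢1+n (sym (inj eq)))
        (fresh-spare _ (h ∘ suc) (Fin.suc-injective ∘ inj) (h≢0 ∘ suc) (h≢1 ∘ suc)
          λ { zero j → ↑ʳ-≢ λ eq → Fin.0≢1+n (inj eq) ; (suc i) j → vars≢ i (suc j) })

      vars : Vec (Fin N) 1
      vars = zero ∷ []

      beyond : Fin d → Fin (2 + d)
      beyond j = suc (suc j)

      free : Vec (Fin N) d
      free = spare beyond

      proper : Proper vars free
      proper = record
        { vars≢out = λ { zero () }
        ; vars≢tmp = λ { zero () }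
        ; free≢out = λ i → spare≢ beyond λ ()
        ; free≢tmp = λ i → spare≢ beyond λ ()
        ; fresh    = fresh-spare vars beyond
            (Fin.suc-injective ∘ Fin.suc-injective) (λ _ ()) (λ _ ()) (λ { zero _ () })
        }

      -- The output lies reversed in `out`, and pouring it into register zero reverses it again.
      -- Before that the input has to leave register zero; `tmp` merely takes it away.
      program : Prog N
      program = compile c vars free ⨾ each zero (push tmp) ⨾ each out (push zero)

      bound : ℕ → ℕ
      bound m = eval (cost c) m + (suc (m * 3) + suc (eval (cost c) m * 3))

      program-correct : ∀ v m → length v ≤ m → ∀ ts → reg ts zero ≡ v →
        (∀ j → reg ts (suc extraTapes ↑ʳ j) ≡ []) →
        Run program (entry program) ts (bound m) λ ts′ → reg ts′ zero ≡ ⟦ c ⟧ (v ∷ [])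
      program-correct v m v≤m ts v≡ rest≡ =
        run-⨾ {p = compile c vars free} {q = each zero (push tmp) ⨾ each out (push zero)}
          (correct c proper len ts record
            { vars≡ = λ { zero → v≡ }
            ; free≡ = λ i → trans (cong (reg ts) (lookup-spare beyond i)) (rest≡ (suc (suc i)))
            ; tmp≡  = rest≡ (suc zero) })
          λ ts₁ (out₁ , same₁) →
        run-⨾ {p = each zero (push tmp)} {q = each out (push zero)}
          (weaken {p = each zero (push tmp)} (run-pour (λ ()) v ts₁ (trans (same₁ zero λ ()) v≡))
            (s≤s (ℕ.*-monoˡ-≤ 3 v≤m)) λ _ post → post)
          λ ts₂ (zero₂ , _ , same₂) →
        weaken {p = each out (push zero)}
          (run-pour {a = out} {c = zero} (λ ()) (⟦ c ⟧ (v ∷ []) ʳ++ []) ts₂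
            (trans (same₂ out (λ ()) out≢tmp)
              (trans out₁ (cong (⟦ c ⟧ (v ∷ []) ʳ++_) (rest≡ zero)))))
          (s≤s (ℕ.*-monoˡ-≤ 3 (ℕ.≤-trans (ℕ.≤-reflexive (length-ʳ++[] (⟦ c ⟧ (v ∷ []))))
            (length-⟦⟧ c (v ∷ []) m len))))
          λ ts₃ (_ , zero₃ , _) →
            trans zero₃ (trans (cong ((⟦ c ⟧ (v ∷ []) ʳ++ []) ʳ++_) zero₂)
              (ʳ++-reverse (⟦ c ⟧ (v ∷ []))))
        where
        len : ∀ (i : Fin 1) → length (lookup (v ∷ []) i) ≤ m
        len zero = v≤m

      open Append F.machine {2 + d} program using (append; append-correct)

      size : Polynomial
      size = (0 ∷ 1 ∷ []) ⊕ scale 2 F.time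

      total : Polynomial
      total = F.time ⊕ ((1 ∷ []) ⊕ (compose (cost c) size ⊕
        (((1 ∷ []) ⊕ scale 3 size) ⊕ ((1 ∷ []) ⊕ scale 3 (compose (cost c) size)))))

      eval-size : ∀ n → eval size n ≡ n + 2 * eval F.time n
      eval-size n rewrite eval-⊕ (0 ∷ 1 ∷ []) (scale 2 F.time) n | eval-scale 2 F.time n
                        | ℕ.*-zeroʳ n | ℕ.*-identityʳ n = refl

      eval-total : ∀ n → eval total n ≡ eval F.time n + suc (bound (eval size n))
      eval-total n
        rewrite eval-⊕ F.time ((1 ∷ []) ⊕ (compose (cost c) size ⊕
                  (((1 ∷ []) ⊕ scale 3 size) ⊕ ((1 ∷ []) ⊕ scale 3 (compose (cost c) size))))) n
              | eval-⊕ (1 ∷ []) (compose (cost c) size ⊕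
                  (((1 ∷ []) ⊕ scale 3 size) ⊕ ((1 ∷ []) ⊕ scale 3 (compose (cost c) size)))) n
              | eval-⊕ (compose (cost c) size)
                  (((1 ∷ []) ⊕ scale 3 size) ⊕ ((1 ∷ []) ⊕ scale 3 (compose (cost c) size))) n
              | eval-⊕ ((1 ∷ []) ⊕ scale 3 size) ((1 ∷ []) ⊕ scale 3 (compose (cost c) size)) n
              | eval-⊕ (1 ∷ []) (scale 3 size) n
              | eval-⊕ (1 ∷ []) (scale 3 (compose (cost c) size)) n
              | eval-scale 3 size n | eval-scale 3 (compose (cost c) size) n
              | eval-compose (cost c) size n | ℕ.*-zeroʳ n
              | ℕ.*-comm 3 (eval size n) | ℕ.*-comm 3 (eval (cost c) (eval size n)) = refl

      length-f : ∀ w → length (f w) ≤ eval size (length w)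
      length-f w with run-sound F.machine (eval F.time (length w)) (F.computes w)
      ... | n , c′ , n≤t , st , _ , out≡ = begin
        length (f w)                             ≡⟨ cong length out≡ ⟨
        length (TM.output F.machine c′)          ≤⟨ length-output F.machine c′ ⟩
        extent F.machine c′                      ≤⟨ extent-steps F.machine st ⟩
        length (List.map just w) + 2 * n         ≡⟨ cong (_+ 2 * n) (List.length-map just w) ⟩
        length w + 2 * n                         ≤⟨ ℕ.+-monoʳ-≤ (length w) (ℕ.*-monoʳ-≤ 2 n≤t) ⟩
        length w + 2 * eval F.time (length w)    ≡⟨ eval-size (length w) ⟨
        eval size (length w)                     ∎
        where open ℕ.≤-Reasoning

    -- Stated for the composite with f, so that stages can be chained onto a given reduction without
    -- a general theorem on composition.
    polyTime-⟦⟧ : PolyTime (λ w → ⟦ c ⟧ (f w ∷ []))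
    polyTime-⟦⟧ = record { machine = append ; time = total ; computes = computes }
      where
      computes : ∀ w → TM.run append (eval total (length w)) (TM.initial append w) ≡
                       just (⟦ c ⟧ (f w ∷ []))
      computes w = trans
        (cong (λ t → TM.run append t (TM.initial append w)) (eval-total (length w)))
        (append-correct (eval F.time (length w)) w
          {v = f w} {n = bound (eval size (length w))} {v′ = ⟦ c ⟧ (f w ∷ [])} (F.computes w)
          (program-correct (f w) (eval size (length w)) (length-f w)))

-- Contraction of starred games and of their products

module Amplification where

  open import Data.Bool.Base using (Bool; true; false; if_then_else_; _∧_)
  import Data.Bool.Properties as Bool
  open import Data.Empty using (⊥-elim)
  open import Data.Fin.Base using (Fin; zero; suc; _↑ˡ_; _↑ʳ_; combine; remQuot)
  import Data.Fin.Properties as Fin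
  import Data.Integer.Base as ℤ
  import Data.Integer.Properties as ℤ
  open import Data.List.Base as List
    using (List; []; _∷_; _++_; allFin; map; cartesianProduct; cartesianProductWith; concatMap)
  import Data.List.Properties as List
  open import Data.List.Membership.Propositional using (_∈_)
  open import Data.List.Membership.Propositional.Properties
    using (∈-allFin; ∈-cartesianProduct⁻; ∈-cartesianProductWith⁻)
  open import Data.List.Relation.Unary.Any using (here; there)
  open import Data.Nat.Base as ℕ using (ℕ; zero; suc)
  import Data.Nat.Properties as ℕ
  open import Data.Product.Base using (∃-syntax; _×_; _,_; proj₁; proj₂)
  open import Data.Rational.Base as ℚ using (ℚ; 0ℚ; 1ℚ; ½; _+_; _*_; -_; _-_; _≤_; _<_; 1/_)
  import Data.Rational.Properties as ℚ
  open import Data.Rational.Solver using (module +-*-Solver)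
  import Data.Rational.Unnormalised.Base as ℚᵘ
  import Data.Rational.Unnormalised.Properties as ℚᵘ
  open import Data.Sum.Base using (inj₁; inj₂)
  open import Function.Base using (_∘_; id)
  open import Relation.Binary.PropositionalEquality
  open import Relation.Nullary using (yes; no; does)
  open +-*-Solver using (solve; _:+_; _:*_; _:-_; _:=_; con; :-_)

  -- Rational arithmetic

  0≤+ : ∀ {p q} → 0ℚ ≤ p → 0ℚ ≤ q → 0ℚ ≤ p + q
  0≤+ 0≤p 0≤q = ℚ.+-mono-≤ 0≤p 0≤q

  *-mono-≤ˡ : ∀ {r p q} → 0ℚ ≤ r → p ≤ q → r * p ≤ r * q
  *-mono-≤ˡ {r} 0≤r = ℚ.*-monoˡ-≤-nonNeg r {{ℚ.nonNegative 0≤r}}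

  *-mono-≤ʳ : ∀ {r p q} → 0ℚ ≤ r → p ≤ q → p * r ≤ q * r
  *-mono-≤ʳ {r} 0≤r = ℚ.*-monoʳ-≤-nonNeg r {{ℚ.nonNegative 0≤r}}

  0≤* : ∀ {p q} → 0ℚ ≤ p → 0ℚ ≤ q → 0ℚ ≤ p * q
  0≤* {p} 0≤p 0≤q = ℚ.≤-trans (ℚ.≤-reflexive (sym (ℚ.*-zeroʳ p))) (*-mono-≤ˡ 0≤p 0≤q)

  0<* : ∀ {p q} → 0ℚ < p → 0ℚ < q → 0ℚ < p * q
  0<* {p} {q} 0<p 0<q =
    ℚ.positive⁻¹ (p * q) {{ℚ.pos*pos⇒pos p {{ℚ.positive 0<p}} q {{ℚ.positive 0<q}}}}

  0≤² : ∀ p → 0ℚ ≤ p * p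
  0≤² p with ℚ.≤-total 0ℚ p
  ... | inj₁ 0≤p = 0≤* 0≤p 0≤p
  ... | inj₂ p≤0 = subst (0ℚ ≤_) (solve 1 (λ p → (:- p) :* (:- p) := p :* p) refl p)
    (0≤* 0≤-p 0≤-p)
    where
    0≤-p : 0ℚ ≤ - p
    0≤-p = ℚ.neg-antimono-≤ p≤0

  ≤-by : ∀ {p q} d → 0ℚ ≤ d → p + d ≡ q → p ≤ q
  ≤-by {p} d 0≤d refl = ℚ.≤-trans (ℚ.≤-reflexive (sym (ℚ.+-identityʳ p))) (ℚ.+-monoʳ-≤ p 0≤d)

  0≤difference : ∀ {p q} → p ≤ q → 0ℚ ≤ q - p
  0≤difference {p} {q} p≤q =
    ℚ.≤-trans (ℚ.≤-reflexive (sym (ℚ.+-inverseʳ p))) (ℚ.+-monoˡ-≤ (- p) p≤q)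

  0≤1 : 0ℚ ≤ 1ℚ
  0≤1 = ℚ.nonNegative⁻¹ 1ℚ

  2ℚ : ℚ
  2ℚ = 1ℚ + 1ℚ

  -- A total reciprocal, so that averages can be formed without a proof of positivity in their
  -- definition; such a proof is asked for only where a factor has to cancel.
  recip : ℚ → ℚ
  recip p with 0ℚ ℚ.<? p
  ... | yes 0<p = (1/ p) {{ℚ.pos⇒nonZero p {{ℚ.positive 0<p}}}}
  ... | no _    = 0ℚ

  0≤recip : ∀ p → 0ℚ ≤ recip p
  0≤recip p with 0ℚ ℚ.<? p
  ... | yes 0<p = ℚ.<⇒≤ (ℚ.positive⁻¹ _ {{ℚ.1/pos⇒pos p {{ℚ.positive 0<p}}}})
  ... | no _    = ℚ.≤-refl

  *-recip : ∀ p → 0ℚ < p → p * recip p ≡ 1ℚ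
  *-recip p 0<p with 0ℚ ℚ.<? p
  ... | yes 0<p′ = ℚ.*-inverseʳ p {{ℚ.pos⇒nonZero p {{ℚ.positive 0<p′}}}}
  ... | no ≮     = ⊥-elim (≮ 0<p)

  *-recip≤1 : ∀ p → p * recip p ≤ 1ℚ
  *-recip≤1 p with 0ℚ ℚ.<? p
  ... | yes 0<p = ℚ.≤-reflexive (ℚ.*-inverseʳ p {{ℚ.pos⇒nonZero p {{ℚ.positive 0<p}}}})
  ... | no _    = ℚ.≤-trans (ℚ.≤-reflexive (ℚ.*-zeroʳ p)) 0≤1

  cancel-half : ∀ {p q} → 2ℚ * p ≤ p + q → p ≤ q
  cancel-half {p} {q} le = ≤-by ((p + q) - 2ℚ * p) (0≤difference le)
    (solve 2 (λ p q → p :+ (p :+ q :- con 2ℚ :* p) := q) refl p q)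

  -- Finite sums

  ∑ : {X : Set} → List X → (X → ℚ) → ℚ
  ∑ []       f = 0ℚ
  ∑ (x ∷ xs) f = f x + ∑ xs f

  module _ {X : Set} where

    ∑-cong-∈ : ∀ (xs : List X) {f g : X → ℚ} → (∀ x → x ∈ xs → f x ≡ g x) → ∑ xs f ≡ ∑ xs g
    ∑-cong-∈ []       eq = refl
    ∑-cong-∈ (x ∷ xs) eq = cong₂ _+_ (eq x (here refl)) (∑-cong-∈ xs λ y y∈ → eq y (there y∈))

    ∑-cong : ∀ (xs : List X) {f g : X → ℚ} → (∀ x → f x ≡ g x) → ∑ xs f ≡ ∑ xs g
    ∑-cong xs eq = ∑-cong-∈ xs λ x _ → eq x

    ∑-mono : ∀ (xs : List X) {f g : X → ℚ} → (∀ x → f x ≤ g x) → ∑ xs f ≤ ∑ xs g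
    ∑-mono []       le = ℚ.≤-refl
    ∑-mono (x ∷ xs) le = ℚ.+-mono-≤ (le x) (∑-mono xs le)

    ∑-0 : ∀ (xs : List X) → ∑ xs (λ _ → 0ℚ) ≡ 0ℚ
    ∑-0 []       = refl
    ∑-0 (x ∷ xs) = trans (ℚ.+-identityˡ _) (∑-0 xs)

    0≤∑ : ∀ (xs : List X) {f : X → ℚ} → (∀ x → 0ℚ ≤ f x) → 0ℚ ≤ ∑ xs f
    0≤∑ xs 0≤f = ℚ.≤-trans (ℚ.≤-reflexive (sym (∑-0 xs))) (∑-mono xs 0≤f)

    ∑-+ : ∀ (xs : List X) (f g : X → ℚ) → ∑ xs (λ x → f x + g x) ≡ ∑ xs f + ∑ xs g
    ∑-+ []       f g = refl
    ∑-+ (x ∷ xs) f g rewrite ∑-+ xs f g =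
      solve 4 (λ a b c d → a :+ b :+ (c :+ d) := a :+ c :+ (b :+ d)) refl (f x) (g x) (∑ xs f) (∑ xs g)

    *-∑ : ∀ (xs : List X) c (f : X → ℚ) → c * ∑ xs f ≡ ∑ xs (λ x → c * f x)
    *-∑ []       c f = ℚ.*-zeroʳ c
    *-∑ (x ∷ xs) c f = trans (ℚ.*-distribˡ-+ c (f x) (∑ xs f)) (cong (c * f x +_) (*-∑ xs c f))

    ∑-* : ∀ (xs : List X) c (f : X → ℚ) → ∑ xs f * c ≡ ∑ xs (λ x → f x * c)
    ∑-* xs c f = trans (ℚ.*-comm _ c) (trans (*-∑ xs c f) (∑-cong xs λ x → ℚ.*-comm c (f x)))

    ∑-++ : ∀ (xs ys : List X) {f : X → ℚ} → ∑ (xs ++ ys) f ≡ ∑ xs f + ∑ ys f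
    ∑-++ []       ys     = sym (ℚ.+-identityˡ _)
    ∑-++ (x ∷ xs) ys {f} = trans (cong (f x +_) (∑-++ xs ys)) (sym (ℚ.+-assoc (f x) _ _))

    term≤∑ : ∀ {xs : List X} {f : X → ℚ} → (∀ x → 0ℚ ≤ f x) → ∀ {x} → x ∈ xs → f x ≤ ∑ xs f
    term≤∑ {y ∷ xs} {f} 0≤f (here refl) = ≤-by (∑ xs f) (0≤∑ xs 0≤f) refl
    term≤∑ {y ∷ xs} {f} 0≤f (there x∈)  =
      ℚ.≤-trans (term≤∑ 0≤f x∈) (≤-by (f y) (0≤f y) (ℚ.+-comm (∑ xs f) (f y)))

  ∑-map : ∀ {X Y : Set} (h : X → Y) xs {f : Y → ℚ} → ∑ (map h xs) f ≡ ∑ xs (f ∘ h)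
  ∑-map h []           = refl
  ∑-map h (x ∷ xs) {f} = cong (f (h x) +_) (∑-map h xs)

  ∑-concatMap : ∀ {X Y : Set} (h : X → List Y) xs {f : Y → ℚ} →
                ∑ (concatMap h xs) f ≡ ∑ xs λ x → ∑ (h x) f
  ∑-concatMap h []           = refl
  ∑-concatMap h (x ∷ xs) {f} =
    trans (∑-++ (h x) (concatMap h xs)) (cong (∑ (h x) f +_) (∑-concatMap h xs))

  ∑-cartesian : ∀ {X Y Z : Set} (h : X → Y → Z) xs ys {f : Z → ℚ} →
                ∑ (cartesianProductWith h xs ys) f ≡ ∑ xs λ x → ∑ ys λ y → f (h x y)
  ∑-cartesian h []       ys     = refl
  ∑-cartesian h (x ∷ xs) ys {f} = trans (∑-++ (map (h x) ys) (cartesianProductWith h xs ys))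
    (cong₂ _+_ (∑-map (h x) ys) (∑-cartesian h xs ys))

  ∑-swap : ∀ {X Y : Set} xs ys (f : X → Y → ℚ) →
           ∑ xs (λ x → ∑ ys λ y → f x y) ≡ ∑ ys λ y → ∑ xs λ x → f x y
  ∑-swap []       ys f = sym (∑-0 ys)
  ∑-swap (x ∷ xs) ys f = trans (cong (∑ ys (f x) +_) (∑-swap xs ys f)) (sym (∑-+ ys (f x) _))

  ∑-exchange : ∀ {X Y : Set} xs ys (c : X → ℚ) (d : Y → ℚ) (f : X → Y → ℚ) →
    ∑ xs (λ x → c x * ∑ ys λ y → d y * f x y) ≡ ∑ ys λ y → d y * ∑ xs λ x → c x * f x y
  ∑-exchange xs ys c d f = begin
    ∑ xs (λ x → c x * ∑ ys λ y → d y * f x y)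
      ≡⟨ ∑-cong xs (λ x → *-∑ ys (c x) _) ⟩
    ∑ xs (λ x → ∑ ys λ y → c x * (d y * f x y))
      ≡⟨ ∑-swap xs ys _ ⟩
    ∑ ys (λ y → ∑ xs λ x → c x * (d y * f x y))
      ≡⟨ ∑-cong ys (λ y → ∑-cong xs λ x →
           solve 3 (λ a b c → a :* (b :* c) := b :* (a :* c)) refl (c x) (d y) (f x y)) ⟩
    ∑ ys (λ y → ∑ xs λ x → d y * (c x * f x y))
      ≡⟨ ∑-cong ys (λ y → sym (*-∑ xs (d y) _)) ⟩
    ∑ ys (λ y → d y * ∑ xs λ x → c x * f x y) ∎
    where open ≡-Reasoning

  ∑′ : ∀ {n} → (Fin n → ℚ) → ℚ
  ∑′ = ∑ (allFin _)

  ∑′-suc : ∀ {n} (f : Fin (suc n) → ℚ) → ∑′ f ≡ f zero + ∑′ (f ∘ suc)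
  ∑′-suc {n} f = cong (f zero +_)
    (trans (cong (λ xs → ∑ xs f) (sym (List.map-tabulate id suc))) (∑-map suc (allFin n)))

  ∑′-+ : ∀ m {n} (f : Fin (m ℕ.+ n) → ℚ) → ∑′ f ≡ ∑′ (λ i → f (i ↑ˡ n)) + ∑′ (λ j → f (m ↑ʳ j))
  ∑′-+ zero    f = sym (ℚ.+-identityˡ _)
  ∑′-+ (suc m) {n} f = begin
    ∑′ f                                             ≡⟨ ∑′-suc f ⟩
    f zero + ∑′ (f ∘ suc)                            ≡⟨ cong (f zero +_) (∑′-+ m (f ∘ suc)) ⟩
    f zero + (∑′ (λ i → f (suc i ↑ˡ n)) + ∑′ (λ j → f (suc m ↑ʳ j)))
      ≡⟨ ℚ.+-assoc (f zero) _ _ ⟨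
    f zero + ∑′ (λ i → f (suc i ↑ˡ n)) + ∑′ (λ j → f (suc m ↑ʳ j))
      ≡⟨ cong (_+ ∑′ (λ j → f (suc m ↑ʳ j))) (∑′-suc (λ i → f (i ↑ˡ n))) ⟨
    ∑′ (λ i → f (i ↑ˡ n)) + ∑′ (λ j → f (suc m ↑ʳ j)) ∎
    where open ≡-Reasoning

  ∑′-combine : ∀ m {n} (f : Fin (m ℕ.* n) → ℚ) → ∑′ f ≡ ∑′ {m} λ i → ∑′ {n} λ j → f (combine i j)
  ∑′-combine zero    f = refl
  ∑′-combine (suc m) {n} f = begin
    ∑′ f                                               ≡⟨ ∑′-+ n f ⟩
    ∑′ (λ j → f (j ↑ˡ m ℕ.* n)) + ∑′ (λ k → f (n ↑ʳ k))
      ≡⟨ cong (∑′ (λ j → f (j ↑ˡ m ℕ.* n)) +_) (∑′-combine m (λ k → f (n ↑ʳ k))) ⟩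
    ∑′ (λ j → f (j ↑ˡ m ℕ.* n)) + ∑′ {m} (λ i → ∑′ {n} λ j → f (n ↑ʳ combine i j))
      ≡⟨ ∑′-suc {m} (λ i → ∑′ {n} λ j → f (combine i j)) ⟨
    ∑′ {suc m} (λ i → ∑′ {n} λ j → f (combine i j)) ∎
    where open ≡-Reasoning

  δ[_,_] : ∀ {n} → Fin n → Fin n → ℚ
  δ[ i , j ] = if does (i Fin.≟ j) then 1ℚ else 0ℚ

  0≤δ : ∀ {n} (i j : Fin n) → 0ℚ ≤ δ[ i , j ]
  0≤δ i j with does (i Fin.≟ j)
  ... | true  = 0≤1
  ... | false = ℚ.≤-refl

  δ-idem : ∀ {n} (i j : Fin n) → δ[ i , j ] * δ[ i , j ] ≡ δ[ i , j ]
  δ-idem i j with does (i Fin.≟ j)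
  ... | true  = refl
  ... | false = refl

  δ-diag : ∀ {n} (i : Fin n) → δ[ i , i ] ≡ 1ℚ
  δ-diag i with i Fin.≟ i
  ... | yes _  = refl
  ... | no i≢i = ⊥-elim (i≢i refl)

  δ-subst : ∀ {n} (i j : Fin n) (h : Fin n → ℚ) → δ[ i , j ] * h i ≡ δ[ i , j ] * h j
  δ-subst i j h with i Fin.≟ j
  ... | yes refl = refl
  ... | no _     = trans (ℚ.*-zeroˡ (h i)) (sym (ℚ.*-zeroˡ (h j)))

  ∑′-δ : ∀ {n} (i : Fin n) (h : Fin n → ℚ) → ∑′ (λ j → δ[ i , j ] * h j) ≡ h i
  ∑′-δ {suc n} zero    h = begin
    ∑′ (λ j → δ[ zero , j ] * h j) ≡⟨ ∑′-suc {n} (λ j → δ[ zero , j ] * h j) ⟩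
    1ℚ * h zero + ∑′ {n} (λ j → 0ℚ * h (suc j))
      ≡⟨ cong₂ _+_ (ℚ.*-identityˡ (h zero)) (∑-cong (allFin n) λ j → ℚ.*-zeroˡ (h (suc j))) ⟩
    h zero + ∑′ {n} (λ j → 0ℚ)     ≡⟨ cong (h zero +_) (∑-0 (allFin n)) ⟩
    h zero + 0ℚ                    ≡⟨ ℚ.+-identityʳ (h zero) ⟩
    h zero                         ∎
    where open ≡-Reasoning
  ∑′-δ {suc n} (suc i) h = begin
    ∑′ (λ j → δ[ suc i , j ] * h j) ≡⟨ ∑′-suc {n} (λ j → δ[ suc i , j ] * h j) ⟩
    0ℚ * h zero + ∑′ {n} (λ j → δ[ suc i , suc j ] * h (suc j))
      ≡⟨ cong₂ _+_ (ℚ.*-zeroˡ (h zero)) (∑-cong (allFin n) λ j → cong (_* h (suc j)) (δ-suc j)) ⟩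
    0ℚ + ∑′ {n} (λ j → δ[ i , j ] * h (suc j)) ≡⟨ ℚ.+-identityˡ _ ⟩
    ∑′ {n} (λ j → δ[ i , j ] * h (suc j)) ≡⟨ ∑′-δ i (h ∘ suc) ⟩
    h (suc i) ∎
    where
    open ≡-Reasoning
    δ-suc : ∀ j → δ[ suc i , suc j ] ≡ δ[ i , j ]
    δ-suc j with i Fin.≟ j
    ... | yes _ = refl
    ... | no _  = refl

  ∑′-δ₁ : ∀ {n} (i : Fin n) → ∑′ (λ j → δ[ i , j ]) ≡ 1ℚ
  ∑′-δ₁ {n} i =
    trans (∑-cong (allFin n) λ j → sym (ℚ.*-identityʳ δ[ i , j ])) (∑′-δ i λ _ → 1ℚ)

  argmax : ∀ {n} .{{_ : ℕ.NonZero n}} (c : Fin n → ℚ) → ∃[ i ] ∀ j → c j ≤ c i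
  argmax {suc zero}    c = zero , λ { zero → ℚ.≤-refl }
  argmax {suc (suc n)} c with argmax {suc n} (c ∘ suc)
  ... | i , max with ℚ.≤-total (c (suc i)) (c zero)
  ...   | inj₁ le = zero  , λ { zero → ℚ.≤-refl ; (suc j) → ℚ.≤-trans (max j) le }
  ...   | inj₂ le = suc i , λ { zero → le ; (suc j) → max j }

  ∑′-≤-max : ∀ {n} (p c : Fin n → ℚ) m → (∀ j → 0ℚ ≤ p j) → ∑′ p ≤ 1ℚ → 0ℚ ≤ m →
             (∀ j → c j ≤ m) → ∑′ (λ j → p j * c j) ≤ m
  ∑′-≤-max {n} p c m 0≤p ∑p≤1 0≤m c≤m = begin
    ∑′ (λ j → p j * c j) ≤⟨ ∑-mono (allFin n) (λ j → *-mono-≤ˡ (0≤p j) (c≤m j)) ⟩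
    ∑′ (λ j → p j * m)   ≡⟨ ∑-* (allFin n) m p ⟨
    ∑′ p * m             ≤⟨ *-mono-≤ʳ 0≤m ∑p≤1 ⟩
    1ℚ * m               ≡⟨ ℚ.*-identityˡ m ⟩
    m                    ∎
    where open ℚ.≤-Reasoning

  -- Games with dyadic weights

  infixl 7 _⊗_
  infixl 7 _⊠_

  -- An edge of weight 2 ^ up / 2 ^ down; (α , β) is in the constraint iff
  -- allowed α β is true.
  record Arc (n q : ℕ) : Set where
    field
      u v        : Fin n
      up down    : ℕ
      allowed    : Fin q → Fin q → Bool
      functional : ∀ β {α α′} → allowed α β ≡ true → allowed α′ β ≡ true → α ≡ α′

  open Arc

  pow : ℚ → ℕ → ℚ
  pow p zero    = 1ℚ
  pow p (suc k) = p * pow p k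

  pow-+ : ∀ p j k → pow p (j ℕ.+ k) ≡ pow p j * pow p k
  pow-+ p zero    k = sym (ℚ.*-identityˡ _)
  pow-+ p (suc j) k = trans (cong (p *_) (pow-+ p j k)) (sym (ℚ.*-assoc p _ _))

  0<pow : ∀ p → 0ℚ < p → ∀ k → 0ℚ < pow p k
  0<pow p 0<p zero    = ℚ.positive⁻¹ 1ℚ
  0<pow p 0<p (suc k) = 0<* 0<p (0<pow p 0<p k)

  wt : ∀ {n q} → Arc n q → ℚ
  wt e = pow 2ℚ (up e) * pow ½ (down e)

  0<wt : ∀ {n q} (e : Arc n q) → 0ℚ < wt e
  0<wt e = 0<* (0<pow 2ℚ (ℚ.positive⁻¹ 2ℚ) (up e)) (0<pow ½ (ℚ.positive⁻¹ ½) (down e))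

  0≤wt : ∀ {n q} (e : Arc n q) → 0ℚ ≤ wt e
  0≤wt e = ℚ.<⇒≤ (0<wt e)

  indicator : Bool → ℚ
  indicator b = if b then 1ℚ else 0ℚ

  0≤indicator : ∀ b → 0ℚ ≤ indicator b
  0≤indicator true  = 0≤1
  0≤indicator false = ℚ.≤-refl

  indicator-∧ : ∀ a b → indicator (a ∧ b) ≡ indicator a * indicator b
  indicator-∧ true  b = sym (ℚ.*-identityˡ (indicator b))
  indicator-∧ false b = sym (ℚ.*-zeroˡ (indicator b))

  A : ∀ {n q} → Arc n q → Fin q → Fin q → ℚ
  A e α β = indicator (allowed e α β)

  -- The projection property in the form in which the estimates use it: carried along an edge, mass
  -- does not grow.
  ∑A≤1 : ∀ {n q} (e : Arc n q) β → ∑′ (λ α → A e α β) ≤ 1ℚ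
  ∑A≤1 {n} {q} e β with Fin.any? (λ α → allowed e α β Bool.≟ true)
  ... | yes (α , ok) = ℚ.≤-trans (∑-mono (allFin q) below) (ℚ.≤-reflexive (∑′-δ₁ α))
    where
    below : ∀ α′ → A e α′ β ≤ δ[ α , α′ ]
    below α′ with allowed e α′ β in eq
    ... | false = 0≤δ α α′
    ... | true  = ℚ.≤-reflexive (sym (trans (cong δ[ α ,_] (functional e β eq ok)) (δ-diag α)))
  ... | no none = ℚ.≤-trans (∑-mono (allFin q) below)
                    (ℚ.≤-trans (ℚ.≤-reflexive (∑-0 (allFin q))) 0≤1)
    where
    below : ∀ α → A e α β ≤ 0ℚ
    below α with allowed e α β in eq
    ... | false = ℚ.≤-refl
    ... | true  = ⊥-elim (none (α , eq))

  ∧-true : ∀ {a b} → a ∧ b ≡ true → a ≡ true × b ≡ true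
  ∧-true {true} {true} _ = refl , refl

  both : ∀ {n q n′ q′} → Arc n q → Arc n′ q′ → Fin q × Fin q′ → Fin q × Fin q′ → Bool
  both e e′ (α , α′) (β , β′) = allowed e α β ∧ allowed e′ α′ β′

  both-functional : ∀ {n q n′ q′} (e : Arc n q) (e′ : Arc n′ q′) δ {γ γ′} →
    both e e′ γ δ ≡ true → both e e′ γ′ δ ≡ true → γ ≡ γ′
  both-functional e e′ (β , β′) ok ok′ = cong₂ _,_
    (functional e β (proj₁ (∧-true ok)) (proj₁ (∧-true ok′)))
    (functional e′ β′ (proj₂ (∧-true ok)) (proj₂ (∧-true ok′)))

  remQuot-injective : ∀ {m} k {i j : Fin (m ℕ.* k)} → remQuot {m} k i ≡ remQuot k j → i ≡ j
  remQuot-injective {m} k {i} {j} eq = trans (sym (Fin.combine-remQuot {m} k i))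
    (trans (cong (λ (a , b) → combine a b) eq) (Fin.combine-remQuot {m} k j))

  -- The two exponents of a weight are added separately and never cancelled against each other, so
  -- that the program for squaring needs no subtraction.
  _⊗_ : ∀ {n q n′ q′} → Arc n q → Arc n′ q′ → Arc (n ℕ.* n′) (q ℕ.* q′)
  _⊗_ {q = q} {q′ = q′} e e′ = record
    { u          = combine (u e) (u e′)
    ; v          = combine (v e) (v e′)
    ; up         = up e ℕ.+ up e′
    ; down       = down e ℕ.+ down e′
    ; allowed    = λ γ δ → both e e′ (remQuot {q} q′ γ) (remQuot {q} q′ δ)
    ; functional = λ δ ok ok′ →
        remQuot-injective {q} q′ (both-functional e e′ (remQuot {q} q′ δ) ok ok′)
    }

  _⊠_ : ∀ {n q n′ q′} → List (Arc n q) → List (Arc n′ q′) → List (Arc (n ℕ.* n′) (q ℕ.* q′))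
  _⊠_ = cartesianProductWith _⊗_

  wt-⊗ : ∀ {n q n′ q′} (e : Arc n q) (e′ : Arc n′ q′) → wt (e ⊗ e′) ≡ wt e * wt e′
  wt-⊗ e e′ rewrite pow-+ 2ℚ (up e) (up e′) | pow-+ ½ (down e) (down e′) =
    solve 4 (λ a b c d → a :* b :* (c :* d) := a :* c :* (b :* d)) refl
      (pow 2ℚ (up e)) (pow 2ℚ (up e′)) (pow ½ (down e)) (pow ½ (down e′))

  A-⊗ : ∀ {n q n′ q′} (e : Arc n q) (e′ : Arc n′ q′) α α′ β β′ →
        A (e ⊗ e′) (combine α α′) (combine β β′) ≡ A e α β * A e′ α′ β′
  A-⊗ e e′ α α′ β β′ = trans
    (cong₂ (λ γ δ → indicator (both e e′ γ δ)) (Fin.remQuot-combine α α′) (Fin.remQuot-combine β β′))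
    (indicator-∧ (allowed e α β) (allowed e′ α′ β′))

  -- Fractional assignments

  Fun : ℕ → ℕ → Set
  Fun n q = Fin n → Fin q → ℚ

  NonNeg : ∀ {n q} → Fun n q → Set
  NonNeg x = ∀ i α → 0ℚ ≤ x i α

  module _ {n q : ℕ} (es : List (Arc n q)) where

    -- Edges and labels are flattened into one index list, which makes `B` and `⟪_,_⟫` single
    -- weighted sums to which `∑-exchange` applies.
    cells₂ : List (Arc n q × Fin q)
    cells₂ = cartesianProduct es (allFin q)

    cells₃ : List (Arc n q × Fin q × Fin q)
    cells₃ = cartesianProduct es (cartesianProduct (allFin q) (allFin q))

    w₃ : Arc n q × Fin q × Fin q → ℚ
    w₃ (e , α , β) = wt e * A e α β

    at₃ : Fun n q → Fun n q → Arc n q × Fin q × Fin q → ℚ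
    at₃ x f (e , α , β) = x (u e) α * f (v e) β

    at₂ : Fun n q → Fun n q → Arc n q × Fin q → ℚ
    at₂ x y (e , α) = x (u e) α * y (u e) α

    W : ℚ
    W = ∑ es wt

    -- For deterministic x and f this is the weight of the satisfied edges.
    B : Fun n q → Fun n q → ℚ
    B x f = ∑ cells₃ λ t → w₃ t * at₃ x f t

    -- The inner product on U × Σ in which a vertex counts with the total weight of its edges.
    ⟪_,_⟫ : Fun n q → Fun n q → ℚ
    ⟪ x , y ⟫ = ∑ cells₂ λ t → wt (proj₁ t) * at₂ x y t

    mass² : Fun n q → ℚ
    mass² f = ∑ es λ e → wt e * (∑′ (f (v e)) * ∑′ (f (v e)))

    -- By scaling x this is equivalent to (B x f)² ≤ c ⟪x,x⟫ `mass²` f. The additive form avoids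
    -- roots, and instances of it for different slices of x and f can be added up.
    Contracts : ℚ → Set
    Contracts c = ∀ x f → NonNeg x → NonNeg f → 2ℚ * B x f ≤ ⟪ x , x ⟫ + c * mass² f

    ∑-cells₂ : ∀ k → ∑ cells₂ k ≡ ∑ es λ e → ∑′ λ α → k (e , α)
    ∑-cells₂ k = ∑-cartesian _,_ es (allFin q)

    ∑-cells₃ : ∀ k → ∑ cells₃ k ≡ ∑ es λ e → ∑′ λ α → ∑′ λ β → k (e , α , β)
    ∑-cells₃ k = trans (∑-cartesian _,_ es (cartesianProduct (allFin q) (allFin q)))
      (∑-cong es λ e → ∑-cartesian _,_ (allFin q) (allFin q))

    -- The operator defined by ⟪ x , op f ⟫ = B x f: it averages over the
    -- edges at a vertex u.  At a vertex without edges its value is 0.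
    degree : Fin n → ℚ
    degree i = ∑ es λ e → wt e * δ[ i , u e ]

    flow : Fun n q → Fin n → Fin q → ℚ
    flow f i α = ∑ cells₃ λ (e , α′ , β) → w₃ (e , α′ , β) * (δ[ u e , i ] * δ[ α′ , α ] * f (v e) β)

    op : Fun n q → Fun n q
    op f i α = flow f i α * recip (degree i)

    0<degree : ∀ {e} → e ∈ es → 0ℚ < degree (u e)
    0<degree {e} e∈ = ℚ.<-≤-trans (0<wt e) (ℚ.≤-trans
      (ℚ.≤-reflexive (sym (trans (cong (wt e *_) (δ-diag (u e))) (ℚ.*-identityʳ (wt e)))))
      (term≤∑ (λ e′ → 0≤* (0≤wt e′) (0≤δ (u e) (u e′))) e∈))

    -- Once the sums are exchanged, the edges at `u e′` contribute its degree, which cancels against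
    -- `recip`. The degree is positive because e′ itself is in the list; this is why membership is
    -- carried through the sum.
    dual : ∀ x f → ⟪ x , op f ⟫ ≡ B x f
    dual x f = begin
      ⟪ x , op f ⟫
        ≡⟨ ∑-cong cells₂ (λ (e , α) → solve 4 (λ a b c d → a :* (b :* (c :* d)) := a :* (b :* d) :* c)
             refl (wt e) (x (u e) α) (flow f (u e) α) (recip (degree (u e)))) ⟩
      ∑ cells₂ (λ s → c s * ∑ cells₃ λ t → w₃ t * k s t)
        ≡⟨ ∑-exchange cells₂ cells₃ c w₃ k ⟩
      ∑ cells₃ (λ t → w₃ t * ∑ cells₂ λ s → c s * k s t)
        ≡⟨ ∑-cong-∈ cells₃ (λ t t∈ → cong (w₃ t *_) (inner t (proj₁ (∈-cartesianProduct⁻ es _ t∈)))) ⟩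
      B x f ∎
      where
      open ≡-Reasoning
      r : Fin n → ℚ
      r i = recip (degree i)
      c : Arc n q × Fin q → ℚ
      c (e , α) = wt e * (x (u e) α * r (u e))
      k : Arc n q × Fin q → Arc n q × Fin q × Fin q → ℚ
      k (e , α) (e′ , α′ , β) = δ[ u e′ , u e ] * δ[ α′ , α ] * f (v e′) β
      inner : ∀ t → proj₁ t ∈ es → ∑ cells₂ (λ s → c s * k s t) ≡ at₃ x f t
      inner (e′ , α′ , β) e′∈ = begin
        ∑ cells₂ (λ s → c s * k s (e′ , α′ , β))
          ≡⟨ ∑-cells₂ _ ⟩
        ∑ es (λ e → ∑′ λ α → c (e , α) * k (e , α) (e′ , α′ , β))
          ≡⟨ ∑-cong es (λ e → ∑-cong (allFin q) λ α →
               solve 6 (λ w x r d d′ f → w :* (x :* r) :* (d :* d′ :* f) := d′ :* (w :* (d :* (x :* r)) :* f))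
                 refl (wt e) (x (u e) α) (r (u e)) δ[ u e′ , u e ] δ[ α′ , α ] y) ⟩
        ∑ es (λ e → ∑′ λ α → δ[ α′ , α ] * (wt e * (δ[ u e′ , u e ] * (x (u e) α * r (u e))) * y))
          ≡⟨ ∑-cong es (λ e → ∑′-δ α′ (λ α → wt e * (δ[ u e′ , u e ] * (x (u e) α * r (u e))) * y)) ⟩
        ∑ es (λ e → wt e * (δ[ u e′ , u e ] * (x (u e) α′ * r (u e))) * y)
          ≡⟨ ∑-cong es (λ e → cong (λ z → wt e * z * y)
               (sym (δ-subst (u e′) (u e) (λ i → x i α′ * r i)))) ⟩
        ∑ es (λ e → wt e * (δ[ u e′ , u e ] * (x (u e′) α′ * r (u e′))) * y)
          ≡⟨ ∑-cong es (λ e → solve 4 (λ a b c d → a :* (b :* c) :* d := a :* b :* (c :* d)) refl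
               (wt e) δ[ u e′ , u e ] (x (u e′) α′ * r (u e′)) y) ⟩
        ∑ es (λ e → wt e * δ[ u e′ , u e ] * (x (u e′) α′ * r (u e′) * y))
          ≡⟨ ∑-* es (x (u e′) α′ * r (u e′) * y) (λ e → wt e * δ[ u e′ , u e ]) ⟨
        degree (u e′) * (x (u e′) α′ * r (u e′) * y)
          ≡⟨ solve 4 (λ a b c d → a :* (b :* c :* d) := a :* c :* (b :* d)) refl
               (degree (u e′)) (x (u e′) α′) (r (u e′)) y ⟩
        degree (u e′) * r (u e′) * (x (u e′) α′ * y)
          ≡⟨ cong (_* (x (u e′) α′ * y)) (*-recip (degree (u e′)) (0<degree e′∈)) ⟩
        1ℚ * (x (u e′) α′ * y)
          ≡⟨ ℚ.*-identityˡ _ ⟩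
        x (u e′) α′ * y ∎
        where
        y : ℚ
        y = f (v e′) β

    0≤w₃ : ∀ t → 0ℚ ≤ w₃ t
    0≤w₃ (e , α , β) = 0≤* (0≤wt e) (0≤indicator (allowed e α β))

    op-nonNeg : ∀ {f} → NonNeg f → NonNeg (op f)
    op-nonNeg 0≤f i α = 0≤* (0≤∑ cells₃ λ (e , α′ , β) → 0≤* (0≤w₃ (e , α′ , β))
      (0≤* (0≤* (0≤δ (u e) i) (0≤δ α′ α)) (0≤f (v e) β))) (0≤recip (degree i))

    op-∑ : ∀ {X : Set} (xs : List X) (f : X → Fun n q) i α →
      op (λ j β → ∑ xs λ x → f x j β) i α ≡ ∑ xs λ x → op (f x) i α
    op-∑ xs f i α = begin
      flow (λ j β → ∑ xs λ x → f x j β) i α * r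
        ≡⟨ cong (_* r) (∑-cong cells₃ λ t → cong (w₃ t *_) (*-∑ xs (d t) _)) ⟩
      ∑ cells₃ (λ t → w₃ t * ∑ xs λ x → d t * g x t) * r
        ≡⟨ cong (_* r) (∑-cong cells₃ λ t → *-∑ xs (w₃ t) _) ⟩
      ∑ cells₃ (λ t → ∑ xs λ x → w₃ t * (d t * g x t)) * r
        ≡⟨ cong (_* r) (∑-swap cells₃ xs _) ⟩
      ∑ xs (λ x → flow (f x) i α) * r
        ≡⟨ ∑-* xs r _ ⟩
      ∑ xs (λ x → op (f x) i α) ∎
      where
      open ≡-Reasoning
      r : ℚ
      r = recip (degree i)
      d : Arc n q × Fin q × Fin q → ℚ
      d (e , α′ , β) = δ[ u e , i ] * δ[ α′ , α ]
      g : _ → Arc n q × Fin q × Fin q → ℚ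
      g x (e , α′ , β) = f x (v e) β

    -- The choice x = `op f` turns `B x f` into ⟪x,x⟫, one half of which the right side absorbs.
    op-contracts : ∀ {c} → Contracts c → ∀ f → NonNeg f → ⟪ op f , op f ⟫ ≤ c * mass² f
    op-contracts {c} ctr f 0≤f = cancel-half (subst (λ z → 2ℚ * z ≤ ⟪ op f , op f ⟫ + c * mass² f)
      (sym (dual (op f) f)) (ctr (op f) f (op-nonNeg 0≤f) 0≤f))

  -- Contraction constants multiply

  module _ {n q n′ q′ : ℕ} (es : List (Arc n q)) (es′ : List (Arc n′ q′)) where

    ∑-cells₃-⊠ : ∀ k → ∑ (cells₃ (es ⊠ es′)) k ≡
      ∑ (cells₃ es) λ (e , α , β) → ∑ (cells₃ es′) λ (e′ , α′ , β′) →
        k (e ⊗ e′ , combine α α′ , combine β β′)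
    ∑-cells₃-⊠ k = begin
      ∑ (cells₃ (es ⊠ es′)) k
        ≡⟨ ∑-cells₃ (es ⊠ es′) k ⟩
      ∑ (es ⊠ es′) (λ e → ∑′ λ γ → ∑′ λ δ → k (e , γ , δ))
        ≡⟨ ∑-cartesian _⊗_ es es′ ⟩
      ∑ es (λ e → ∑ es′ λ e′ → ∑′ λ γ → ∑′ λ δ → k (e ⊗ e′ , γ , δ))
        ≡⟨ (∑-cong es λ e → ∑-cong es′ λ e′ → trans (∑′-combine q _)
             (∑-cong (allFin q) λ α → ∑-cong (allFin q′) λ α′ → ∑′-combine q _)) ⟩
      ∑ es (λ e → ∑ es′ λ e′ → ∑′ λ α → ∑′ λ α′ → ∑′ λ β → ∑′ λ β′ → K e e′ α α′ β β′)
        ≡⟨ (∑-cong es λ e → ∑-swap es′ (allFin q) _) ⟩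
      ∑ es (λ e → ∑′ λ α → ∑ es′ λ e′ → ∑′ λ α′ → ∑′ λ β → ∑′ λ β′ → K e e′ α α′ β β′)
        ≡⟨ (∑-cong es λ e → ∑-cong (allFin q) λ α → ∑-cong es′ λ e′ → ∑-swap (allFin q′) (allFin q) _) ⟩
      ∑ es (λ e → ∑′ λ α → ∑ es′ λ e′ → ∑′ λ β → ∑′ λ α′ → ∑′ λ β′ → K e e′ α α′ β β′)
        ≡⟨ (∑-cong es λ e → ∑-cong (allFin q) λ α → ∑-swap es′ (allFin q) _) ⟩
      ∑ es (λ e → ∑′ λ α → ∑′ λ β → ∑ es′ λ e′ → ∑′ λ α′ → ∑′ λ β′ → K e e′ α α′ β β′)
        ≡⟨ (∑-cong es λ e → ∑-cong (allFin q) λ α → ∑-cong (allFin q) λ β → sym (∑-cells₃ es′ _)) ⟩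
      ∑ es (λ e → ∑′ λ α → ∑′ λ β → ∑ (cells₃ es′) λ (e′ , α′ , β′) → K e e′ α α′ β β′)
        ≡⟨ ∑-cells₃ es _ ⟨
      ∑ (cells₃ es) (λ (e , α , β) → ∑ (cells₃ es′) λ (e′ , α′ , β′) → K e e′ α α′ β β′) ∎
      where
      open ≡-Reasoning
      K : Arc n q → Arc n′ q′ → Fin q → Fin q′ → Fin q → Fin q′ → ℚ
      K e e′ α α′ β β′ = k (e ⊗ e′ , combine α α′ , combine β β′)

    ∑-cells₂-⊠ : ∀ k → ∑ (cells₂ (es ⊠ es′)) k ≡
      ∑ (cells₂ es) λ (e , α) → ∑ (cells₂ es′) λ (e′ , α′) → k (e ⊗ e′ , combine α α′)
    ∑-cells₂-⊠ k = begin
      ∑ (cells₂ (es ⊠ es′)) k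
        ≡⟨ ∑-cells₂ (es ⊠ es′) k ⟩
      ∑ (es ⊠ es′) (λ e → ∑′ λ γ → k (e , γ))
        ≡⟨ ∑-cartesian _⊗_ es es′ ⟩
      ∑ es (λ e → ∑ es′ λ e′ → ∑′ λ γ → k (e ⊗ e′ , γ))
        ≡⟨ (∑-cong es λ e → ∑-cong es′ λ e′ → ∑′-combine q _) ⟩
      ∑ es (λ e → ∑ es′ λ e′ → ∑′ λ α → ∑′ λ α′ → K e e′ α α′)
        ≡⟨ (∑-cong es λ e → ∑-swap es′ (allFin q) _) ⟩
      ∑ es (λ e → ∑′ λ α → ∑ es′ λ e′ → ∑′ λ α′ → K e e′ α α′)
        ≡⟨ (∑-cong es λ e → ∑-cong (allFin q) λ α → sym (∑-cells₂ es′ _)) ⟩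
      ∑ es (λ e → ∑′ λ α → ∑ (cells₂ es′) λ (e′ , α′) → K e e′ α α′)
        ≡⟨ ∑-cells₂ es _ ⟨
      ∑ (cells₂ es) (λ (e , α) → ∑ (cells₂ es′) λ (e′ , α′) → K e e′ α α′) ∎
      where
      open ≡-Reasoning
      K : Arc n q → Arc n′ q′ → Fin q → Fin q′ → ℚ
      K e e′ α α′ = k (e ⊗ e′ , combine α α′)

    W-⊠ : W (es ⊠ es′) ≡ W es * W es′
    W-⊠ = begin
      ∑ (es ⊠ es′) wt                           ≡⟨ ∑-cartesian _⊗_ es es′ ⟩
      ∑ es (λ e → ∑ es′ λ e′ → wt (e ⊗ e′))
        ≡⟨ (∑-cong es λ e → trans (∑-cong es′ (wt-⊗ e)) (sym (*-∑ es′ (wt e) wt))) ⟩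
      ∑ es (λ e → wt e * W es′)                 ≡⟨ ∑-* es (W es′) wt ⟨
      W es * W es′                              ∎
      where open ≡-Reasoning

    -- Sum out the second factor first: for fixed v and β it is the operator op of
    -- es′, which is linear, so that the masses of the result depend only on the
    -- masses of f.
    contracts-⊠ : ∀ {c c′} → 0ℚ ≤ c → Contracts es c → Contracts es′ c′ →
                  Contracts (es ⊠ es′) (c * c′)
    contracts-⊠ {c} {c′} 0≤c ctr ctr′ x f 0≤x 0≤f = begin
      2ℚ * B (es ⊠ es′) x f
        ≡⟨ cong (2ℚ *_) B≡ ⟩
      2ℚ * ∑ (cells₂ es′) (λ s → wt (proj₁ s) * B es (X s) (Y s))
        ≡⟨ trans (*-∑ (cells₂ es′) 2ℚ _) (∑-cong (cells₂ es′) λ s →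
             solve 3 (λ a b c → a :* (b :* c) := b :* (a :* c)) refl 2ℚ (wt (proj₁ s)) (B es (X s) (Y s))) ⟩
      ∑ (cells₂ es′) (λ s → wt (proj₁ s) * (2ℚ * B es (X s) (Y s)))
        ≤⟨ (∑-mono (cells₂ es′) λ s → *-mono-≤ˡ (0≤wt (proj₁ s))
             (ctr (X s) (Y s) (λ i α → 0≤x _ _) (λ j β → op-nonNeg es′ (λ j′ β′ → 0≤f _ _) _ _))) ⟩
      ∑ (cells₂ es′) (λ s → wt (proj₁ s) * (⟪_,_⟫ es (X s) (X s) + c * mass² es (Y s)))
        ≡⟨ trans (∑-cong (cells₂ es′) λ s → solve 4 (λ a b c d → a :* (b :+ c :* d) := a :* b :+ c :* (a :* d))
             refl (wt (proj₁ s)) (⟪_,_⟫ es (X s) (X s)) c (mass² es (Y s)))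
             (trans (∑-+ (cells₂ es′) _ _)
               (cong₂ _+_ XX (sym (*-∑ (cells₂ es′) c λ s → wt (proj₁ s) * mass² es (Y s))))) ⟩
      ⟪_,_⟫ (es ⊠ es′) x x + c * ∑ (cells₂ es′) (λ s → wt (proj₁ s) * mass² es (Y s))
        ≤⟨ ℚ.+-monoʳ-≤ (⟪_,_⟫ (es ⊠ es′) x x) (*-mono-≤ˡ 0≤c YY) ⟩
      ⟪_,_⟫ (es ⊠ es′) x x + c * (c′ * mass² (es ⊠ es′) f)
        ≡⟨ cong (⟪_,_⟫ (es ⊠ es′) x x +_) (sym (ℚ.*-assoc c c′ _)) ⟩
      ⟪_,_⟫ (es ⊠ es′) x x + c * c′ * mass² (es ⊠ es′) f ∎
      where
      open ℚ.≤-Reasoning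
      module E = ≡-Reasoning
      xₜ : Arc n q × Fin q × Fin q → Fun n′ q′
      xₜ (e , α , β) i′ α′ = x (combine (u e) i′) (combine α α′)
      slice : Fin n → Fin q → Fun n′ q′
      slice j β j′ β′ = f (combine j j′) (combine β β′)
      fₜ : Arc n q × Fin q × Fin q → Fun n′ q′
      fₜ (e , α , β) = slice (v e) β
      -- An edge of the second game together with a label α′ fixes a slice of x, and the operator of
      -- `es′` turns f into a function on the first game. The first contraction applies to each such
      -- pair.
      X Y : Arc n′ q′ × Fin q′ → Fun n q
      X (e′ , α′) i α = x (combine i (u e′)) (combine α α′)
      Y (e′ , α′) j β = op es′ (slice j β) (u e′) α′
      B≡ : B (es ⊠ es′) x f ≡ ∑ (cells₂ es′) λ s → wt (proj₁ s) * B es (X s) (Y s)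
      B≡ = E.begin
        B (es ⊠ es′) x f
          E.≡⟨ ∑-cells₃-⊠ _ ⟩
        ∑ (cells₃ es) (λ (e , α , β) → ∑ (cells₃ es′) λ (e′ , α′ , β′) →
          wt (e ⊗ e′) * A (e ⊗ e′) (combine α α′) (combine β β′) *
            at₃ es′ (xₜ (e , α , β)) (fₜ (e , α , β)) (e′ , α′ , β′))
          E.≡⟨ (∑-cong (cells₃ es) λ (e , α , β) → trans
                 (∑-cong (cells₃ es′) λ (e′ , α′ , β′) → trans
                   (cong₂ (λ a b → a * b * at₃ es′ (xₜ (e , α , β)) (fₜ (e , α , β)) (e′ , α′ , β′))
                     (wt-⊗ e e′) (A-⊗ e e′ α α′ β β′))
                   (solve 5 (λ a b c d k → a :* b :* (c :* d) :* k := a :* c :* (b :* d :* k)) refl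
                     (wt e) (wt e′) (A e α β) (A e′ α′ β′) _))
                 (sym (*-∑ (cells₃ es′) (wt e * A e α β) _))) ⟩
        ∑ (cells₃ es) (λ t → w₃ es t * B es′ (xₜ t) (fₜ t))
          E.≡⟨ (∑-cong (cells₃ es) λ t → cong (w₃ es t *_) (sym (dual es′ (xₜ t) (fₜ t)))) ⟩
        ∑ (cells₃ es) (λ t → w₃ es t * ∑ (cells₂ es′) λ s →
          wt (proj₁ s) * at₂ es′ (xₜ t) (op es′ (fₜ t)) s)
          E.≡⟨ ∑-exchange (cells₃ es) (cells₂ es′) (w₃ es) (wt ∘ proj₁) _ ⟩
        ∑ (cells₂ es′) (λ s → wt (proj₁ s) * B es (X s) (Y s)) E.∎
      XX : ∑ (cells₂ es′) (λ s → wt (proj₁ s) * ⟪_,_⟫ es (X s) (X s)) ≡ ⟪_,_⟫ (es ⊠ es′) x x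
      XX = E.begin
        ∑ (cells₂ es′) (λ s → wt (proj₁ s) * ⟪_,_⟫ es (X s) (X s))
          E.≡⟨ ∑-exchange (cells₂ es′) (cells₂ es) (wt ∘ proj₁) (wt ∘ proj₁) _ ⟩
        ∑ (cells₂ es) (λ t → wt (proj₁ t) * ∑ (cells₂ es′) λ s → wt (proj₁ s) * at₂ es (X s) (X s) t)
          E.≡⟨ (∑-cong (cells₂ es) λ (e , α) → trans (*-∑ (cells₂ es′) (wt e) _)
                 (∑-cong (cells₂ es′) λ (e′ , α′) → trans (sym (ℚ.*-assoc (wt e) (wt e′) _))
                   (cong (_* at₂ es (X (e′ , α′)) (X (e′ , α′)) (e , α)) (sym (wt-⊗ e e′))))) ⟩
        ∑ (cells₂ es) (λ (e , α) → ∑ (cells₂ es′) λ (e′ , α′) →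
          wt (e ⊗ e′) * at₂ es (X (e′ , α′)) (X (e′ , α′)) (e , α))
          E.≡⟨ ∑-cells₂-⊠ _ ⟨
        ⟪_,_⟫ (es ⊠ es′) x x E.∎
      -- The mass of `Y s` at j is `op es′` of this marginal, so the second contraction applies for
      -- each j. The mass of `marginal j` at j′ is that of f at the pair, which brings back `mass²`
      -- of the product.
      marginal : Fin n → Fun n′ q′
      marginal j j′ β′ = ∑′ λ β → slice j β j′ β′
      YY : ∑ (cells₂ es′) (λ s → wt (proj₁ s) * mass² es (Y s)) ≤ c′ * mass² (es ⊠ es′) f
      YY = begin
        ∑ (cells₂ es′) (λ s → wt (proj₁ s) * mass² es (Y s))
          ≡⟨ ∑-exchange (cells₂ es′) es (wt ∘ proj₁) wt _ ⟩
        ∑ es (λ e → wt e * ∑ (cells₂ es′) λ s → wt (proj₁ s) * (∑′ (Y s (v e)) * ∑′ (Y s (v e))))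
          ≡⟨ (∑-cong es λ e → cong (wt e *_) (∑-cong (cells₂ es′) λ (e′ , α′) →
               cong (wt e′ *_) (cong₂ _*_ (sym (op-∑ es′ (allFin q) (slice (v e)) (u e′) α′))
                                          (sym (op-∑ es′ (allFin q) (slice (v e)) (u e′) α′))))) ⟩
        ∑ es (λ e → wt e * ⟪_,_⟫ es′ (op es′ (marginal (v e))) (op es′ (marginal (v e))))
          ≤⟨ (∑-mono es λ e → *-mono-≤ˡ (0≤wt e)
               (op-contracts es′ {c′} ctr′ (marginal (v e)) (λ j′ β′ → 0≤∑ (allFin q) λ β → 0≤f _ _))) ⟩
        ∑ es (λ e → wt e * (c′ * mass² es′ (marginal (v e))))
          ≡⟨ trans (∑-cong es λ e → solve 3 (λ a b c → a :* (b :* c) := b :* (a :* c)) refl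
               (wt e) c′ (mass² es′ (marginal (v e)))) (sym (*-∑ es c′ _)) ⟩
        c′ * ∑ es (λ e → wt e * mass² es′ (marginal (v e)))
          ≡⟨ cong (c′ *_) (∑-cong es λ e → trans (*-∑ es′ (wt e) _) (∑-cong es′ λ e′ →
               trans (sym (ℚ.*-assoc (wt e) (wt e′) _)) (cong₂ (λ a b → a * (b * b))
                 (sym (wt-⊗ e e′))
                 (trans (∑-swap (allFin q′) (allFin q) _) (sym (∑′-combine q _)))))) ⟩
        c′ * ∑ es (λ e → ∑ es′ λ e′ → wt (e ⊗ e′) *
          (∑′ (f (combine (v e) (v e′))) * ∑′ (f (combine (v e) (v e′)))))
          ≡⟨ cong (c′ *_) (∑-cartesian _⊗_ es es′) ⟨
        c′ * mass² (es ⊠ es′) f ∎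

  -- Derandomisation

  δ-sym : ∀ {n} (i j : Fin n) → δ[ i , j ] ≡ δ[ j , i ]
  δ-sym i j with i Fin.≟ j | j Fin.≟ i
  ... | yes _   | yes _   = refl
  ... | no _    | no _    = refl
  ... | yes i≡j | no j≢i  = ⊥-elim (j≢i (sym i≡j))
  ... | no i≢j  | yes j≡i = ⊥-elim (i≢j (sym j≡i))

  ⌈_⌉ : ∀ {n q} → (Fin n → Fin q) → Fun n q
  ⌈ f ⌉ i α = δ[ f i , α ]

  ⌈⌉-nonNeg : ∀ {n q} (f : Fin n → Fin q) → NonNeg ⌈ f ⌉
  ⌈⌉-nonNeg f i α = 0≤δ (f i) α

  SubProb : ∀ {n q} → Fun n q → Set
  SubProb p = ∀ i → ∑′ (p i) ≤ 1ℚ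

  module _ {n q : ℕ} (es : List (Arc n q)) where

    sat : (Fin n → Fin q) → (Fin n → Fin q) → ℚ
    sat f g = ∑ es λ e → wt e * A e (f (u e)) (g (v e))

    B-⌈⌉ : ∀ f g → B es ⌈ f ⌉ ⌈ g ⌉ ≡ sat f g
    B-⌈⌉ f g = trans (∑-cells₃ es _) (∑-cong es λ e → begin
      ∑′ (λ α → ∑′ λ β → wt e * A e α β * (δ[ f (u e) , α ] * δ[ g (v e) , β ]))
        ≡⟨ (∑-cong (allFin q) λ α → trans
             (∑-cong (allFin q) λ β → solve 3 (λ a b c → a :* (b :* c) := c :* (b :* a)) refl
               (wt e * A e α β) δ[ f (u e) , α ] δ[ g (v e) , β ])
             (∑′-δ (g (v e)) λ β → δ[ f (u e) , α ] * (wt e * A e α β))) ⟩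
      ∑′ (λ α → δ[ f (u e) , α ] * (wt e * A e α (g (v e))))
        ≡⟨ ∑′-δ (f (u e)) (λ α → wt e * A e α (g (v e))) ⟩
      wt e * A e (f (u e)) (g (v e)) ∎)
      where open ≡-Reasoning

    -- The common pattern of `flow` and `coflow`: each cell t deposits its weight at the place (κ t,
    -- ν t), and pairing the deposits with y evaluates y at these places.
    spread : ∀ (κ : Arc n q × Fin q × Fin q → Fin n) (ν : Arc n q × Fin q × Fin q → Fin q)
      (h : Arc n q × Fin q × Fin q → ℚ) (y : Fun n q) →
      ∑′ (λ i → ∑′ λ α → y i α * ∑ (cells₃ es) λ t → w₃ es t * (δ[ κ t , i ] * δ[ ν t , α ] * h t)) ≡
      ∑ (cells₃ es) λ t → w₃ es t * (y (κ t) (ν t) * h t)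
    spread κ ν h y = begin
      ∑′ (λ i → ∑′ λ α → y i α * ∑ (cells₃ es) λ t → w₃ es t * (δ[ κ t , i ] * δ[ ν t , α ] * h t))
        ≡⟨ (∑-cong (allFin n) λ i → ∑-exchange (allFin q) (cells₃ es) (y i) (w₃ es) _) ⟩
      ∑′ (λ i → ∑ (cells₃ es) λ t → w₃ es t * ∑′ λ α → y i α * (δ[ κ t , i ] * δ[ ν t , α ] * h t))
        ≡⟨ ∑-swap (allFin n) (cells₃ es) _ ⟩
      ∑ (cells₃ es) (λ t → ∑′ λ i → w₃ es t * ∑′ λ α → y i α * (δ[ κ t , i ] * δ[ ν t , α ] * h t))
        ≡⟨ (∑-cong (cells₃ es) λ t → trans (sym (*-∑ (allFin n) (w₃ es t) _)) (cong (w₃ es t *_) (trans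
             (∑-cong (allFin n) λ i → trans
               (∑-cong (allFin q) λ α → solve 4 (λ y a b h → y :* (a :* b :* h) := b :* (a :* (y :* h))) refl
                 (y i α) δ[ κ t , i ] δ[ ν t , α ] (h t))
               (∑′-δ (ν t) λ α → δ[ κ t , i ] * (y i α * h t)))
             (∑′-δ (κ t) λ i → y i (ν t) * h t)))) ⟩
      ∑ (cells₃ es) (λ t → w₃ es t * (y (κ t) (ν t) * h t)) ∎
      where open ≡-Reasoning

    coflow : Fun n q → Fun n q
    coflow y j β = ∑ (cells₃ es) λ (e , α , β′) → w₃ es (e , α , β′) * (δ[ v e , j ] * δ[ β′ , β ] * y (u e) α)

    B-flow : ∀ y p → B es y p ≡ ∑′ λ i → ∑′ λ α → y i α * flow es p i α
    B-flow y p = sym (spread (λ (e , _ , _) → u e) (λ (_ , α , _) → α) (λ (e , _ , β) → p (v e) β) y)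

    B-coflow : ∀ y p → B es y p ≡ ∑′ λ j → ∑′ λ β → p j β * coflow y j β
    B-coflow y p = sym (trans
      (spread (λ (e , _ , _) → v e) (λ (_ , _ , β) → β) (λ (e , α , _) → y (u e) α) p)
      (∑-cong (cells₃ es) λ (e , α , β) → cong (w₃ es (e , α , β) *_) (ℚ.*-comm (p (v e) β) (y (u e) α))))

    0≤flow : ∀ {p} → NonNeg p → NonNeg (flow es p)
    0≤flow 0≤p i α = 0≤∑ (cells₃ es) λ (e , α′ , β) → 0≤* (0≤w₃ es (e , α′ , β))
      (0≤* (0≤* (0≤δ (u e) i) (0≤δ α′ α)) (0≤p (v e) β))

    0≤coflow : ∀ {y} → NonNeg y → NonNeg (coflow y)
    0≤coflow 0≤y j β = 0≤∑ (cells₃ es) λ (e , α , β′) → 0≤* (0≤w₃ es (e , α , β′))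
      (0≤* (0≤* (0≤δ (v e) j) (0≤δ β′ β)) (0≤y (u e) α))

    -- B is linear in each of its arguments, so it is maximised at point masses.
    derandomise : .{{_ : ℕ.NonZero q}} → ∀ y p → NonNeg y → SubProb y → NonNeg p → SubProb p →
      ∃[ f ] ∃[ g ] B es y p ≤ sat f g
    derandomise y p 0≤y y≤1 0≤p p≤1 = f , g , (begin
      B es y p
        ≡⟨ B-coflow y p ⟩
      ∑′ (λ j → ∑′ λ β → p j β * coflow y j β)
        ≤⟨ ∑-mono (allFin n) (λ j → ∑′-≤-max (p j) (coflow y j) _ (0≤p j) (p≤1 j)
             (0≤coflow 0≤y j (g j)) (proj₂ (argmax (coflow y j)))) ⟩
      ∑′ (λ j → coflow y j (g j))
        ≡⟨ ∑-cong (allFin n) (λ j → sym (∑′-δ (g j) (coflow y j))) ⟩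
      ∑′ (λ j → ∑′ λ β → ⌈ g ⌉ j β * coflow y j β)
        ≡⟨ B-coflow y ⌈ g ⌉ ⟨
      B es y ⌈ g ⌉
        ≡⟨ B-flow y ⌈ g ⌉ ⟩
      ∑′ (λ i → ∑′ λ α → y i α * flow es ⌈ g ⌉ i α)
        ≤⟨ ∑-mono (allFin n) (λ i → ∑′-≤-max (y i) (flow es ⌈ g ⌉ i) _ (0≤y i) (y≤1 i)
             (0≤flow (⌈⌉-nonNeg g) i (f i)) (proj₂ (argmax (flow es ⌈ g ⌉ i)))) ⟩
      ∑′ (λ i → flow es ⌈ g ⌉ i (f i))
        ≡⟨ ∑-cong (allFin n) (λ i → sym (∑′-δ (f i) (flow es ⌈ g ⌉ i))) ⟩
      ∑′ (λ i → ∑′ λ α → ⌈ f ⌉ i α * flow es ⌈ g ⌉ i α)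
        ≡⟨ B-flow ⌈ f ⌉ ⌈ g ⌉ ⟨
      B es ⌈ f ⌉ ⌈ g ⌉
        ≡⟨ B-⌈⌉ f g ⟩
      sat f g ∎)
      where
      open ℚ.≤-Reasoning
      f g : Fin n → Fin q
      g j = proj₁ (argmax (coflow y j))
      f i = proj₁ (argmax (flow es ⌈ g ⌉ i))

    -- `op` averages over the edges at i, and by the projection property each edge brings along no
    -- more than the mass of p at its other end.
    op-subProb : ∀ p → NonNeg p → SubProb p → SubProb (op es p)
    op-subProb p 0≤p p≤1 i = begin
      ∑′ (λ α → flow es p i α * r)
        ≡⟨ ∑-* (allFin q) r (flow es p i) ⟨
      ∑′ (flow es p i) * r
        ≡⟨ cong (_* r) outflow ⟩
      ∑ es (λ e → ∑′ λ α → ∑′ λ β → wt e * A e α β * (δ[ u e , i ] * p (v e) β)) * r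
        ≤⟨ *-mono-≤ʳ (0≤recip (degree es i)) (∑-mono es inner) ⟩
      degree es i * r
        ≤⟨ *-recip≤1 (degree es i) ⟩
      1ℚ ∎
      where
      open ℚ.≤-Reasoning
      r : ℚ
      r = recip (degree es i)
      k : Arc n q × Fin q × Fin q → ℚ
      k (e , α , β) = w₃ es (e , α , β) * (δ[ u e , i ] * p (v e) β)
      collapse : ∀ ((e , α′ , β) : Arc n q × Fin q × Fin q) →
        ∑′ (λ α → w₃ es (e , α′ , β) * (δ[ u e , i ] * δ[ α′ , α ] * p (v e) β)) ≡ k (e , α′ , β)
      collapse (e , α′ , β) = trans
        (∑-cong (allFin q) λ α → solve 4 (λ w a b c → w :* (a :* b :* c) := b :* (w :* (a :* c))) refl
          (w₃ es (e , α′ , β)) δ[ u e , i ] δ[ α′ , α ] (p (v e) β))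
        (∑′-δ α′ λ _ → k (e , α′ , β))
      outflow : ∑′ (flow es p i) ≡
        ∑ es (λ e → ∑′ λ α → ∑′ λ β → wt e * A e α β * (δ[ u e , i ] * p (v e) β))
      outflow = trans (∑-swap (allFin q) (cells₃ es) _)
        (trans (∑-cong (cells₃ es) collapse) (∑-cells₃ es k))
      inner : ∀ e → ∑′ (λ α → ∑′ λ β → wt e * A e α β * (δ[ u e , i ] * p (v e) β)) ≤ wt e * δ[ i , u e ]
      inner e = begin
        ∑′ (λ α → ∑′ λ β → wt e * A e α β * (δ[ u e , i ] * p (v e) β))
          ≡⟨ ∑-swap (allFin q) (allFin q) _ ⟩
        ∑′ (λ β → ∑′ λ α → wt e * A e α β * (δ[ u e , i ] * p (v e) β))
          ≡⟨ (∑-cong (allFin q) λ β → trans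
               (∑-cong (allFin q) λ α → solve 4 (λ w a d p → w :* a :* (d :* p) := w :* d :* p :* a) refl
                 (wt e) (A e α β) δ[ u e , i ] (p (v e) β))
               (sym (*-∑ (allFin q) (wt e * δ[ u e , i ] * p (v e) β) λ α → A e α β))) ⟩
        ∑′ (λ β → wt e * δ[ u e , i ] * p (v e) β * ∑′ λ α → A e α β)
          ≤⟨ (∑-mono (allFin q) λ β → *-mono-≤ˡ (0≤* 0≤wδ (0≤p (v e) β)) (∑A≤1 e β)) ⟩
        ∑′ (λ β → wt e * δ[ u e , i ] * p (v e) β * 1ℚ)
          ≡⟨ trans (∑-cong (allFin q) λ β → ℚ.*-identityʳ _)
               (sym (*-∑ (allFin q) (wt e * δ[ u e , i ]) (p (v e)))) ⟩
        wt e * δ[ u e , i ] * ∑′ (p (v e))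
          ≤⟨ *-mono-≤ˡ 0≤wδ (p≤1 (v e)) ⟩
        wt e * δ[ u e , i ] * 1ℚ
          ≡⟨ trans (ℚ.*-identityʳ _) (cong (wt e *_) (δ-sym (u e) i)) ⟩
        wt e * δ[ i , u e ] ∎
        where
        0≤wδ : 0ℚ ≤ wt e * δ[ u e , i ]
        0≤wδ = 0≤* (0≤wt e) (0≤δ (u e) i)

    -- The link from the value to a norm. By duality the squared norm of `op es p` is the weight
    -- satisfied when U plays `op es p` and V plays p; both are randomised assignments, so the bound
    -- for deterministic ones applies.
    ⟨op,op⟩-≤ : .{{_ : ℕ.NonZero q}} → ∀ {c} → (∀ f g → sat f g ≤ c) →
      ∀ p → NonNeg p → SubProb p → ⟪_,_⟫ es (op es p) (op es p) ≤ c
    ⟨op,op⟩-≤ bound p 0≤p p≤1 =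
      let f , g , le = derandomise (op es p) p (op-nonNeg es 0≤p) (op-subProb p 0≤p p≤1) 0≤p p≤1
      in ℚ.≤-trans (ℚ.≤-reflexive (dual es (op es p) p)) (ℚ.≤-trans le (bound f g))

    -- The projection property enters here: the masses φ α that p sends to the
    -- labels α add up to at most 1, hence so do their squares.
    B-scaled : ∀ p → NonNeg p → SubProb p → ∀ x (s : Fin n → ℚ) →
      2ℚ * B es x (λ j β → s j * p j β) ≤ ⟪_,_⟫ es x x + ∑ es λ e → wt e * (s (v e) * s (v e))
    B-scaled p 0≤p p≤1 x s = begin
      2ℚ * B es x (λ j β → s j * p j β)
        ≡⟨ trans (cong (2ℚ *_) (∑-cells₃ es _)) (*-∑ es 2ℚ _) ⟩
      ∑ es (λ e → 2ℚ * ∑′ λ α → ∑′ λ β → wt e * A e α β * (x (u e) α * (s (v e) * p (v e) β)))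
        ≤⟨ ∑-mono es edge ⟩
      ∑ es (λ e → ∑′ (λ α → wt e * (x (u e) α * x (u e) α)) + wt e * (s (v e) * s (v e)))
        ≡⟨ trans (∑-+ es _ _) (cong (_+ ∑ es λ e → wt e * (s (v e) * s (v e))) (sym (∑-cells₂ es _))) ⟩
      ⟪_,_⟫ es x x + ∑ es (λ e → wt e * (s (v e) * s (v e))) ∎
      where
      open ℚ.≤-Reasoning
      edge : ∀ e → 2ℚ * ∑′ (λ α → ∑′ λ β → wt e * A e α β * (x (u e) α * (s (v e) * p (v e) β))) ≤
                   ∑′ (λ α → wt e * (x (u e) α * x (u e) α)) + wt e * (s (v e) * s (v e))
      edge e = begin
        2ℚ * ∑′ (λ α → ∑′ λ β → wt e * A e α β * (x (u e) α * (s (v e) * p (v e) β)))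
          ≡⟨ trans (*-∑ (allFin q) 2ℚ _) (∑-cong (allFin q) λ α → trans
               (cong (2ℚ *_) (trans
                 (∑-cong (allFin q) λ β → solve 5 (λ w a x s p → w :* a :* (x :* (s :* p)) := w :* x :* s :* (a :* p))
                   refl (wt e) (A e α β) (x (u e) α) (s (v e)) (p (v e) β))
                 (sym (*-∑ (allFin q) (wt e * x (u e) α * s (v e)) λ β → A e α β * p (v e) β))))
               (solve 4 (λ w x s y → con 2ℚ :* (w :* x :* s :* y) := w :* (con 2ℚ :* (x :* (s :* y)))) refl
                 (wt e) (x (u e) α) (s (v e)) (φ α))) ⟩
        ∑′ (λ α → wt e * (2ℚ * (x (u e) α * (s (v e) * φ α))))
          ≤⟨ (∑-mono (allFin q) λ α → *-mono-≤ˡ (0≤wt e) (amgm (x (u e) α) (s (v e) * φ α))) ⟩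
        ∑′ (λ α → wt e * (x (u e) α * x (u e) α + s (v e) * φ α * (s (v e) * φ α)))
          ≡⟨ trans (∑-cong (allFin q) λ α → trans (ℚ.*-distribˡ-+ (wt e) _ _)
               (cong (wt e * (x (u e) α * x (u e) α) +_)
                 (solve 3 (λ w s y → w :* (s :* y :* (s :* y)) := w :* (s :* s) :* (y :* y)) refl
                   (wt e) (s (v e)) (φ α))))
               (trans (∑-+ (allFin q) _ _) (cong (∑′ (λ α → wt e * (x (u e) α * x (u e) α)) +_)
                 (sym (*-∑ (allFin q) (wt e * (s (v e) * s (v e))) λ α → φ α * φ α)))) ⟩
        ∑′ (λ α → wt e * (x (u e) α * x (u e) α)) + wt e * (s (v e) * s (v e)) * ∑′ (λ α → φ α * φ α)
          ≤⟨ ℚ.+-monoʳ-≤ (∑′ λ α → wt e * (x (u e) α * x (u e) α))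
               (*-mono-≤ˡ (0≤* (0≤wt e) (0≤² (s (v e)))) ∑φ²≤1) ⟩
        ∑′ (λ α → wt e * (x (u e) α * x (u e) α)) + wt e * (s (v e) * s (v e)) * 1ℚ
          ≡⟨ cong (∑′ (λ α → wt e * (x (u e) α * x (u e) α)) +_) (ℚ.*-identityʳ _) ⟩
        ∑′ (λ α → wt e * (x (u e) α * x (u e) α)) + wt e * (s (v e) * s (v e)) ∎
        where
        amgm : ∀ a b → 2ℚ * (a * b) ≤ a * a + b * b
        amgm a b = ≤-by ((a - b) * (a - b)) (0≤² (a - b))
          (solve 2 (λ a b → con 2ℚ :* (a :* b) :+ (a :- b) :* (a :- b) := a :* a :+ b :* b) refl a b)
        φ : Fin q → ℚ
        φ α = ∑′ λ β → A e α β * p (v e) β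
        0≤φ : ∀ α → 0ℚ ≤ φ α
        0≤φ α = 0≤∑ (allFin q) λ β → 0≤* (0≤indicator (allowed e α β)) (0≤p (v e) β)
        ∑φ≤1 : ∑′ φ ≤ 1ℚ
        ∑φ≤1 = begin
          ∑′ φ                                        ≡⟨ ∑-swap (allFin q) (allFin q) _ ⟩
          ∑′ (λ β → ∑′ λ α → A e α β * p (v e) β)     ≡⟨ ∑-cong (allFin q) (λ β → ∑-* (allFin q) (p (v e) β) _) ⟨
          ∑′ (λ β → ∑′ (λ α → A e α β) * p (v e) β)
            ≤⟨ (∑-mono (allFin q) λ β → *-mono-≤ʳ (0≤p (v e) β) (∑A≤1 e β)) ⟩
          ∑′ (λ β → 1ℚ * p (v e) β)                   ≡⟨ ∑-cong (allFin q) (λ β → ℚ.*-identityˡ _) ⟩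
          ∑′ (p (v e))                                ≤⟨ p≤1 (v e) ⟩
          1ℚ                                          ∎
        φ≤1 : ∀ α → φ α ≤ 1ℚ
        φ≤1 α = ℚ.≤-trans (term≤∑ 0≤φ (∈-allFin α)) ∑φ≤1
        ∑φ²≤1 : ∑′ (λ α → φ α * φ α) ≤ 1ℚ
        ∑φ²≤1 = ℚ.≤-trans (∑-mono (allFin q) λ α → ℚ.≤-trans (*-mono-≤ˡ (0≤φ α) (φ≤1 α))
          (ℚ.≤-reflexive (ℚ.*-identityʳ (φ α)))) ∑φ≤1

  -- Adding a star

  -- A constraint that accepted everything would not be a projection. So the label of v is ignored
  -- and the label of s is prescribed as α₀, which costs the players nothing.
  star : ∀ {n q} → Fin n → Fin q → Arc n q → Arc n q
  star s α₀ e = record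
    { u = s ; v = v e ; up = up e ; down = down e
    ; allowed    = λ α β → does (α₀ Fin.≟ α)
    ; functional = λ β {α} {α′} ok ok′ → trans (sym (point α ok)) (point α′ ok′)
    }
    where
    point : ∀ α → does (α₀ Fin.≟ α) ≡ true → α₀ ≡ α
    point α ok with α₀ Fin.≟ α
    ... | yes eq = eq

  -- With half of the total weight the vertex s checks nothing, which makes the
  -- game expanding.
  starred : ∀ {n q} → Fin n → Fin q → List (Arc n q) → List (Arc n q)
  starred s α₀ = concatMap λ e → e ∷ star s α₀ e ∷ []

  module _ {n q : ℕ} (s : Fin n) (α₀ : Fin q) (es : List (Arc n q)) where

    ∑-starred : ∀ k → ∑ (starred s α₀ es) k ≡ ∑ es k + ∑ es (k ∘ star s α₀)
    ∑-starred k = trans (∑-concatMap (λ e → e ∷ star s α₀ e ∷ []) es)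
      (trans (∑-cong es λ e → cong (k e +_) (ℚ.+-identityʳ (k (star s α₀ e)))) (∑-+ es k (k ∘ star s α₀)))

    flux : Fun n q → ℚ
    flux f = ∑ es λ e → wt e * ∑′ (f (v e))

    B-starred : ∀ x f → B (starred s α₀ es) x f ≡ B es x f + x s α₀ * flux f
    B-starred x f = trans (∑-cells₃ (starred s α₀ es) _) (trans (∑-starred _)
      (cong₂ _+_ (sym (∑-cells₃ es _)) (trans (∑-cong es edge) (sym (*-∑ es (x s α₀) _)))))
      where
      edge : ∀ e → ∑′ (λ α → ∑′ λ β → wt e * δ[ α₀ , α ] * (x s α * f (v e) β)) ≡
                   x s α₀ * (wt e * ∑′ (f (v e)))
      edge e = trans
        (∑-cong (allFin q) λ α → trans
          (∑-cong (allFin q) λ β → solve 4 (λ w d x f → w :* d :* (x :* f) := d :* (x :* w) :* f) refl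
            (wt e) δ[ α₀ , α ] (x s α) (f (v e) β))
          (trans (sym (*-∑ (allFin q) (δ[ α₀ , α ] * (x s α * wt e)) (f (v e))))
            (ℚ.*-assoc δ[ α₀ , α ] _ _)))
        (trans (∑′-δ α₀ λ α → x s α * wt e * ∑′ (f (v e))) (ℚ.*-assoc (x s α₀) (wt e) _))

    ⟨⟩-starred : ∀ x → ⟪_,_⟫ (starred s α₀ es) x x ≡ ⟪_,_⟫ es x x + W es * ∑′ (λ α → x s α * x s α)
    ⟨⟩-starred x = trans (∑-cells₂ (starred s α₀ es) _) (trans (∑-starred _)
      (cong₂ _+_ (sym (∑-cells₂ es _))
        (trans (∑-cong es λ e → sym (*-∑ (allFin q) (wt e) λ α → x s α * x s α)) (sym (∑-* es _ wt)))))

    mass²-starred : ∀ f → mass² (starred s α₀ es) f ≡ mass² es f + mass² es f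
    mass²-starred f = ∑-starred _

    W-starred : W (starred s α₀ es) ≡ W es + W es
    W-starred = ∑-starred wt

  -- The gap of the starred game

  ∑-variance : ∀ {X : Set} (xs : List X) (w F : X → ℚ) μ →
    ∑ xs (λ x → w x * F x) ≡ ∑ xs w * μ →
    ∑ xs (λ x → w x * ((F x - μ) * (F x - μ))) + μ * μ * ∑ xs w ≡ ∑ xs λ x → w x * (F x * F x)
  ∑-variance xs w F μ mean = begin
    ∑ xs (λ x → w x * ((F x - μ) * (F x - μ))) + μ * μ * ∑ xs w
      ≡⟨ cong (_+ μ * μ * ∑ xs w) (trans
           (∑-cong xs λ x → solve 3 (λ w F μ → w :* ((F :- μ) :* (F :- μ)) :=
             w :* (F :* F) :+ (:- (con 2ℚ :* μ) :* (w :* F) :+ μ :* μ :* w)) refl (w x) (F x) μ)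
           (trans (∑-+ xs _ _) (cong (Q +_) (trans (∑-+ xs _ _)
             (cong₂ _+_ (sym (*-∑ xs (- (2ℚ * μ)) _)) (sym (*-∑ xs (μ * μ) w))))))) ⟩
    Q + (- (2ℚ * μ) * ∑ xs (λ x → w x * F x) + μ * μ * ∑ xs w) + μ * μ * ∑ xs w
      ≡⟨ cong (λ z → Q + (- (2ℚ * μ) * z + μ * μ * ∑ xs w) + μ * μ * ∑ xs w) mean ⟩
    Q + (- (2ℚ * μ) * (∑ xs w * μ) + μ * μ * ∑ xs w) + μ * μ * ∑ xs w
      ≡⟨ solve 3 (λ Q w μ → Q :+ (:- (con 2ℚ :* μ) :* (w :* μ) :+ μ :* μ :* w) :+ μ :* μ :* w := Q) refl
           Q (∑ xs w) μ ⟩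
    Q ∎
    where
    open ≡-Reasoning
    Q : ℚ
    Q = ∑ xs λ x → w x * (F x * F x)

  ¼ℚ : ℚ
  ¼ℚ = ½ * ½

  -- This is ε³/4. Mixing with weight ε/2 in `mixed` lowers the coefficient of μ² w by (ε/2) ε² =
  -- ε³/2; relative to the doubled mass of the starred game the gain is half as much.
  gap : ℚ → ℚ
  gap ε = ε * ε * ε * ¼ℚ

  -- M is 1/ε, given by its equation so that the ring solver can treat it as a variable.
  module _ {n q : ℕ} .{{_ : ℕ.NonZero q}} (s : Fin n) (α₀ : Fin q) (es : List (Arc n q))
           {ε M : ℚ} (0≤ε : 0ℚ ≤ ε) (ε≤1 : ε ≤ 1ℚ) (εM≡1 : ε * M ≡ 1ℚ) (0≤M : 0ℚ ≤ M)
           (0<W : 0ℚ < W es) (bound : ∀ f g → sat es f g ≤ (1ℚ - ε) * W es) where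

    module _ (x f : Fun n q) (0≤x : NonNeg x) (0≤f : NonNeg f) where
      private
        F : Fin n → ℚ
        F j = ∑′ (f j)

        0≤F : ∀ j → 0ℚ ≤ F j
        0≤F j = 0≤∑ (allFin q) (0≤f j)

        -- f is the product of its masses F and a randomised assignment p. Where F vanishes any
        -- distribution will do, and the point mass at α₀ is taken.
        p : Fun n q
        p j β with 0ℚ ℚ.<? F j
        ... | yes _ = f j β * recip (F j)
        ... | no  _ = δ[ α₀ , β ]

        0≤p : NonNeg p
        0≤p j β with 0ℚ ℚ.<? F j
        ... | yes _ = 0≤* (0≤f j β) (0≤recip (F j))
        ... | no  _ = 0≤δ α₀ β

        p≤1 : SubProb p
        p≤1 j with 0ℚ ℚ.<? F j
        ... | yes _ = ℚ.≤-trans (ℚ.≤-reflexive (sym (∑-* (allFin q) (recip (F j)) (f j))))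
                        (*-recip≤1 (F j))
        ... | no  _ = ℚ.≤-reflexive (∑′-δ₁ α₀)

        f≡Fp : ∀ j β → F j * p j β ≡ f j β
        f≡Fp j β with 0ℚ ℚ.<? F j
        ... | yes 0<F = trans (solve 3 (λ F f r → F :* (f :* r) := F :* r :* f) refl (F j) (f j β) (recip (F j)))
                          (trans (cong (_* f j β) (*-recip (F j) 0<F)) (ℚ.*-identityˡ (f j β)))
        ... | no 0≮F = trans (cong (_* δ[ α₀ , β ]) F≡0) (trans (ℚ.*-zeroˡ δ[ α₀ , β ]) (sym f≡0))
          where
          F≡0 : F j ≡ 0ℚ
          F≡0 = ℚ.≤-antisym (ℚ.≮⇒≥ 0≮F) (0≤F j)
          f≡0 : f j β ≡ 0ℚ
          f≡0 = ℚ.≤-antisym (ℚ.≤-trans (term≤∑ (0≤f j) (∈-allFin β)) (ℚ.≤-reflexive F≡0)) (0≤f j β)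

        w μ : ℚ
        w = W es
        μ = flux s α₀ es f * recip w

        mean : flux s α₀ es f ≡ w * μ
        mean = sym (trans (solve 3 (λ w a r → w :* (a :* r) := w :* r :* a) refl w (flux s α₀ es f) (recip w))
          (trans (cong (_* flux s α₀ es f) (*-recip w 0<W)) (ℚ.*-identityˡ _)))

        r : Fin n → ℚ
        r j = F j - μ

        Q V : ℚ
        Q = mass² es f
        V = ∑ es λ e → wt e * (r (v e) * r (v e))

        0≤V : 0ℚ ≤ V
        0≤V = 0≤∑ es λ e → 0≤* (0≤wt e) (0≤² (r (v e)))

        V+μ²w : V + μ * μ * w ≡ Q
        V+μ²w = ∑-variance es wt (F ∘ v) μ mean

        B-cong : ∀ y {g h} → (∀ j β → g j β ≡ h j β) → B es y g ≡ B es y h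
        B-cong y eq = ∑-cong (cells₃ es) λ (e , α , β) →
          cong (λ z → w₃ es (e , α , β) * (y (u e) α * z)) (eq (v e) β)

        -- Since f = μ p + r p, `op es f` splits into μ P, to which the value of the game applies,
        -- and N, which is controlled by the variance V of the masses.
        P N rp : Fun n q
        rp j β = r j * p j β
        P = op es p
        N = op es rp

        contraction : 2ℚ * B es x f ≤ ⟪_,_⟫ es x x + Q
        contraction = subst (λ z → 2ℚ * z ≤ ⟪_,_⟫ es x x + Q) (B-cong x f≡Fp) (B-scaled es p 0≤p p≤1 x F)

        split : B es x f ≡ ∑ (cells₂ es) λ (e , α) → wt e * (x (u e) α * (μ * P (u e) α + N (u e) α))
        split = begin
          B es x f
            ≡⟨ B-cong x (λ j β → trans (sym (f≡Fp j β))
                 (solve 3 (λ F μ p → F :* p := μ :* p :+ (F :- μ) :* p) refl (F j) μ (p j β))) ⟩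
          B es x (λ j β → μ * p j β + rp j β)
            ≡⟨ trans (∑-cong (cells₃ es) λ (e , α , β) →
                 solve 5 (λ w x μ p r → w :* (x :* (μ :* p :+ r)) := μ :* (w :* (x :* p)) :+ w :* (x :* r)) refl
                   (w₃ es (e , α , β)) (x (u e) α) μ (p (v e) β) (rp (v e) β))
                 (trans (∑-+ (cells₃ es) _ _) (cong (_+ B es x rp) (sym (*-∑ (cells₃ es) μ _)))) ⟩
          μ * B es x p + B es x rp
            ≡⟨ cong₂ (λ a b → μ * a + b) (dual es x p) (dual es x rp) ⟨
          μ * ⟪_,_⟫ es x P + ⟪_,_⟫ es x N
            ≡⟨ trans (cong (_+ ⟪_,_⟫ es x N) (*-∑ (cells₂ es) μ _)) (trans (sym (∑-+ (cells₂ es) _ _))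
                 (∑-cong (cells₂ es) λ (e , α) →
                   solve 5 (λ w x μ p r → μ :* (w :* (x :* p)) :+ w :* (x :* r) := w :* (x :* (μ :* p :+ r))) refl
                     (wt e) (x (u e) α) μ (P (u e) α) (N (u e) α))) ⟩
          ∑ (cells₂ es) (λ (e , α) → wt e * (x (u e) α * (μ * P (u e) α + N (u e) α))) ∎
          where open ≡-Reasoning

        -- The right side minus the left side is (x - μP - N)² + ε (μP - MN)².
        pointwise : ∀ x P N → 2ℚ * (x * (μ * P + N)) ≤
          x * x + ((1ℚ + ε) * (μ * μ) * (P * P) + (1ℚ + M) * (N * N))
        pointwise x P N = ≤-by (d₁ * d₁ + ε * (d₂ * d₂)) (0≤+ (0≤² d₁) (0≤* 0≤ε (0≤² d₂))) (begin
          2ℚ * (x * (μ * P + N)) + (d₁ * d₁ + ε * (d₂ * d₂))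
            ≡⟨ solve 6 (λ x P N ε M μ →
                 con 2ℚ :* (x :* (μ :* P :+ N)) :+ ((x :- μ :* P :- N) :* (x :- μ :* P :- N) :+
                   ε :* ((μ :* P :- M :* N) :* (μ :* P :- M :* N))) :=
                 x :* x :+ (con 1ℚ :+ ε) :* (μ :* μ) :* (P :* P) :+ con 2ℚ :* (μ :* P :* N) :+ N :* N
                   :- con 2ℚ :* (ε :* M) :* (μ :* P :* N) :+ (ε :* M) :* M :* (N :* N))
                 refl x P N ε M μ ⟩
          x * x + (1ℚ + ε) * (μ * μ) * (P * P) + 2ℚ * (μ * P * N) + N * N
            - 2ℚ * (ε * M) * (μ * P * N) + ε * M * M * (N * N)
            ≡⟨ cong (λ z → x * x + (1ℚ + ε) * (μ * μ) * (P * P) + 2ℚ * (μ * P * N) + N * N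
                 - 2ℚ * z * (μ * P * N) + z * M * (N * N)) εM≡1 ⟩
          x * x + (1ℚ + ε) * (μ * μ) * (P * P) + 2ℚ * (μ * P * N) + N * N
            - 2ℚ * 1ℚ * (μ * P * N) + 1ℚ * M * (N * N)
            ≡⟨ solve 5 (λ a b M m N → a :+ b :+ con 2ℚ :* m :+ N :* N :- con 2ℚ :* con 1ℚ :* m :+
                 con 1ℚ :* M :* (N :* N) := a :+ (b :+ (con 1ℚ :+ M) :* (N :* N)))
                 refl (x * x) ((1ℚ + ε) * (μ * μ) * (P * P)) M (μ * P * N) N ⟩
          x * x + ((1ℚ + ε) * (μ * μ) * (P * P) + (1ℚ + M) * (N * N)) ∎)
          where
          open ≡-Reasoning
          d₁ d₂ : ℚ
          d₁ = x - μ * P - N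
          d₂ = μ * P - M * N

        -- The squared norm of P is at most (1 - ε) w by the bound on the value, that of N at most V
        -- by `B-scaled`. The factor 1 + ε spent on the mixed terms in P and N leaves (1 + ε)(1 - ε)
        -- = 1 - ε² for the mean part; what is paid is M in the coefficient of V.
        improved : 2ℚ * B es x f ≤
          ⟪_,_⟫ es x x + ((1ℚ + ε) * (μ * μ) * ((1ℚ - ε) * w) + (1ℚ + M) * V)
        improved = begin
          2ℚ * B es x f
            ≡⟨ trans (cong (2ℚ *_) split) (trans (*-∑ (cells₂ es) 2ℚ _) (∑-cong (cells₂ es) λ (e , α) →
                 solve 2 (λ w a → con 2ℚ :* (w :* a) := w :* (con 2ℚ :* a)) refl (wt e) _)) ⟩
          ∑ (cells₂ es) (λ (e , α) → wt e * (2ℚ * (x (u e) α * (μ * P (u e) α + N (u e) α))))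
            ≤⟨ ∑-mono (cells₂ es) (λ (e , α) → *-mono-≤ˡ (0≤wt e) (pointwise (x (u e) α) (P (u e) α) (N (u e) α))) ⟩
          ∑ (cells₂ es) (λ t → wt (proj₁ t) *
            (at₂ es x x t + ((1ℚ + ε) * (μ * μ) * at₂ es P P t + (1ℚ + M) * at₂ es N N t)))
            ≡⟨ trans (∑-cong (cells₂ es) λ t →
                 solve 6 (λ w a c b d e → w :* (a :+ (c :* b :+ d :* e)) := w :* a :+ (c :* (w :* b) :+ d :* (w :* e))) refl
                   (wt (proj₁ t)) (at₂ es x x t) ((1ℚ + ε) * (μ * μ)) (at₂ es P P t) (1ℚ + M) (at₂ es N N t))
                 (trans (∑-+ (cells₂ es) _ _) (cong (⟪_,_⟫ es x x +_) (trans (∑-+ (cells₂ es) _ _)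
                   (cong₂ _+_ (sym (*-∑ (cells₂ es) ((1ℚ + ε) * (μ * μ)) _)) (sym (*-∑ (cells₂ es) (1ℚ + M) _)))))) ⟩
          ⟪_,_⟫ es x x + ((1ℚ + ε) * (μ * μ) * ⟪_,_⟫ es P P + (1ℚ + M) * ⟪_,_⟫ es N N)
            ≤⟨ ℚ.+-monoʳ-≤ (⟪_,_⟫ es x x) (ℚ.+-mono-≤
                 (*-mono-≤ˡ (0≤* (0≤+ 0≤1 0≤ε) (0≤² μ)) (⟨op,op⟩-≤ es bound p 0≤p p≤1))
                 (*-mono-≤ˡ (0≤+ 0≤1 0≤M) NN)) ⟩
          ⟪_,_⟫ es x x + ((1ℚ + ε) * (μ * μ) * ((1ℚ - ε) * w) + (1ℚ + M) * V) ∎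
          where
          open ℚ.≤-Reasoning
          NN : ⟪_,_⟫ es N N ≤ V
          NN = cancel-half (subst (λ z → 2ℚ * z ≤ ⟪_,_⟫ es N N + V) (sym (dual es N rp))
            (B-scaled es p 0≤p p≤1 N r))

        -- Chosen such that θ M = ½: then V gets the coefficient 3/2, safely below the nearly 2 that
        -- the starred game has to offer.
        θ : ℚ
        θ = ε * ½

        0≤θ : 0ℚ ≤ θ
        0≤θ = 0≤* 0≤ε (ℚ.nonNegative⁻¹ ½)

        θ≤1 : θ ≤ 1ℚ
        θ≤1 = ℚ.≤-trans (*-mono-≤ʳ (ℚ.nonNegative⁻¹ ½) ε≤1) (≤-by ½ (ℚ.nonNegative⁻¹ ½) refl)

        -- The bound contraction gains nothing in μ² w, and improved loses in V; as the
        -- star does not see V, there is room for a mixture of the two.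
        mixed : 2ℚ * B es x f ≤ ⟪_,_⟫ es x x + (μ * μ * w * (1ℚ - 2ℚ * gap ε) + V * (1ℚ + ½))
        mixed = begin
          2ℚ * B es x f
            ≡⟨ solve 2 (λ θ b → b := (con 1ℚ :- θ) :* b :+ θ :* b) refl θ (2ℚ * B es x f) ⟩
          (1ℚ - θ) * (2ℚ * B es x f) + θ * (2ℚ * B es x f)
            ≤⟨ ℚ.+-mono-≤ (*-mono-≤ˡ (0≤difference θ≤1) contraction) (*-mono-≤ˡ 0≤θ improved) ⟩
          (1ℚ - θ) * (X + Q) + θ * (X + ((1ℚ + ε) * (μ * μ) * ((1ℚ - ε) * w) + (1ℚ + M) * V))
            ≡⟨ cong (λ z → (1ℚ - θ) * (X + z) + θ * (X + ((1ℚ + ε) * (μ * μ) * ((1ℚ - ε) * w) + (1ℚ + M) * V)))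
                 (sym V+μ²w) ⟩
          (1ℚ - θ) * (X + (V + μ * μ * w)) + θ * (X + ((1ℚ + ε) * (μ * μ) * ((1ℚ - ε) * w) + (1ℚ + M) * V))
            ≡⟨ solve 6 (λ ε M X V μ w →
                 (con 1ℚ :- ε :* con ½) :* (X :+ (V :+ μ :* μ :* w)) :+ ε :* con ½ :*
                   (X :+ ((con 1ℚ :+ ε) :* (μ :* μ) :* ((con 1ℚ :- ε) :* w) :+ (con 1ℚ :+ M) :* V)) :=
                 X :+ (μ :* μ :* w :* (con 1ℚ :- con 2ℚ :* (ε :* ε :* ε :* con ¼ℚ)) :+ V :* (con 1ℚ :+ ε :* M :* con ½)))
                 refl ε M X V μ w ⟩
          X + (μ * μ * w * (1ℚ - 2ℚ * gap ε) + V * (1ℚ + ε * M * ½))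
            ≡⟨ cong (λ z → X + (μ * μ * w * (1ℚ - 2ℚ * gap ε) + V * (1ℚ + z * ½))) εM≡1 ⟩
          X + (μ * μ * w * (1ℚ - 2ℚ * gap ε) + V * (1ℚ + 1ℚ * ½)) ∎
          where
          open ℚ.≤-Reasoning
          X : ℚ
          X = ⟪_,_⟫ es x x

        0≤w : 0ℚ ≤ w
        0≤w = ℚ.<⇒≤ 0<W

        -- 2ab ≤ a² + b² for a = x s α₀ and b = μ.
        star-part : 2ℚ * (x s α₀ * (w * μ)) ≤ w * ∑′ (λ α → x s α * x s α) + μ * μ * w
        star-part = begin
          2ℚ * (x s α₀ * (w * μ))
            ≤⟨ ≤-by (w * ((x s α₀ - μ) * (x s α₀ - μ))) (0≤* 0≤w (0≤² (x s α₀ - μ)))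
                 (solve 3 (λ x w μ → con 2ℚ :* (x :* (w :* μ)) :+ w :* ((x :- μ) :* (x :- μ)) :=
                   w :* (x :* x) :+ μ :* μ :* w) refl (x s α₀) w μ) ⟩
          w * (x s α₀ * x s α₀) + μ * μ * w
            ≤⟨ ℚ.+-monoˡ-≤ (μ * μ * w) (*-mono-≤ˡ 0≤w
                 (term≤∑ {f = λ α → x s α * x s α} (λ α → 0≤² (x s α)) (∈-allFin α₀))) ⟩
          w * ∑′ (λ α → x s α * x s α) + μ * μ * w ∎
          where open ℚ.≤-Reasoning

        -- This is the slack 2 (1 - `gap ε`) - 3/2 in the coefficient of V.
        gap-small : 0ℚ ≤ ½ - 2ℚ * gap ε
        gap-small = 0≤difference (begin
          2ℚ * (ε * ε * ε * ¼ℚ) ≡⟨ solve 1 (λ ε → con 2ℚ :* (ε :* ε :* ε :* con ¼ℚ) := con ½ :* (ε :* ε :* ε)) refl ε ⟩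
          ½ * (ε * ε * ε)       ≤⟨ *-mono-≤ˡ (ℚ.nonNegative⁻¹ ½) (ℚ.≤-trans (*-mono-≤ˡ (0≤² ε) ε≤1)
                                     (ℚ.≤-trans (ℚ.≤-reflexive (ℚ.*-identityʳ (ε * ε)))
                                       (ℚ.≤-trans (*-mono-≤ˡ 0≤ε ε≤1)
                                         (ℚ.≤-trans (ℚ.≤-reflexive (ℚ.*-identityʳ ε)) ε≤1)))) ⟩
          ½ * 1ℚ                ≡⟨⟩
          ½                     ∎)
          where open ℚ.≤-Reasoning

      starred-bound : 2ℚ * B (starred s α₀ es) x f ≤
        ⟪_,_⟫ (starred s α₀ es) x x + (1ℚ - gap ε) * mass² (starred s α₀ es) f
      starred-bound = begin
        2ℚ * B (starred s α₀ es) x f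
          ≡⟨ cong (2ℚ *_) (trans (B-starred s α₀ es x f) (cong (λ z → B es x f + x s α₀ * z) mean)) ⟩
        2ℚ * (B es x f + x s α₀ * (w * μ))
          ≡⟨ ℚ.*-distribˡ-+ 2ℚ (B es x f) _ ⟩
        2ℚ * B es x f + 2ℚ * (x s α₀ * (w * μ))
          ≤⟨ ℚ.+-mono-≤ mixed star-part ⟩
        X + (μ * μ * w * (1ℚ - 2ℚ * gap ε) + V * (1ℚ + ½)) + (Y + μ * μ * w)
          ≤⟨ ≤-by (V * (½ - 2ℚ * gap ε)) (0≤* 0≤V gap-small)
               (solve 5 (λ X Y V m g →
                 X :+ (m :* (con 1ℚ :- con 2ℚ :* g) :+ V :* (con 1ℚ :+ con ½)) :+ (Y :+ m) :+ V :* (con ½ :- con 2ℚ :* g) :=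
                 X :+ Y :+ (con 1ℚ :- g) :* ((V :+ m) :+ (V :+ m))) refl X Y V (μ * μ * w) (gap ε)) ⟩
        X + Y + (1ℚ - gap ε) * ((V + μ * μ * w) + (V + μ * μ * w))
          ≡⟨ cong₂ (λ a b → a + (1ℚ - gap ε) * b) (sym (⟨⟩-starred s α₀ es x))
               (trans (cong (λ z → z + z) V+μ²w) (sym (mass²-starred s α₀ es f))) ⟩
        ⟪_,_⟫ (starred s α₀ es) x x + (1ℚ - gap ε) * mass² (starred s α₀ es) f ∎
        where
        open ℚ.≤-Reasoning
        X Y : ℚ
        X = ⟪_,_⟫ es x x
        Y = w * ∑′ (λ α → x s α * x s α)

    starred-contracts : Contracts (starred s α₀ es) (1ℚ - gap ε)
    starred-contracts = starred-bound

  -- Repeated squaring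

  -- This is n ^ 2 ^ l, by the recursion that `power` and `squares` follow too: the argument is
  -- squared first, so that types and constants match without rewriting.
  tower : ℕ → ℕ → ℕ
  tower zero    n = n
  tower (suc l) n = tower l (n ℕ.* n)

  power : ∀ l {n q} → List (Arc n q) → List (Arc (tower l n) (tower l q))
  power zero    es = es
  power (suc l) es = power l (es ⊠ es)

  squares : ℕ → ℚ → ℚ
  squares zero    c = c
  squares (suc l) c = squares l (c * c)

  contracts-power : ∀ l {n q} (es : List (Arc n q)) {c} → 0ℚ ≤ c → Contracts es c →
                    Contracts (power l es) (squares l c)
  contracts-power zero    es 0≤c ctr = ctr
  contracts-power (suc l) es {c} 0≤c ctr =
    contracts-power l (es ⊠ es) (0≤* 0≤c 0≤c) (contracts-⊠ es es {c} {c} 0≤c ctr ctr)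

  0<W-power : ∀ l {n q} (es : List (Arc n q)) → 0ℚ < W es → 0ℚ < W (power l es)
  0<W-power zero    es 0<W = 0<W
  0<W-power (suc l) es 0<W =
    0<W-power l (es ⊠ es) (subst (0ℚ <_) (sym (W-⊠ es es)) (0<* 0<W 0<W))

  -- d stands in for the root of c. Testing with d ⌈f⌉ and ⌈g⌉ makes the two terms on the right d² W
  -- and c W ≤ d² W, after which the factor 2 d cancels.
  contracts⇒sat≤ : ∀ {n q} (es : List (Arc n q)) {c d} → 0ℚ < d → c ≤ d * d → Contracts es c →
                   ∀ f g → sat es f g ≤ d * W es
  contracts⇒sat≤ {n} {q} es {c} {d} 0<d c≤d² ctr f g =
    ℚ.*-cancelˡ-≤-pos (2ℚ * d) {{ℚ.positive (0<* (ℚ.positive⁻¹ 2ℚ) 0<d)}} (begin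
      2ℚ * d * sat es f g
        ≡⟨ trans (cong (2ℚ * d *_) (sym (B-⌈⌉ es f g))) (trans (ℚ.*-assoc 2ℚ d _)
             (cong (2ℚ *_) (trans (*-∑ (cells₃ es) d _) (∑-cong (cells₃ es) λ t →
               solve 4 (λ d w a b → d :* (w :* (a :* b)) := w :* ((d :* a) :* b)) refl d (w₃ es t) _ _)))) ⟩
      2ℚ * B es x ⌈ g ⌉
        ≤⟨ ctr x ⌈ g ⌉ (λ i α → 0≤* (ℚ.<⇒≤ 0<d) (0≤δ (f i) α)) (⌈⌉-nonNeg g) ⟩
      ⟪_,_⟫ es x x + c * mass² es ⌈ g ⌉
        ≡⟨ cong₂ (λ a b → a + c * b) xx gg ⟩
      d * d * W es + c * W es
        ≤⟨ ℚ.+-monoʳ-≤ (d * d * W es) (*-mono-≤ʳ (0≤∑ es 0≤wt) c≤d²) ⟩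
      d * d * W es + d * d * W es
        ≡⟨ solve 2 (λ d w → d :* d :* w :+ d :* d :* w := con 2ℚ :* d :* (d :* w)) refl d (W es) ⟩
      2ℚ * d * (d * W es) ∎)
    where
    open ℚ.≤-Reasoning
    x : Fun n q
    x i α = d * ⌈ f ⌉ i α
    xx : ⟪_,_⟫ es x x ≡ d * d * W es
    xx = trans (∑-cells₂ es _) (trans (∑-cong es λ e → trans
      (∑-cong (allFin q) λ α → trans
        (solve 3 (λ w d a → w :* (d :* a :* (d :* a)) := (a :* a) :* (d :* d :* w)) refl (wt e) d δ[ f (u e) , α ])
        (cong (_* (d * d * wt e)) (δ-idem (f (u e)) α)))
      (∑′-δ (f (u e)) λ _ → d * d * wt e)) (sym (*-∑ es (d * d) wt)))
    gg : mass² es ⌈ g ⌉ ≡ W es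
    gg = ∑-cong es λ e → trans (cong (λ z → wt e * (z * z)) (∑′-δ₁ (g (v e)))) (ℚ.*-identityʳ (wt e))

  -- Small powers

  infixr 8 _×ℚ_

  _×ℚ_ : ℕ → ℚ → ℚ
  zero  ×ℚ p = 0ℚ
  suc k ×ℚ p = p + k ×ℚ p

  -- In the manner of Bernoulli's inequality: c ≤ 1 - κ persists under squaring, and then c² (1 + t
  -- + κ) ≤ c + κ ≤ 1, so every squaring raises t by κ. Growth linear in l is far from sharp, but it
  -- suffices for the existence of l.
  squares-bound : ∀ l {c κ t} → 0ℚ ≤ c → 0ℚ ≤ κ → c ≤ 1ℚ - κ → c * (1ℚ + t) ≤ 1ℚ →
    squares l c * (1ℚ + (t + l ×ℚ κ)) ≤ 1ℚ
  squares-bound zero    {c} {κ} {t} 0≤c 0≤κ c≤ ct≤1 =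
    subst (λ z → c * (1ℚ + z) ≤ 1ℚ) (sym (ℚ.+-identityʳ t)) ct≤1
  squares-bound (suc l) {c} {κ} {t} 0≤c 0≤κ c≤ ct≤1 =
    subst (λ z → squares l (c * c) * (1ℚ + z) ≤ 1ℚ) (ℚ.+-assoc t κ (l ×ℚ κ))
      (squares-bound l {t = t + κ} (0≤* 0≤c 0≤c) 0≤κ (ℚ.≤-trans c²≤c c≤) (begin
        c * c * (1ℚ + (t + κ))
          ≡⟨ solve 3 (λ c t κ → c :* c :* (con 1ℚ :+ (t :+ κ)) := c :* (c :* (con 1ℚ :+ t)) :+ c :* c :* κ) refl c t κ ⟩
        c * (c * (1ℚ + t)) + c * c * κ
          ≤⟨ ℚ.+-mono-≤ (*-mono-≤ˡ 0≤c ct≤1) (*-mono-≤ʳ 0≤κ (ℚ.≤-trans c²≤c c≤1)) ⟩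
        c * 1ℚ + 1ℚ * κ
          ≡⟨ cong₂ _+_ (ℚ.*-identityʳ c) (ℚ.*-identityˡ κ) ⟩
        c + κ
          ≤⟨ ℚ.+-monoˡ-≤ κ c≤ ⟩
        1ℚ - κ + κ
          ≡⟨ solve 1 (λ κ → con 1ℚ :- κ :+ κ := con 1ℚ) refl κ ⟩
        1ℚ ∎))
    where
    open ℚ.≤-Reasoning
    c≤1 : c ≤ 1ℚ
    c≤1 = ℚ.≤-trans c≤ (≤-by κ 0≤κ (solve 1 (λ κ → con 1ℚ :- κ :+ κ := con 1ℚ) refl κ))
    c²≤c : c * c ≤ c
    c²≤c = ℚ.≤-trans (*-mono-≤ˡ 0≤c c≤1) (ℚ.≤-reflexive (ℚ.*-identityʳ c))

  ×ℚ-* : ∀ k p r → k ×ℚ p * r ≡ k ×ℚ (p * r)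
  ×ℚ-* zero    p r = ℚ.*-zeroˡ r
  ×ℚ-* (suc k) p r = trans (ℚ.*-distribʳ-+ r p (k ×ℚ p)) (cong (p * r +_) (×ℚ-* k p r))

  /1-suc : ∀ k → (ℤ.+ suc k) ℚ./ 1 ≡ 1ℚ + (ℤ.+ k) ℚ./ 1
  /1-suc k = ℚ.toℚᵘ-injective (begin
    ℚ.toℚᵘ ((ℤ.+ suc k) ℚ./ 1)                      ≈⟨ ℚ.toℚᵘ-fromℚᵘ (ℚᵘ.mkℚᵘ (ℤ.+ suc k) 0) ⟩
    ℚᵘ.mkℚᵘ (ℤ.+ suc k) 0                           ≈⟨ ℚᵘ.*≡* (trans
      (ℤ.*-identityʳ (ℤ.+ suc k))
      (sym (trans (ℤ.*-identityʳ _) (cong (ℤ._+_ (ℤ.+ 1)) (ℤ.*-identityʳ (ℤ.+ k)))))) ⟩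
    ℚᵘ.1ℚᵘ ℚᵘ.+ ℚᵘ.mkℚᵘ (ℤ.+ k) 0                   ≈⟨ ℚᵘ.+-congʳ ℚᵘ.1ℚᵘ (ℚ.toℚᵘ-fromℚᵘ (ℚᵘ.mkℚᵘ (ℤ.+ k) 0)) ⟨
    ℚᵘ.1ℚᵘ ℚᵘ.+ ℚ.toℚᵘ ((ℤ.+ k) ℚ./ 1)              ≈⟨ ℚ.toℚᵘ-homo-+ 1ℚ ((ℤ.+ k) ℚ./ 1) ⟨
    ℚ.toℚᵘ (1ℚ + (ℤ.+ k) ℚ./ 1)                     ∎)
    where open ℚᵘ.≃-Reasoning

  ×ℚ-/1 : ∀ k p → k ×ℚ p ≡ (ℤ.+ k) ℚ./ 1 * p
  ×ℚ-/1 zero    p = sym (ℚ.*-zeroˡ p)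
  ×ℚ-/1 (suc k) p = trans (cong (p +_) (×ℚ-/1 k p))
    (sym (trans (cong (_* p) (/1-suc k)) (trans (ℚ.*-distribʳ-+ p 1ℚ ((ℤ.+ k) ℚ./ 1))
      (cong (_+ (ℤ.+ k) ℚ./ 1 * p) (ℚ.*-identityˡ p)))))

  -- The denominator of p will do, since a positive numerator is at least 1.
  archimedean : ∀ p → 0ℚ < p → ∃[ k ] 1ℚ ≤ k ×ℚ p
  archimedean p@(ℚ.mkℚ (ℤ.+ suc m) d _) _ = suc d , subst (1ℚ ≤_) (sym (×ℚ-/1 (suc d) p))
    (ℚ.toℚᵘ-cancel-≤ (ℚᵘ.≤-trans (ℚᵘ.*≤* (ℤ.+≤+ le))
      (ℚᵘ.≤-reflexive (ℚᵘ.≃-sym (ℚᵘ.≃-trans (ℚ.toℚᵘ-homo-* ((ℤ.+ suc d) ℚ./ 1) p)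
        (ℚᵘ.*-congʳ {ℚ.toℚᵘ p} (ℚ.toℚᵘ-fromℚᵘ (ℚᵘ.mkℚᵘ (ℤ.+ suc d) 0))))))))
    where
    le : 1 ℕ.* (1 ℕ.* suc d) ℕ.≤ (suc d ℕ.* suc m) ℕ.* 1
    le rewrite ℕ.*-identityˡ (1 ℕ.* suc d) | ℕ.*-identityˡ (suc d) | ℕ.*-identityʳ (suc d ℕ.* suc m) =
      ℕ.m≤m*n (suc d) (suc m)
  archimedean (ℚ.mkℚ (ℤ.+ zero) d _)  (ℚ.*<* (ℤ.+<+ lt)) = ⊥-elim (ℕ.n≮0 (subst (0 ℕ.<_) refl lt))
  archimedean (ℚ.mkℚ ℤ.-[1+ m ] d _) (ℚ.*<* ())

  -- l is taken with l κ d² ≥ 1, and `squares-bound` starts from t = 0, where (1 - κ)(1 + 0) ≤ 1.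
  squares-small : ∀ {κ d} → 0ℚ < κ → κ ≤ 1ℚ → 0ℚ < d → ∃[ l ] squares l (1ℚ - κ) ≤ d * d
  squares-small {κ} {d} 0<κ κ≤1 0<d = l , (begin
    s                                ≡⟨ ℚ.*-identityʳ s ⟨
    s * 1ℚ                           ≤⟨ *-mono-≤ˡ 0≤s large ⟩
    s * (l ×ℚ κ * (d * d))           ≤⟨ *-mono-≤ˡ 0≤s (*-mono-≤ʳ 0≤d² (≤-by {l ×ℚ κ} 1ℚ 0≤1 (ℚ.+-comm (l ×ℚ κ) 1ℚ))) ⟩
    s * ((1ℚ + l ×ℚ κ) * (d * d))    ≡⟨ ℚ.*-assoc s _ _ ⟨
    s * (1ℚ + l ×ℚ κ) * (d * d)      ≤⟨ *-mono-≤ʳ 0≤d² bounded ⟩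
    1ℚ * (d * d)                     ≡⟨ ℚ.*-identityˡ (d * d) ⟩
    d * d                            ∎)
    where
    open ℚ.≤-Reasoning
    l : ℕ
    l = proj₁ (archimedean (κ * (d * d)) (0<* 0<κ (0<* 0<d 0<d)))
    s : ℚ
    s = squares l (1ℚ - κ)
    0≤d² : 0ℚ ≤ d * d
    0≤d² = 0≤² d
    0≤squares : ∀ l {c} → 0ℚ ≤ c → 0ℚ ≤ squares l c
    0≤squares zero    0≤c = 0≤c
    0≤squares (suc l) 0≤c = 0≤squares l (0≤* 0≤c 0≤c)
    0≤s : 0ℚ ≤ s
    0≤s = 0≤squares l (0≤difference κ≤1)
    large : 1ℚ ≤ l ×ℚ κ * (d * d)
    large = subst (1ℚ ≤_) (sym (×ℚ-* l κ (d * d)))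
      (proj₂ (archimedean (κ * (d * d)) (0<* 0<κ (0<* 0<d 0<d))))
    bounded : s * (1ℚ + l ×ℚ κ) ≤ 1ℚ
    bounded = subst (λ z → s * (1ℚ + z) ≤ 1ℚ) (ℚ.+-identityˡ (l ×ℚ κ))
      (squares-bound l {t = 0ℚ} (0≤difference κ≤1) (ℚ.<⇒≤ 0<κ) ℚ.≤-refl
        (≤-by κ (ℚ.<⇒≤ 0<κ) (solve 1 (λ κ → (con 1ℚ :- κ) :* (con 1ℚ :+ con 0ℚ) :+ κ := con 1ℚ) refl κ)))

  -- Satisfying assignments

  Satisfies : ∀ {n q} → (Fin n → Fin q) → (Fin n → Fin q) → List (Arc n q) → Set
  Satisfies f g es = ∀ e → e ∈ es → allowed e (f (u e)) (g (v e)) ≡ true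

  Satisfiable : ∀ {n q} → List (Arc n q) → Set
  Satisfiable es = ∃[ f ] ∃[ g ] Satisfies f g es

  pair : ∀ {n q n′ q′} → (Fin n → Fin q) → (Fin n′ → Fin q′) → Fin (n ℕ.* n′) → Fin (q ℕ.* q′)
  pair {n} {n′ = n′} f f′ i = combine (f (proj₁ (remQuot {n} n′ i))) (f′ (proj₂ (remQuot {n} n′ i)))

  pair-combine : ∀ {n q n′ q′} (f : Fin n → Fin q) (f′ : Fin n′ → Fin q′) i i′ →
                 pair f f′ (combine i i′) ≡ combine (f i) (f′ i′)
  pair-combine f f′ i i′ = cong (λ (a , b) → combine (f a) (f′ b)) (Fin.remQuot-combine i i′)

  allowed-⊗ : ∀ {n q n′ q′} (e : Arc n q) (e′ : Arc n′ q′) α α′ β β′ →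
    allowed (e ⊗ e′) (combine α α′) (combine β β′) ≡ allowed e α β ∧ allowed e′ α′ β′
  allowed-⊗ e e′ α α′ β β′ = cong₂ (both e e′) (Fin.remQuot-combine α α′) (Fin.remQuot-combine β β′)

  satisfiable-⊠ : ∀ {n q n′ q′} {es : List (Arc n q)} {es′ : List (Arc n′ q′)} →
    Satisfiable es → Satisfiable es′ → Satisfiable (es ⊠ es′)
  satisfiable-⊠ {es = es} {es′} (f , g , ok) (f′ , g′ , ok′) = pair f f′ , pair g g′ , satisfied
    where
    satisfied : Satisfies (pair f f′) (pair g g′) (es ⊠ es′)
    satisfied e″ e″∈ with ∈-cartesianProductWith⁻ _⊗_ es es′ e″∈
    ... | e , e′ , e∈ , e′∈ , refl = trans
      (cong₂ (allowed (e ⊗ e′)) (pair-combine f f′ (u e) (u e′)) (pair-combine g g′ (v e) (v e′)))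
      (trans (allowed-⊗ e e′ _ _ _ _) (cong₂ _∧_ (ok e e∈) (ok′ e′ e′∈)))

  satisfiable-power : ∀ l {n q} {es : List (Arc n q)} → Satisfiable es → Satisfiable (power l es)
  satisfiable-power zero    sat = sat
  satisfiable-power (suc l) {es = es} sat = satisfiable-power l (satisfiable-⊠ {es = es} {es} sat sat)

  -- Only f is changed, and only at s, so s must not be the u-end of an old arc. It may well be a
  -- v-end: the two sides share their vertex numbers.
  satisfiable-starred : ∀ {n q} s (α₀ : Fin q) {es : List (Arc n q)} → (∀ e → e ∈ es → u e ≢ s) →
    Satisfiable es → Satisfiable (starred s α₀ es)
  satisfiable-starred {n} {q} s α₀ {es} fresh (f , g , ok) = f′ , g , satisfied es fresh ok
    where
    f′ : Fin n → Fin q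
    f′ i = if does (i Fin.≟ s) then α₀ else f i
    f′-other : ∀ i → i ≢ s → f′ i ≡ f i
    f′-other i i≢s with i Fin.≟ s
    ... | yes i≡s = ⊥-elim (i≢s i≡s)
    ... | no _    = refl
    f′-star : f′ s ≡ α₀
    f′-star with s Fin.≟ s
    ... | yes _  = refl
    ... | no s≢s = ⊥-elim (s≢s refl)
    same : does (α₀ Fin.≟ α₀) ≡ true
    same with α₀ Fin.≟ α₀
    ... | yes _ = refl
    ... | no ne = ⊥-elim (ne refl)
    satisfied : ∀ es → (∀ e → e ∈ es → u e ≢ s) → Satisfies f g es → Satisfies f′ g (starred s α₀ es)
    satisfied (e ∷ es) fresh ok _ (here refl) =
      trans (cong (λ i → allowed e i (g (v e))) (f′-other (u e) (fresh e (here refl)))) (ok e (here refl))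
    satisfied (e ∷ es) fresh ok _ (there (here refl)) =
      trans (cong (λ α → does (α₀ Fin.≟ α)) f′-star) same
    satisfied (e ∷ es) fresh ok e′ (there (there e′∈)) =
      satisfied es (λ e″ → fresh e″ ∘ there) (λ e″ → ok e″ ∘ there) e′ e′∈

-- Encodings of games and the programs that transform them

module Formats where

  open Machines using (Cmd; nop; emit; _⨾_; scan; scanning; ⟦_⟧)
  open Amplification using (Arc; both; _⊗_; _⊠_; star; starred)
  open Arc

  open import Data.Bool.Base using (Bool; true; false; if_then_else_; _∧_)
  open import Data.Fin.Base
    using (Fin; zero; suc; toℕ; fromℕ; fromℕ<; inject₁; inject≤; combine; remQuot; splitAt; join)
  import Data.Fin.Properties as Fin
  open import Data.List.Base as List
    using (List; []; _∷_; _++_; length; replicate; concat; concatMap; tabulate; allFin; map; cartesianProductWith)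
  import Data.List.Properties as List
  open import Data.Nat.Base as ℕ using (ℕ; zero; suc; _+_; _*_; _^_; _<_; z≤n; s≤s)
  import Data.Nat.Properties as ℕ
  open import Data.Nat.Binary.Base as ℕᵇ using (ℕᵇ; 2[1+_]; 1+[2_])
  import Data.Nat.Binary.Properties as ℕᵇ
  open import Data.Product.Base using (_×_; _,_; proj₂)
  open import Data.Sum.Base using (_⊎_; inj₁; inj₂)
  open import Data.Vec.Base as Vec using (Vec; []; _∷_; lookup)
  import Data.Vec.Properties as Vec
  open import Function.Base using (_∘_; id)
  open import Relation.Binary.PropositionalEquality
  open import Relation.Nullary using (does)

  -- Words made of unary fields

  fieldsWord : List ℕ → Word
  fieldsWord = concatMap unary

  fieldsWord-∷ : ∀ a as w → fieldsWord (a ∷ as) ++ w ≡ unary a ++ (fieldsWord as ++ w)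
  fieldsWord-∷ a as w = List.++-assoc (unary a) (fieldsWord as) w

  repeat : ℕ → Word → Word
  repeat k w = concat (replicate k w)

  ones : ℕ → Word
  ones k = replicate k true

  ones-++ : ∀ m l → ones m ++ ones l ≡ ones (m + l)
  ones-++ zero    l = refl
  ones-++ (suc m) l = cong (true ∷_) (ones-++ m l)

  repeat-ones : ∀ k m → repeat k (ones m) ≡ ones (k * m)
  repeat-ones zero    m = refl
  repeat-ones (suc k) m = trans (cong (ones m ++_) (repeat-ones k m)) (ones-++ m (k * m))

  repeat-true : ∀ k → repeat k (true ∷ []) ≡ ones k
  repeat-true zero    = refl
  repeat-true (suc k) = cong (true ∷_) (repeat-true k)

  nth : List ℕ → ℕ → ℕ
  nth []       _       = 0
  nth (a ∷ as) zero    = a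
  nth (a ∷ as) (suc j) = nth as j

  nth-tabulate : ∀ {m} (f : Fin m → ℕ) k → nth (tabulate f) (toℕ k) ≡ f k
  nth-tabulate f zero    = refl
  nth-tabulate f (suc k) = nth-tabulate (f ∘ suc) k

  -- Access to a field

  -- State 0: field done; state 1: at the field; state 2 + s: 1 + s fields to skip.
  seek : ∀ {j} → Bool → Fin (2 + j) → Bool → Fin (2 + j)
  seek stay zero          b     = zero
  seek stay (suc zero)    true  = if stay then suc zero else zero
  seek stay (suc zero)    false = zero
  seek stay (suc (suc s)) true  = suc (suc s)
  seek stay (suc (suc s)) false = suc (inject₁ s)

  atField : ∀ {d n j} → (Bool → Cmd d (suc n)) → Fin (2 + j) → Bool → Cmd d (suc n)
  atField body zero          b = nop
  atField body (suc zero)    b = body b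
  atField body (suc (suc s)) b = nop

  whenTrue : ∀ {d n} → Cmd d n → Bool → Cmd d n
  whenTrue c true  = c
  whenTrue c false = nop

  -- Runs c as often as field j of word i says.
  times : ∀ {d n} → ℕ → Fin n → Cmd d (suc n) → Cmd (suc d) n
  times j i c = scan i (fromℕ (suc j)) (seek true) (atField (whenTrue c))

  -- Runs body b for the first bit b of field j of word i.
  first : ∀ {d n} → ℕ → Fin n → (Bool → Cmd d (suc n)) → Cmd (suc d) n
  first j i body = scan i (fromℕ (suc j)) (seek false) (atField body)

  module _ {d n j : ℕ} (stay : Bool) (body : Bool → Cmd d (suc n)) (ρ : Vec Word n) where

    seeking : Fin (2 + j) → Word → Word
    seeking s = scanning (seek stay) (λ s b → ⟦ atField body s b ⟧) s ρ

    seeking-done : ∀ w → seeking zero w ≡ []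
    seeking-done []      = refl
    seeking-done (b ∷ w) = seeking-done w

    seeking-skip : ∀ s a w → seeking (suc (suc s)) (unary a ++ w) ≡ seeking (suc (inject₁ s)) w
    seeking-skip s zero    w = refl
    seeking-skip s (suc a) w = seeking-skip s a w

    -- A predicate on the output serves both `times` and `first`. It is required for every
    -- continuation w, since what follows the field is visible to the body.
    seeking-field : ∀ {P : Word → Set} as k s → toℕ s ≡ suc k → k < length as →
      (∀ w → P (seeking (suc zero) (unary (nth as k) ++ w))) →
      ∀ w → P (seeking s (fieldsWord as ++ w))
    seeking-field (a ∷ as) zero    (suc zero)    eq lt p w
      rewrite fieldsWord-∷ a as w = p (fieldsWord as ++ w)
    seeking-field {P} (a ∷ as) (suc k) (suc (suc s)) eq (s≤s lt) p w
      rewrite fieldsWord-∷ a as w | seeking-skip s a (fieldsWord as ++ w) =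
      seeking-field {P} as k (suc (inject₁ s))
        (cong suc (trans (Fin.toℕ-inject₁ s) (ℕ.suc-injective (ℕ.suc-injective eq)))) lt p w

  module _ {d n : ℕ} {ρ : Vec Word n} (i : Fin n) {as : List ℕ} {w : Word}
           (word : lookup ρ i ≡ fieldsWord as ++ w) where

    ⟦times⟧ : ∀ j (c : Cmd d (suc n)) {o} → j < length as → (∀ w → ⟦ c ⟧ (w ∷ ρ) ≡ o) →
              ⟦ times j i c ⟧ ρ ≡ repeat (nth as j) o
    ⟦times⟧ j c {o} lt c≡ rewrite word =
      seeking-field {j = j} true (whenTrue c) ρ {λ x → x ≡ repeat (nth as j) o}
        as j (fromℕ (suc j)) (Fin.toℕ-fromℕ (suc j)) lt (active (nth as j)) w
      where
      active : ∀ a w → seeking {j = j} true (whenTrue c) ρ (suc zero) (unary a ++ w) ≡ repeat a o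
      active zero    w = seeking-done {j = j} true (whenTrue c) ρ w
      active (suc a) w = cong₂ _++_ (c≡ (unary a ++ w)) (active a w)

    ⟦first⟧ : ∀ j (body : Bool → Cmd d (suc n)) {P : Word → Set} → j < length as →
      (∀ w → P (⟦ body (0 ℕ.<ᵇ nth as j) ⟧ (w ∷ ρ))) → P (⟦ first j i body ⟧ ρ)
    ⟦first⟧ j body {P} lt p rewrite word =
      seeking-field {j = j} false body ρ {P} as j (fromℕ (suc j)) (Fin.toℕ-fromℕ (suc j)) lt
        (active (nth as j) p) w
      where
      active : ∀ a → (∀ w → P (⟦ body (0 ℕ.<ᵇ a) ⟧ (w ∷ ρ))) →
               ∀ w → P (seeking {j = j} false body ρ (suc zero) (unary a ++ w))
      active zero p w = subst P
        (sym (trans (cong (⟦ body false ⟧ (w ∷ ρ) ++_) (seeking-done {j = j} false body ρ w)) (List.++-identityʳ _)))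
        (p w)
      active (suc a) p w = subst P
        (sym (trans (cong (⟦ body true ⟧ ((unary a ++ w) ∷ ρ) ++_)
          (seeking-done {j = j} false body ρ (unary a ++ w))) (List.++-identityʳ _)))
        (p (unary a ++ w))

  -- Iteration over records

  -- A record consists of the marker field 1 and K further fields.  The state
  -- is the number of fields before the next marker.
  advance : ∀ {K} → Fin (suc K) → Bool → Fin (suc K)
  advance zero    true  = zero
  advance zero    false = fromℕ _
  advance (suc s) true  = suc s
  advance (suc s) false = inject₁ s

  atMarker : ∀ {d n K} → Cmd d (suc n) → Fin (suc K) → Bool → Cmd d (suc n)
  atMarker body zero    true  = body
  atMarker body zero    false = nop
  atMarker body (suc _) _     = nop

  -- `start` is the number of header fields, which are skipped as if they were the end of a
  -- preceding record.
  records : ∀ {d n} K → Fin (suc K) → Fin n → Cmd d (suc n) → Cmd (suc d) n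
  records K start i body = scan i start advance (atMarker body)

  recordsWord : {X : Set} → (X → List ℕ) → List X → Word
  recordsWord fs = concatMap λ x → fieldsWord (1 ∷ fs x)

  module _ {d n K : ℕ} (body : Cmd d (suc n)) (ρ : Vec Word n) where

    stepping : Fin (suc K) → Word → Word
    stepping s = scanning advance (λ s b → ⟦ atMarker body s b ⟧) s ρ

    stepping-field : ∀ s a w → stepping (suc s) (unary a ++ w) ≡ stepping (inject₁ s) w
    stepping-field s zero    w = refl
    stepping-field s (suc a) w = stepping-field s a w

    stepping-fields : ∀ as s → toℕ s ≡ length as → ∀ w →
      stepping s (fieldsWord as ++ w) ≡ stepping zero w
    stepping-fields []       zero    eq w = refl
    stepping-fields (a ∷ as) (suc s) eq w = begin
      stepping (suc s) (fieldsWord (a ∷ as) ++ w)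
        ≡⟨ cong (stepping (suc s)) (List.++-assoc (unary a) (fieldsWord as) w) ⟩
      stepping (suc s) (unary a ++ (fieldsWord as ++ w)) ≡⟨ stepping-field s a _ ⟩
      stepping (inject₁ s) (fieldsWord as ++ w)
        ≡⟨ stepping-fields as (inject₁ s) (trans (Fin.toℕ-inject₁ s) (ℕ.suc-injective eq)) w ⟩
      stepping zero w ∎
      where open ≡-Reasoning

    -- The body runs at the `true` of the marker. What is then in scope begins with the `false` of
    -- the marker, which reads as a field 0; this is why the proper fields of a record are numbered
    -- from 1.
    stepping-records : ∀ {X : Set} (fs : X → List ℕ) (o : X → Word) → (∀ x → length (fs x) ≡ K) →
      (∀ x w → ⟦ body ⟧ ((fieldsWord (0 ∷ fs x) ++ w) ∷ ρ) ≡ o x) →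
      ∀ xs → stepping zero (recordsWord fs xs) ≡ concatMap o xs
    stepping-records fs o len body≡ []       = refl
    stepping-records fs o len body≡ (x ∷ xs) = cong₂ _++_ (body≡ x (recordsWord fs xs))
      (trans (stepping-fields (fs x) (fromℕ K) (trans (Fin.toℕ-fromℕ K) (sym (len x))) (recordsWord fs xs))
        (stepping-records fs o len body≡ xs))

  ⟦records⟧ : ∀ {d n K} {ρ : Vec Word n} (i : Fin n) {as : List ℕ} {X : Set} {fs : X → List ℕ} {xs : List X} →
    lookup ρ i ≡ fieldsWord as ++ recordsWord fs xs → (start : Fin (suc K)) → toℕ start ≡ length as →
    (∀ x → length (fs x) ≡ K) → (body : Cmd d (suc n)) (o : X → Word) →
    (∀ x w → ⟦ body ⟧ ((fieldsWord (0 ∷ fs x) ++ w) ∷ ρ) ≡ o x) →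
    ⟦ records K start i body ⟧ ρ ≡ concatMap o xs
  ⟦records⟧ {ρ = ρ} i {as} {fs = fs} {xs} word start start≡ len body o body≡ rewrite word =
    trans (stepping-fields body ρ as start start≡ (recordsWord fs xs))
      (stepping-records body ρ fs o len body≡ xs)

  -- Output of constants and lists

  emits : ∀ {d n} → Word → Cmd d n
  emits []      = nop
  emits (b ∷ w) = emit b ⨾ emits w

  ⟦emits⟧ : ∀ {d n} w (ρ : Vec Word n) → ⟦ emits {d} w ⟧ ρ ≡ w
  ⟦emits⟧ []      ρ = refl
  ⟦emits⟧ (b ∷ w) ρ = cong (b ∷_) (⟦emits⟧ w ρ)

  sequence : ∀ {d n} {X : Set} → List X → (X → Cmd d n) → Cmd d n
  sequence []       c = nop
  sequence (x ∷ xs) c = c x ⨾ sequence xs c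

  ⟦sequence⟧ : ∀ {d n} {X : Set} (xs : List X) (c : X → Cmd d n) (ρ : Vec Word n) {o : X → Word} →
    (∀ x → ⟦ c x ⟧ ρ ≡ o x) → ⟦ sequence xs c ⟧ ρ ≡ concatMap o xs
  ⟦sequence⟧ []       c ρ eq = refl
  ⟦sequence⟧ (x ∷ xs) c ρ eq = cong₂ _++_ (eq x) (⟦sequence⟧ xs c ρ eq)

  concatMap-tabulate : ∀ {A : Set} {m} (g : A → Word) (f : Fin m → A) →
    concatMap g (tabulate f) ≡ concatMap (g ∘ f) (allFin m)
  concatMap-tabulate g f = cong concat
    (trans (List.map-tabulate f g) (sym (List.map-tabulate id (g ∘ f))))

  copies : ∀ {d n} {ρ : Vec Word n} (i : Fin n) {as : List ℕ} {w : Word} →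
    lookup ρ i ≡ fieldsWord as ++ w → ∀ j → j < length as → ⟦ times {d} j i (emit true) ⟧ ρ ≡ ones (nth as j)
  copies {d} {n} {ρ} i {as} {w} word j lt =
    trans (⟦times⟧ {d} {n} {ρ} i {as} {w} word j (emit true) lt λ _ → refl) (repeat-true (nth as j))

  products : ∀ {d n} {ρ : Vec Word n} (i i′ : Fin n) {as as′ : List ℕ} {w w′ : Word} →
    lookup ρ i ≡ fieldsWord as ++ w → lookup ρ i′ ≡ fieldsWord as′ ++ w′ →
    ∀ j j′ → j < length as → j′ < length as′ →
    ⟦ times {suc d} j i (times j′ (suc i′) (emit true)) ⟧ ρ ≡ ones (nth as j * nth as′ j′)
  products {d} {n} {ρ} i i′ {as} {as′} {w} {w′} word word′ j j′ lt lt′ =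
    trans (⟦times⟧ {suc d} {n} {ρ} i {as} {w} word j (times j′ (suc i′) (emit true)) lt
            λ x → copies {ρ = x ∷ ρ} (suc i′) {as′} {w′} word′ j′ lt′)
      (repeat-ones (nth as j) (nth as′ j′))

  -- The intermediate format of games

  bit : Bool → ℕ
  bit true  = 1
  bit false = 0

  bit-∧ : ∀ a b → bit a * bit b ≡ bit (a ∧ b)
  bit-∧ true  true  = refl
  bit-∧ true  false = refl
  bit-∧ false b     = refl

  cell : ∀ {n q} → Arc n q → Fin q × Fin q → Bool
  cell e (β , α) = allowed e α β

  -- With all numbers in unary, sums are consecutive loops and products nested ones. The table has β
  -- as its outer index, like `rel`, so entries keep their order in passing from and to the official
  -- encoding.
  fields : ∀ {n q} → Arc n q → List ℕ
  fields {q = q} e = toℕ (u e) ∷ toℕ (v e) ∷ up e ∷ down e ∷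
                     tabulate {n = q * q} λ k → bit (cell e (remQuot {q} q k))

  length-fields : ∀ {n q} (e : Arc n q) → length (fields e) ≡ 4 + q * q
  length-fields e = cong (4 +_) (List.length-tabulate _)

  gameWord : ∀ {n q} → List (Arc n q) → Word
  gameWord {n} es = fieldsWord (n ∷ []) ++ recordsWord fields es

  -- Five fields precede the table: the rest of the marker, two vertices and two exponents.
  cellField : ∀ {q} → Fin q → Fin q → ℕ
  cellField β α = 5 + toℕ (combine β α)

  nth-cell : ∀ {n q} (e : Arc n q) β α → nth (0 ∷ fields e) (cellField β α) ≡ bit (allowed e α β)
  nth-cell {q = q} e β α = trans (nth-tabulate (λ k → bit (cell e (remQuot {q} q k))) (combine β α))
    (cong (bit ∘ cell e) (Fin.remQuot-combine β α))

  header< : ∀ {n q j} (e : Arc n q) → j < 5 → j < length (0 ∷ fields e)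
  header< e j<5 = ℕ.<-≤-trans j<5 (s≤s (s≤s (s≤s (s≤s (s≤s z≤n)))))

  cell< : ∀ {n q} (e : Arc n q) (β α : Fin q) → cellField β α < length (0 ∷ fields e)
  cell< {q = q} e β α = subst (λ l → cellField β α < suc l) (sym (length-fields e))
    (ℕ.+-monoʳ-< 5 (Fin.toℕ<n (combine β α)))

  unary-+ : ∀ a b → ones a ++ (ones b ++ false ∷ []) ≡ unary (a + b)
  unary-+ a b = trans (sym (List.++-assoc (ones a) (ones b) _)) (cong (_++ false ∷ []) (ones-++ a b))

  -- Squaring

  concatMap-cartesian : ∀ {X Y Z : Set} (g : Z → Word) (h : X → Y → Z) xs ys →
    concatMap g (cartesianProductWith h xs ys) ≡ concatMap (λ x → concatMap (g ∘ h x) ys) xs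
  concatMap-cartesian g h []       ys = refl
  concatMap-cartesian g h (x ∷ xs) ys = trans
    (List.concatMap-++ g (map (h x) ys) (cartesianProductWith h xs ys))
    (cong₂ _++_ (List.concatMap-map g (h x) ys) (concatMap-cartesian g h xs ys))

  private
    e₁ e₂ : Fin 3
    e₂ = zero
    e₁ = suc zero

  -- The number i n + i′ of a pair of vertices. As n depends on the input, it is read from the
  -- header of the whole word, whereas q is a parameter of the program.
  combined : ℕ → Cmd 2 3
  combined j = times j e₁ (times 0 (suc (suc (suc zero))) (emit true)) ⨾ times j e₂ (emit true) ⨾ emit false

  added : ℕ → Cmd 2 3
  added j = times j e₁ (emit true) ⨾ times j e₂ (emit true) ⨾ emit false

  conjunction : ∀ {q} → (Fin q × Fin q) × (Fin q × Fin q) → Cmd 2 3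
  conjunction ((β , β′) , (α , α′)) =
    times (cellField β α) e₁ (times (cellField β′ α′) (suc e₂) (emit true)) ⨾ emit false

  split² : ∀ {q} → Fin (q * q * (q * q)) → (Fin q × Fin q) × (Fin q × Fin q)
  split² {q} k = let δ , γ = remQuot {q * q} (q * q) k in remQuot {q} q δ , remQuot {q} q γ

  pairing : ℕ → Cmd 2 3
  pairing q = emit true ⨾ emit false ⨾ combined 1 ⨾ combined 2 ⨾ added 3 ⨾ added 4 ⨾
    sequence (allFin (q * q * (q * q))) λ k → conjunction {q} (split² {q} k)

  square : ℕ → Cmd 4 1
  square q = times 0 zero (times 0 (suc zero) (emit true)) ⨾ emit false ⨾
    records (4 + q * q) (suc zero) zero
      (records (4 + q * q) (suc zero) (suc zero) (pairing q))

  module _ {n q : ℕ} (w₀ : Word) (e e′ : Arc n q) (w w′ : Word) where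
    private
      ρ : Vec Word 3
      ρ = (fieldsWord (0 ∷ fields e′) ++ w′) ∷ (fieldsWord (0 ∷ fields e) ++ w) ∷ (fieldsWord (n ∷ []) ++ w₀) ∷ []

      ⟦combined⟧ : ∀ j → j < 5 → ⟦ combined j ⟧ ρ ≡
        unary (nth (0 ∷ fields e) j * n + nth (0 ∷ fields e′) j)
      ⟦combined⟧ j j<5 = trans
        (cong₂ (λ x y → x ++ (y ++ false ∷ []))
          (products {ρ = ρ} e₁ (suc (suc zero)) {0 ∷ fields e} {n ∷ []} refl refl j 0 (header< e j<5) (s≤s z≤n))
          (copies {ρ = ρ} e₂ {0 ∷ fields e′} refl j (header< e′ j<5)))
        (unary-+ (nth (0 ∷ fields e) j * n) (nth (0 ∷ fields e′) j))

      ⟦added⟧ : ∀ j → j < 5 → ⟦ added j ⟧ ρ ≡ unary (nth (0 ∷ fields e) j + nth (0 ∷ fields e′) j)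
      ⟦added⟧ j j<5 = trans
        (cong₂ (λ x y → x ++ (y ++ false ∷ []))
          (copies {ρ = ρ} e₁ {0 ∷ fields e} refl j (header< e j<5))
          (copies {ρ = ρ} e₂ {0 ∷ fields e′} refl j (header< e′ j<5)))
        (unary-+ (nth (0 ∷ fields e) j) (nth (0 ∷ fields e′) j))

      ⟦conjunction⟧ : ∀ β β′ α α′ → ⟦ conjunction ((β , β′) , (α , α′)) ⟧ ρ ≡
        unary (bit (allowed e α β ∧ allowed e′ α′ β′))
      ⟦conjunction⟧ β β′ α α′ = cong (_++ false ∷ []) (trans
        (products {ρ = ρ} e₁ e₂ {0 ∷ fields e} {0 ∷ fields e′} refl refl
          (cellField β α) (cellField β′ α′) (cell< e β α) (cell< e′ β′ α′))
        (cong ones (trans (cong₂ _*_ (nth-cell e β α) (nth-cell e′ β′ α′)) (bit-∧ (allowed e α β) _))))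

      vertex : ∀ {i j : Fin n} → unary (toℕ i * n + toℕ j) ≡ unary (toℕ (combine i j))
      vertex {i} {j} = cong unary (sym (trans (Fin.toℕ-combine i j) (cong (_+ toℕ j) (ℕ.*-comm n (toℕ i)))))

    ⟦pairing⟧ : ⟦ pairing q ⟧ ρ ≡ fieldsWord (1 ∷ fields (e ⊗ e′))
    ⟦pairing⟧ = cong (λ x → true ∷ false ∷ x)
      (cong₂ _++_ (trans (⟦combined⟧ 1 (s≤s (s≤s z≤n))) vertex)
      (cong₂ _++_ (trans (⟦combined⟧ 2 (s≤s (s≤s (s≤s z≤n)))) vertex)
      (cong₂ _++_ (⟦added⟧ 3 (s≤s (s≤s (s≤s (s≤s z≤n)))))
      (cong₂ _++_ (⟦added⟧ 4 (s≤s (s≤s (s≤s (s≤s (s≤s z≤n))))))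
      (trans (⟦sequence⟧ (allFin (q * q * (q * q))) (λ k → conjunction {q} (split² {q} k)) ρ λ k → ⟦conjunction⟧ _ _ _ _)
        (sym (concatMap-tabulate unary (λ k → bit (cell (e ⊗ e′) (remQuot {q * q} (q * q) k))))))))))

  ⟦square⟧ : ∀ {n q} (es : List (Arc n q)) → ⟦ square q ⟧ (gameWord es ∷ []) ≡ gameWord (es ⊠ es)
  ⟦square⟧ {n} {q} es = trans
    (cong₂ (λ x y → x ++ (false ∷ y))
      (products {ρ = gameWord es ∷ []} zero zero {n ∷ []} {n ∷ []}
        {recordsWord fields es} {recordsWord fields es} refl refl 0 0 (s≤s z≤n) (s≤s z≤n))
      (⟦records⟧ {K = 4 + q * q} {ρ = gameWord es ∷ []} zero {n ∷ []}
        {fs = fields {n} {q}} {xs = es} refl (suc zero) refl length-fields _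
        (λ e → concatMap (λ e′ → fieldsWord (1 ∷ fields (e ⊗ e′))) es)
        λ e w → ⟦records⟧ {K = 4 + q * q} {ρ = (fieldsWord (0 ∷ fields e) ++ w) ∷ gameWord es ∷ []}
          (suc zero) {n ∷ []} {fs = fields {n} {q}} {xs = es} refl
          (suc zero) refl length-fields _ _ λ e′ w′ → ⟦pairing⟧ (recordsWord fields es) e e′ w w′))
    (trans (cong (λ x → ones (n * n) ++ (false ∷ x))
        (sym (concatMap-cartesian (λ e → fieldsWord (1 ∷ fields e)) _⊗_ es es)))
      (trans (sym (List.++-assoc (ones (n * n)) (false ∷ []) _))
        (cong (_++ recordsWord fields (es ⊠ es)) (sym (List.++-identityʳ _)))))

  -- Output in the official encoding

  -- Numerator and denominator are both doubled, which leaves the weight as it is: in bijective base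
  -- 2, the number 2 ^ (k + 1) has the lowest digit 2 and then k digits 1, while 2 ^ 0 would be an
  -- exception.
  toEdge : ∀ {n q} → Arc n q → Edge n n q
  toEdge e = record
    { u = u e ; v = v e
    ; num = 2 ^ suc (up e) ; den = 2 ^ suc (down e)
    ; den≢0 = ℕ.m^n≢0 2 (suc (down e))
    ; constraint = record
      { rel = Vec.tabulate λ β → Vec.tabulate λ α → allowed e α β
      ; functional = λ β {α} {α′} α∈ α′∈ → functional e β (member β α α∈) (member β α′ α′∈)
      }
    }
    where
    member : ∀ β α → _ → allowed e α β ≡ true
    member β α α∈ = trans (sym (Vec.lookup∘tabulate (λ α → allowed e α β) α))
      (trans (cong (λ r → lookup r α) (sym (Vec.lookup∘tabulate (λ β → Vec.tabulate λ α → allowed e α β) β)))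
        (Vec.[]=⇒lookup α∈))

  encodeEdges : ∀ {nU nV q} → List (Edge nU nV q) → Word
  encodeEdges = concatMap λ e → true ∷ encodeEdge e

  allOnes : ℕ → ℕᵇ
  allOnes zero    = ℕᵇ.zero
  allOnes (suc k) = 1+[2 allOnes k ]

  toℕ-allOnes : ∀ k → suc (ℕᵇ.toℕ (allOnes k)) ≡ 2 ^ k
  toℕ-allOnes zero    = refl
  toℕ-allOnes (suc k) = trans (cong suc (sym (ℕ.+-suc (ℕᵇ.toℕ (allOnes k)) _)))
    (cong (2 *_) (toℕ-allOnes k))

  fromℕ-2^ : ∀ k → ℕᵇ.fromℕ (2 ^ suc k) ≡ 2[1+ allOnes k ]
  fromℕ-2^ k = ℕᵇ.toℕ-injective (trans (ℕᵇ.toℕ-fromℕ (2 ^ suc k)) (cong (2 *_) (sym (toℕ-allOnes k))))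

  encode-allOnes : ∀ k → encodeℕᵇ (allOnes k) ≡ repeat k (true ∷ false ∷ []) ++ false ∷ []
  encode-allOnes zero    = refl
  encode-allOnes (suc k) = cong (λ w → true ∷ false ∷ w) (encode-allOnes k)

  binary-2^ : ∀ k → binary (2 ^ suc k) ≡ true ∷ true ∷ repeat k (true ∷ false ∷ []) ++ false ∷ []
  binary-2^ k = trans (cong encodeℕᵇ (fromℕ-2^ k)) (cong (λ w → true ∷ true ∷ w) (encode-allOnes k))

  toList-tabulate : ∀ {A : Set} {m} (f : Fin m → A) → Vec.toList (Vec.tabulate f) ≡ tabulate f
  toList-tabulate {m = zero}  f = refl
  toList-tabulate {m = suc m} f = cong (f zero ∷_) (toList-tabulate (f ∘ suc))

  copyField : ∀ {d n} → ℕ → Fin n → Cmd (suc d) n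
  copyField j i = times j i (emit true) ⨾ emit false

  copyPower : ∀ {d n} → ℕ → Fin n → Cmd (suc d) n
  copyPower j i = emit true ⨾ emit true ⨾ times j i (emit true ⨾ emit false) ⨾ emit false

  putEdge : ℕ → Cmd 1 2
  putEdge q = emit true ⨾ copyField 1 zero ⨾ copyField 2 zero ⨾ copyPower 3 zero ⨾ copyPower 4 zero ⨾
    sequence (allFin q) λ β → sequence (allFin q) λ α → first (cellField β α) zero emit

  finish : ℕ → Cmd 2 1
  finish q = copyField 0 zero ⨾ copyField 0 zero ⨾ emits (unary q) ⨾
    records (4 + q * q) (suc zero) zero (putEdge q) ⨾ emit false

  ⟦copyField⟧ : ∀ {d n} {ρ : Vec Word n} (i : Fin n) {as : List ℕ} {w : Word} →
    lookup ρ i ≡ fieldsWord as ++ w → ∀ j → j < length as → ⟦ copyField {d} j i ⟧ ρ ≡ unary (nth as j)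
  ⟦copyField⟧ {d} {ρ = ρ} i {as} {w} word j lt =
    cong (_++ false ∷ []) (copies {d} {ρ = ρ} i {as} {w} word j lt)

  ⟦copyPower⟧ : ∀ {d n} {ρ : Vec Word n} (i : Fin n) {as : List ℕ} {w : Word} →
    lookup ρ i ≡ fieldsWord as ++ w → ∀ j → j < length as →
    ⟦ copyPower {d} j i ⟧ ρ ≡ binary (2 ^ suc (nth as j))
  ⟦copyPower⟧ {d} {n} {ρ} i {as} {w} word j lt = trans
    (cong (λ x → true ∷ true ∷ x ++ false ∷ [])
      (⟦times⟧ {d} {n} {ρ} i {as} {w} word j (emit true ⨾ emit false) lt λ _ → refl))
    (sym (binary-2^ (nth as j)))

  module _ {n q : ℕ} (e : Arc n q) (w w₀ : Word) where
    private
      ρ : Vec Word 2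
      ρ = (fieldsWord (0 ∷ fields e) ++ w) ∷ w₀ ∷ []

      copied : ∀ j → j < 5 → ⟦ copyField {0} j zero ⟧ ρ ≡ unary (nth (0 ∷ fields e) j)
      copied j j<5 = ⟦copyField⟧ {ρ = ρ} zero {0 ∷ fields e} refl j (header< e j<5)

      powered : ∀ j → j < 5 → ⟦ copyPower {0} j zero ⟧ ρ ≡ binary (2 ^ suc (nth (0 ∷ fields e) j))
      powered j j<5 = ⟦copyPower⟧ {ρ = ρ} zero {0 ∷ fields e} refl j (header< e j<5)

      isPositive : ∀ b → (0 ℕ.<ᵇ bit b) ≡ b
      isPositive true  = refl
      isPositive false = refl

      entries : ∀ β α → ⟦ first {0} {2} (cellField β α) zero emit ⟧ ρ ≡ allowed e α β ∷ []
      entries β α = ⟦first⟧ {0} {2} {ρ} zero {0 ∷ fields e} {w} refl (cellField β α) emit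
        {λ x → x ≡ allowed e α β ∷ []} (cell< e β α)
        λ _ → cong (_∷ []) (trans (cong (0 ℕ.<ᵇ_) (nth-cell e β α)) (isPositive (allowed e α β)))

      tabulated : ∀ {m} (f : Fin m → Bool) → concatMap (λ α → f α ∷ []) (allFin m) ≡ tabulate f
      tabulated f = trans (sym (concatMap-tabulate (_∷ []) f)) (List.concatMap-pure _)

      relation : ⟦ sequence (allFin q) (λ β → sequence (allFin q) λ α → first {0} {2} (cellField β α) zero emit) ⟧ ρ ≡
                 concatMap Vec.toList (Vec.toList (Edge.rel (toEdge e)))
      relation = trans
        (⟦sequence⟧ (allFin q) _ ρ {λ β → Vec.toList (Vec.tabulate λ α → allowed e α β)} λ β → trans
          (⟦sequence⟧ (allFin q) _ ρ {λ α → allowed e α β ∷ []} (entries β))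
          (trans (tabulated (λ α → allowed e α β)) (sym (toList-tabulate (λ α → allowed e α β)))))
        (trans (sym (concatMap-tabulate Vec.toList (λ β → Vec.tabulate λ α → allowed e α β)))
          (cong (concatMap Vec.toList) (sym (toList-tabulate (λ β → Vec.tabulate λ α → allowed e α β)))))

    ⟦putEdge⟧ : ⟦ putEdge q ⟧ ρ ≡ true ∷ encodeEdge (toEdge e)
    ⟦putEdge⟧ = cong (true ∷_)
      (cong₂ _++_ (copied 1 (s≤s (s≤s z≤n)))
      (cong₂ _++_ (copied 2 (s≤s (s≤s (s≤s z≤n))))
      (cong₂ _++_ (powered 3 (s≤s (s≤s (s≤s (s≤s z≤n)))))
      (cong₂ _++_ (powered 4 (s≤s (s≤s (s≤s (s≤s (s≤s z≤n)))))) relation))))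

  ⟦finish⟧ : ∀ {n q} (es : List (Arc n q)) → ⟦ finish q ⟧ (gameWord es ∷ []) ≡
    unary n ++ unary n ++ unary q ++ encodeEdges (map toEdge es) ++ false ∷ []
  ⟦finish⟧ {n} {q} es =
    cong₂ _++_ header (cong₂ _++_ header (cong₂ _++_ (⟦emits⟧ {2} (unary q) (gameWord es ∷ []))
      (cong (_++ false ∷ []) (trans
        (⟦records⟧ {K = 4 + q * q} {ρ = gameWord es ∷ []} zero {n ∷ []}
          {fs = fields {n} {q}} {xs = es} refl (suc zero) refl length-fields (putEdge q)
          (λ e → true ∷ encodeEdge (toEdge e)) λ e w → ⟦putEdge⟧ e w (gameWord es))
        (sym (List.concatMap-map (λ e → true ∷ encodeEdge e) toEdge es))))))
    where
    header : ⟦ copyField {1} 0 zero ⟧ (gameWord es ∷ []) ≡ unary n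
    header = ⟦copyField⟧ {ρ = gameWord es ∷ []} zero {n ∷ []} {recordsWord fields es} refl 0 (s≤s z≤n)

  -- From the official encoding to dyadic weights

  -- The exponent to which a numerator or denominator is rounded: a scan can write it in unary
  -- without arithmetic, one bit per digit.
  digits : ℕᵇ → ℕ
  digits ℕᵇ.zero  = 0
  digits 2[1+ b ] = suc (digits b)
  digits 1+[2 b ] = suc (digits b)

  entryOf : ∀ {nU nV q} → Edge nU nV q → Fin q × Fin q → Bool
  entryOf e (β , α) = lookup (lookup (Edge.rel e) β) α

  edgeFields : ∀ {nU nV q} → Edge nU nV q → List ℕ
  edgeFields {q = q} e = toℕ (Edge.u e) ∷ toℕ (Edge.v e) ∷
    digits (ℕᵇ.fromℕ (Edge.num e)) ∷ digits (ℕᵇ.fromℕ (Edge.den e)) ∷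
    tabulate {n = q * q} λ k → bit (entryOf e (remQuot {q} q k))

  length-edgeFields : ∀ {nU nV q} (e : Edge nU nV q) → length (edgeFields e) ≡ 4 + q * q
  length-edgeFields e = cong (4 +_) (List.length-tabulate _)

  parsedWord : ∀ {nU nV q} → List (Edge nU nV q) → Word
  parsedWord {nU} {nV} {q} es = fieldsWord (nU ∷ nV ∷ q ∷ []) ++ recordsWord edgeFields es

  pattern copy₀ = inj₁ zero
  pattern copy₁ = inj₁ (suc zero)
  pattern copy₂ = inj₁ (suc (suc zero))
  pattern copy₃ = inj₁ (suc (suc (suc zero)))
  pattern copy₄ = inj₁ (suc (suc (suc (suc zero))))
  pattern num₀  = inj₁ (suc (suc (suc (suc (suc zero)))))
  pattern num₁  = inj₁ (suc (suc (suc (suc (suc (suc zero))))))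
  pattern den₀  = inj₁ (suc (suc (suc (suc (suc (suc (suc zero)))))))
  pattern den₁  = inj₁ (suc (suc (suc (suc (suc (suc (suc (suc zero))))))))
  pattern flag  = inj₂ zero
  pattern rest k = inj₂ (suc k)

  -- The states 0 to 4 copy a unary field, namely the three of the header and
  -- the two vertices; 5, 6 and 7, 8 read a digit of num and of den after
  -- announcing it in the first of the two; the others count the bits of the
  -- relation that are left, and read the flag before an edge if there are none.
  module Parser (Q : ℕ) where

    Parsing : Set
    Parsing = Fin 9 ⊎ Fin (suc Q)

    parseNext : Parsing → Bool → Parsing
    parseNext copy₀    b = if b then copy₀ else copy₁
    parseNext copy₁    b = if b then copy₁ else copy₂
    parseNext copy₂    b = if b then copy₂ else flag
    parseNext copy₃    b = if b then copy₃ else copy₄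
    parseNext copy₄    b = if b then copy₄ else num₀
    parseNext num₀     b = if b then num₁ else den₀
    parseNext num₁     b = num₀
    parseNext den₀     b = if b then den₁ else inj₂ (fromℕ _)
    parseNext den₁     b = den₀
    parseNext flag     b = if b then copy₃ else flag
    parseNext (rest k) b = inj₂ (inject₁ k)

    parseOut : Parsing → Bool → Word
    -- The digit itself is dropped: only the number of digits matters.
    parseOut num₁     b = []
    parseOut den₁     b = []
    parseOut flag     b = if b then unary 1 else []
    parseOut (rest k) b = unary (bit b)
    parseOut (inj₁ _) b = b ∷ []

    parsing : Parsing → Word → Word
    parsing s []      = []
    parsing s (b ∷ w) = parseOut s b ++ parsing (parseNext s b) w

    parse : Cmd 1 1
    parse = scan zero {9 + suc Q} zero
      (λ s b → join 9 _ (parseNext (splitAt 9 s) b))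
      (λ s b → emits (parseOut (splitAt 9 s) b))

    ⟦parse⟧ : ∀ w → ⟦ parse ⟧ (w ∷ []) ≡ parsing copy₀ w
    ⟦parse⟧ w = go copy₀ w
      where
      go : ∀ (s : Parsing) v →
        scanning (λ s b → join 9 _ (parseNext (splitAt 9 s) b))
                 (λ s b → ⟦ emits {0} {2} (parseOut (splitAt 9 s) b) ⟧) (join 9 _ s) (w ∷ []) v ≡
        parsing s v
      go s []      = refl
      go s (b ∷ v) rewrite Fin.splitAt-join 9 (suc Q) s =
        cong₂ _++_ (⟦emits⟧ {0} (parseOut s b) (v ∷ w ∷ [])) (go (parseNext s b) v)

    parsing-unary : ∀ (s s′ : Parsing) → (∀ b → parseOut s b ≡ b ∷ []) →
      parseNext s true ≡ s → parseNext s false ≡ s′ →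
      ∀ n w → parsing s (unary n ++ w) ≡ unary n ++ parsing s′ w
    parsing-unary s s′ out t f zero    w rewrite out false | f = refl
    parsing-unary s s′ out t f (suc n) w rewrite out true | t =
      cong (true ∷_) (parsing-unary s s′ out t f n w)

    parsing-digits : ∀ (s₀ s₁ s′ : Parsing) → (∀ b → parseOut s₀ b ≡ b ∷ []) →
      (∀ b → parseOut s₁ b ≡ []) → parseNext s₀ true ≡ s₁ → parseNext s₀ false ≡ s′ →
      (∀ b → parseNext s₁ b ≡ s₀) →
      ∀ n w → parsing s₀ (encodeℕᵇ n ++ w) ≡ unary (digits n) ++ parsing s′ w
    parsing-digits s₀ s₁ s′ out₀ out₁ t f back ℕᵇ.zero  w rewrite out₀ false | f = refl
    parsing-digits s₀ s₁ s′ out₀ out₁ t f back 2[1+ n ] w rewrite out₀ true | t | out₁ true | back true =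
      cong (true ∷_) (parsing-digits s₀ s₁ s′ out₀ out₁ t f back n w)
    parsing-digits s₀ s₁ s′ out₀ out₁ t f back 1+[2 n ] w rewrite out₀ true | t | out₁ false | back false =
      cong (true ∷_) (parsing-digits s₀ s₁ s′ out₀ out₁ t f back n w)

    parsing-bits : ∀ bs (k : Fin (suc Q)) → toℕ k ≡ length bs → ∀ w →
      parsing (inj₂ k) (bs ++ w) ≡ concatMap (unary ∘ bit) bs ++ parsing flag w
    parsing-bits []       zero    eq w = refl
    parsing-bits (b ∷ bs) (suc k) eq w = trans
      (cong (unary (bit b) ++_)
        (parsing-bits bs (inject₁ k) (trans (Fin.toℕ-inject₁ k) (ℕ.suc-injective eq)) w))
      (sym (List.++-assoc (unary (bit b)) (concatMap (unary ∘ bit) bs) _))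

  toList-concat : ∀ {A : Set} {m n} (xss : Vec (Vec A m) n) →
                  concatMap Vec.toList (Vec.toList xss) ≡ Vec.toList (Vec.concat xss)
  toList-concat []         = refl
  toList-concat (xs ∷ xss) = trans (cong (Vec.toList xs ++_) (toList-concat xss))
    (sym (Vec.toList-++ xs (Vec.concat xss)))

  relBits : ∀ {nU nV q} (e : Edge nU nV q) → concatMap Vec.toList (Vec.toList (Edge.rel e)) ≡
            tabulate {n = q * q} λ k → entryOf e (remQuot {q} q k)
  relBits {q = q} e = begin
    concatMap Vec.toList (Vec.toList rel)
      ≡⟨ toList-concat rel ⟩
    Vec.toList (Vec.concat rel)
      ≡⟨ cong Vec.toList (Vec.tabulate∘lookup (Vec.concat rel)) ⟨
    Vec.toList (Vec.tabulate (lookup (Vec.concat rel)))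
      ≡⟨ toList-tabulate (lookup (Vec.concat rel)) ⟩
    tabulate (lookup (Vec.concat rel))
      ≡⟨ List.tabulate-cong (λ k → trans (cong (lookup (Vec.concat rel)) (sym (Fin.combine-remQuot {q} q k)))
           (Vec.lookup-concat rel _ _)) ⟩
    tabulate (λ k → entryOf e (remQuot {q} q k)) ∎
    where
    open ≡-Reasoning
    rel = Edge.rel e

  length-relBits : ∀ {nU nV q} (e : Edge nU nV q) →
                   length (concatMap Vec.toList (Vec.toList (Edge.rel e))) ≡ q * q
  length-relBits e = trans (cong length (relBits e)) (List.length-tabulate _)

  module _ {nU nV q : ℕ} where
    open Parser (q * q)

    parsing-edge : ∀ (e : Edge nU nV q) w →
      parsing copy₃ (encodeEdge e ++ w) ≡ fieldsWord (edgeFields e) ++ parsing flag w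
    parsing-edge e w = begin
      parsing copy₃ (encodeEdge e ++ w)
        ≡⟨ cong (parsing copy₃) (reassoc a b c d bs w) ⟩
      parsing copy₃ (a ++ (b ++ (c ++ (d ++ (bs ++ w)))))
        ≡⟨ parsing-unary copy₃ copy₄ (λ _ → refl) refl refl (toℕ (Edge.u e)) _ ⟩
      a ++ parsing copy₄ (b ++ (c ++ (d ++ (bs ++ w))))
        ≡⟨ cong (a ++_) (parsing-unary copy₄ num₀ (λ _ → refl) refl refl (toℕ (Edge.v e)) _) ⟩
      a ++ (b ++ parsing num₀ (c ++ (d ++ (bs ++ w))))
        ≡⟨ cong (λ x → a ++ (b ++ x)) (parsing-digits num₀ num₁ den₀
             (λ _ → refl) (λ _ → refl) refl refl (λ _ → refl) (ℕᵇ.fromℕ (Edge.num e)) _) ⟩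
      a ++ (b ++ (c′ ++ parsing den₀ (d ++ (bs ++ w))))
        ≡⟨ cong (λ x → a ++ (b ++ (c′ ++ x))) (parsing-digits den₀ den₁ (inj₂ (fromℕ (q * q)))
             (λ _ → refl) (λ _ → refl) refl refl (λ _ → refl) (ℕᵇ.fromℕ (Edge.den e)) _) ⟩
      a ++ (b ++ (c′ ++ (d′ ++ parsing (inj₂ (fromℕ (q * q))) (bs ++ w))))
        ≡⟨ cong (λ x → a ++ (b ++ (c′ ++ (d′ ++ x)))) (trans
             (parsing-bits bs (fromℕ (q * q)) (trans (Fin.toℕ-fromℕ (q * q)) (sym (length-relBits e))) w)
             (cong (_++ parsing flag w) bits≡)) ⟩
      a ++ (b ++ (c′ ++ (d′ ++ (bs′ ++ parsing flag w))))
        ≡⟨ reassoc a b c′ d′ bs′ (parsing flag w) ⟨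
      fieldsWord (edgeFields e) ++ parsing flag w ∎
      where
      open ≡-Reasoning
      a b c d bs c′ d′ bs′ : Word
      a   = unary (toℕ (Edge.u e))
      b   = unary (toℕ (Edge.v e))
      c   = binary (Edge.num e)
      d   = binary (Edge.den e)
      bs  = concatMap Vec.toList (Vec.toList (Edge.rel e))
      c′  = unary (digits (ℕᵇ.fromℕ (Edge.num e)))
      d′  = unary (digits (ℕᵇ.fromℕ (Edge.den e)))
      bs′ = fieldsWord (tabulate λ k → bit (entryOf e (remQuot {q} q k)))
      reassoc : ∀ (a b c d bs w : Word) →
        (a ++ (b ++ (c ++ (d ++ bs)))) ++ w ≡ a ++ (b ++ (c ++ (d ++ (bs ++ w))))
      reassoc a b c d bs w = trans (List.++-assoc a _ w) (cong (a ++_) (trans (List.++-assoc b _ w)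
        (cong (b ++_) (trans (List.++-assoc c _ w) (cong (c ++_) (List.++-assoc d bs w))))))
      bits≡ : concatMap (unary ∘ bit) bs ≡ bs′
      bits≡ = trans (cong (concatMap (unary ∘ bit)) (relBits e))
        (trans (concatMap-tabulate (unary ∘ bit) (λ k → entryOf e (remQuot {q} q k)))
          (sym (concatMap-tabulate unary (λ k → bit (entryOf e (remQuot {q} q k))))))

    parsing-edges : ∀ (es : List (Edge nU nV q)) →
      parsing flag (encodeEdges es ++ false ∷ []) ≡ recordsWord edgeFields es
    parsing-edges []       = refl
    parsing-edges (e ∷ es) = cong (λ w → true ∷ false ∷ w) (begin
      parsing copy₃ ((encodeEdge e ++ encodeEdges es) ++ false ∷ [])
        ≡⟨ cong (parsing copy₃) (List.++-assoc (encodeEdge e) (encodeEdges es) _) ⟩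
      parsing copy₃ (encodeEdge e ++ (encodeEdges es ++ false ∷ []))
        ≡⟨ parsing-edge e _ ⟩
      fieldsWord (edgeFields e) ++ parsing flag (encodeEdges es ++ false ∷ [])
        ≡⟨ cong (fieldsWord (edgeFields e) ++_) (parsing-edges es) ⟩
      fieldsWord (edgeFields e) ++ recordsWord edgeFields es ∎)
      where open ≡-Reasoning

  ⟦parse⟧-encode : ∀ G → ⟦ Parser.parse (Game.q G ℕ.* Game.q G) ⟧ (encode G ∷ []) ≡ parsedWord (Game.edges G)
  ⟦parse⟧-encode G = begin
    ⟦ parse ⟧ (encode G ∷ [])
      ≡⟨ ⟦parse⟧ (encode G) ⟩
    parsing copy₀ (encode G)
      ≡⟨ parsing-unary copy₀ copy₁ (λ _ → refl) refl refl nU _ ⟩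
    unary nU ++ parsing copy₁ (unary nV ++ unary q ++ tail)
      ≡⟨ cong (unary nU ++_) (parsing-unary copy₁ copy₂ (λ _ → refl) refl refl nV _) ⟩
    unary nU ++ (unary nV ++ parsing copy₂ (unary q ++ tail))
      ≡⟨ cong (λ w → unary nU ++ (unary nV ++ w)) (parsing-unary copy₂ flag (λ _ → refl) refl refl q _) ⟩
    unary nU ++ (unary nV ++ (unary q ++ parsing flag tail))
      ≡⟨ cong (λ w → unary nU ++ (unary nV ++ (unary q ++ w))) (parsing-edges edges) ⟩
    unary nU ++ (unary nV ++ (unary q ++ recordsWord edgeFields edges))
      ≡⟨ cong (λ w → unary nU ++ (unary nV ++ w)) (List.++-assoc (unary q) [] _) ⟨
    unary nU ++ (unary nV ++ ((unary q ++ []) ++ recordsWord edgeFields edges))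
      ≡⟨ trans (List.++-assoc (unary nU) _ _) (cong (unary nU ++_) (List.++-assoc (unary nV) _ _)) ⟨
    parsedWord edges ∎
    where
    open ≡-Reasoning
    open Game G
    open Parser (q * q)
    tail : Word
    tail = encodeEdges edges ++ false ∷ []

  -- Adding the star

  module _ {nU nV q : ℕ} where

    -- Both sides keep their vertex numbers, so that unary fields can be copied, and the number nU
    -- becomes available for the hub. The common size uses a sum where a maximum would do, as a sum
    -- is formed by concatenation.
    arc : Edge nU nV q → Arc (suc (nU + nV)) q
    arc e = record
      { u          = inject≤ (Edge.u e) (ℕ.≤-trans (ℕ.m≤m+n nU nV) (ℕ.n≤1+n _))
      ; v          = inject≤ (Edge.v e) (ℕ.≤-trans (ℕ.m≤n+m nV nU) (ℕ.n≤1+n _))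
      ; up         = digits (ℕᵇ.fromℕ (Edge.num e))
      ; down       = digits (ℕᵇ.fromℕ (Edge.den e))
      ; allowed    = λ α β → entryOf e (β , α)
      ; functional = λ β {α} {α′} ok ok′ → Edge.functional e β
          (Vec.lookup⇒[]= α _ ok) (Vec.lookup⇒[]= α′ _ ok′)
      }

    -- A numerator 0 would be rounded to 2 ^ 0 = 1, so the edges of weight 0 have to be dropped.
    positive? : Edge nU nV q → Bool
    positive? e = 0 ℕ.<ᵇ digits (ℕᵇ.fromℕ (Edge.num e))

    arcIfPositive : Edge nU nV q → List (Arc (suc (nU + nV)) q)
    arcIfPositive e = if positive? e then arc e ∷ [] else []

    arcs : List (Edge nU nV q) → List (Arc (suc (nU + nV)) q)
    arcs = concatMap arcIfPositive

  hub : ∀ nU nV → Fin (suc (nU + nV))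
  hub nU nV = fromℕ< (s≤s (ℕ.m≤m+n nU nV))

  withStar : ∀ {q} → Fin q → Cmd 1 3
  withStar {q} α₀ =
    emit true ⨾ emit false ⨾ copyField 1 e ⨾ copyField 2 e ⨾ copyField 3 e ⨾ copyField 4 e ⨾
    sequence (allFin (q * q)) (λ k → copyField (5 + toℕ k) e) ⨾
    -- The number of the hub is nU, which is field 0 of the header.
    emit true ⨾ emit false ⨾ copyField 0 i ⨾ copyField 2 e ⨾ copyField 3 e ⨾ copyField 4 e ⨾
    sequence (allFin (q * q)) λ k → emits (unary (bit (does (α₀ Fin.≟ proj₂ (remQuot {q} q k)))))
    where
    e i : Fin 3
    e = suc zero
    i = suc (suc zero)

  addStar : ∀ {q} → Fin q → Cmd 3 1
  addStar {q} α₀ = emit true ⨾ times 0 zero (emit true) ⨾ times 1 zero (emit true) ⨾ emit false ⨾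
    -- Field 3 counts the digits of the numerator; its first bit is `false` exactly for weight 0.
    records (4 + q * q) (suc (suc (suc zero))) zero (first 3 zero (whenTrue (withStar α₀)))

  concatMap-concatMap : ∀ {A B : Set} (g : B → Word) (h : A → List B) xs →
    concatMap g (concatMap h xs) ≡ concatMap (concatMap g ∘ h) xs
  concatMap-concatMap g h []       = refl
  concatMap-concatMap g h (x ∷ xs) =
    trans (List.concatMap-++ g (h x) (concatMap h xs)) (cong (concatMap g (h x) ++_) (concatMap-concatMap g h xs))

  module _ {nU nV q : ℕ} (α₀ : Fin q) (e : Edge nU nV q) (w w₀ : Word) where
    private
      as : List ℕ
      as = 0 ∷ edgeFields e

      ρ : Vec Word 2
      ρ = (fieldsWord as ++ w) ∷ (fieldsWord (nU ∷ nV ∷ q ∷ []) ++ w₀) ∷ []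

      header : ∀ {j} → j < 5 → j < length as
      header j<5 = ℕ.<-≤-trans j<5 (s≤s (s≤s (s≤s (s≤s (s≤s z≤n)))))

      copied : ∀ x j → j < 5 → ⟦ copyField {0} j (suc zero) ⟧ (x ∷ ρ) ≡ unary (nth as j)
      copied x j j<5 = ⟦copyField⟧ {ρ = x ∷ ρ} (suc zero) {as} refl j (header j<5)

      g : Arc (suc (nU + nV)) q → Word
      g a = fieldsWord (1 ∷ fields a)

      s : Arc (suc (nU + nV)) q
      s = star (hub nU nV) α₀ (arc e)

    ⟦withStar⟧ : ∀ x → ⟦ withStar α₀ ⟧ (x ∷ ρ) ≡ g (arc e) ++ (g s ++ [])
    ⟦withStar⟧ x = trans
      (cong (λ y → true ∷ false ∷ y)
        (cong₂ _++_ (trans (copied x 1 (s≤s (s≤s z≤n))) u≡)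
        (cong₂ _++_ (trans (copied x 2 (s≤s (s≤s (s≤s z≤n)))) v≡)
        (cong₂ _++_ (copied x 3 (s≤s (s≤s (s≤s (s≤s z≤n)))))
        (cong₂ _++_ (copied x 4 (s≤s (s≤s (s≤s (s≤s (s≤s z≤n))))))
        (cong₂ _++_ cells
          (cong (λ y → true ∷ false ∷ y)
            (cong₂ _++_ (trans (⟦copyField⟧ {ρ = x ∷ ρ} (suc (suc zero)) {nU ∷ nV ∷ q ∷ []} {w₀} refl 0 (s≤s z≤n)) hub≡)
            (cong₂ _++_ (trans (copied x 2 (s≤s (s≤s (s≤s z≤n)))) v≡)
            (cong₂ _++_ (copied x 3 (s≤s (s≤s (s≤s (s≤s z≤n)))))
            (cong₂ _++_ (copied x 4 (s≤s (s≤s (s≤s (s≤s (s≤s z≤n)))))) star-cells)))))))))))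
      (trans (sym (reassoc (unary (toℕ (u (arc e)))) (unary (toℕ (v (arc e)))) (unary (up (arc e)))
                (unary (down (arc e)))
                (fieldsWord (tabulate λ k → bit (cell (arc e) (remQuot {q} q k)))) (g s)))
        (cong (g (arc e) ++_) (sym (List.++-identityʳ (g s)))))
      where
      reassoc : ∀ (a b c d bs w : Word) →
        true ∷ false ∷ (a ++ (b ++ (c ++ (d ++ bs)))) ++ w ≡ true ∷ false ∷ a ++ (b ++ (c ++ (d ++ (bs ++ w))))
      reassoc a b c d bs w = cong {B = Word} (λ y → true ∷ false ∷ y)
        (trans (List.++-assoc a _ w) (cong (a ++_) (trans (List.++-assoc b _ w)
          (cong (b ++_) (trans (List.++-assoc c _ w) (cong (c ++_) (List.++-assoc d bs w)))))))
      u≡ : unary (toℕ (Edge.u e)) ≡ unary (toℕ (u (arc e)))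
      u≡ = cong unary (sym (Fin.toℕ-inject≤ (Edge.u e) _))
      v≡ : unary (toℕ (Edge.v e)) ≡ unary (toℕ (v (arc e)))
      v≡ = cong unary (sym (Fin.toℕ-inject≤ (Edge.v e) _))
      hub≡ : unary nU ≡ unary (toℕ (hub nU nV))
      hub≡ = cong unary (sym (Fin.toℕ-fromℕ< (s≤s (ℕ.m≤m+n nU nV))))
      cells : ⟦ sequence (allFin (q * q)) (λ k → copyField {0} (5 + toℕ k) (suc zero)) ⟧ (x ∷ ρ) ≡
              fieldsWord (tabulate λ k → bit (cell (arc e) (remQuot {q} q k)))
      cells = trans
        (⟦sequence⟧ (allFin (q * q)) _ (x ∷ ρ) {λ k → unary (bit (cell (arc e) (remQuot {q} q k)))} λ k → trans
          (⟦copyField⟧ {ρ = x ∷ ρ} (suc zero) {as} refl (5 + toℕ k)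
            (subst (λ l → 5 + toℕ k < suc l) (sym (length-edgeFields e)) (ℕ.+-monoʳ-< 5 (Fin.toℕ<n k))))
          (cong unary (nth-tabulate (λ k → bit (entryOf e (remQuot {q} q k))) k)))
        (sym (concatMap-tabulate unary (λ k → bit (cell (arc e) (remQuot {q} q k)))))
      star-cells : ⟦ sequence {1} (allFin (q * q)) (λ k →
                     emits (unary (bit (does (α₀ Fin.≟ proj₂ (remQuot {q} q k)))))) ⟧ (x ∷ ρ) ≡
                   fieldsWord (tabulate λ k → bit (cell s (remQuot {q} q k)))
      star-cells = trans
        (⟦sequence⟧ {1} (allFin (q * q)) _ (x ∷ ρ) {λ k → unary (bit (cell s (remQuot {q} q k)))}
          λ k → ⟦emits⟧ {1} (unary (bit (cell s (remQuot {q} q k)))) (x ∷ ρ))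
        (sym (concatMap-tabulate unary (λ k → bit (cell s (remQuot {q} q k)))))

    ⟦ifPositive⟧ : ⟦ first {1} {2} 3 zero (whenTrue (withStar α₀)) ⟧ ρ ≡
                   concatMap g (starred (hub nU nV) α₀ (arcIfPositive e))
    ⟦ifPositive⟧ = ⟦first⟧ {1} {2} {ρ} zero {as} {w} refl 3 (whenTrue (withStar α₀))
      {λ y → y ≡ concatMap g (starred (hub nU nV) α₀ (arcIfPositive e))}
      (header (s≤s (s≤s (s≤s (s≤s z≤n))))) chosen
      where
      chosen : ∀ x → ⟦ whenTrue (withStar α₀) (positive? e) ⟧ (x ∷ ρ) ≡
               concatMap g (starred (hub nU nV) α₀ (arcIfPositive e))
      chosen x with positive? e
      ... | true  = ⟦withStar⟧ x
      ... | false = refl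

  starred-concatMap : ∀ {A : Set} {n q} (s : Fin n) (α₀ : Fin q) (h : A → List (Arc n q)) xs →
    starred s α₀ (concatMap h xs) ≡ concatMap (starred s α₀ ∘ h) xs
  starred-concatMap s α₀ h []       = refl
  starred-concatMap s α₀ h (x ∷ xs) = trans
    (List.concatMap-++ _ (h x) (concatMap h xs)) (cong (starred s α₀ (h x) ++_) (starred-concatMap s α₀ h xs))

  ⟦addStar⟧ : ∀ {nU nV q} (α₀ : Fin q) (es : List (Edge nU nV q)) →
    ⟦ addStar α₀ ⟧ (parsedWord es ∷ []) ≡ gameWord (starred (hub nU nV) α₀ (arcs es))
  ⟦addStar⟧ {nU} {nV} {q} α₀ es = trans
    (cong (true ∷_) (cong₂ _++_
      (copies {2} {ρ = parsedWord es ∷ []} zero {nU ∷ nV ∷ q ∷ []} {recordsWord edgeFields es} refl 0 (s≤s z≤n))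
      (cong₂ (λ x y → x ++ (false ∷ y))
        (copies {2} {ρ = parsedWord es ∷ []} zero {nU ∷ nV ∷ q ∷ []} {recordsWord edgeFields es} refl 1 (s≤s (s≤s z≤n)))
        (⟦records⟧ {K = 4 + q * q} {ρ = parsedWord es ∷ []} zero {nU ∷ nV ∷ q ∷ []}
          {fs = edgeFields {nU} {nV} {q}} {xs = es} refl (suc (suc (suc zero))) refl length-edgeFields
          (first 3 zero (whenTrue (withStar α₀))) o λ e w → ⟦ifPositive⟧ α₀ e w (recordsWord edgeFields es)))))
    (trans (cong (true ∷_) (trans (sym (List.++-assoc (ones nU) (ones nV) (false ∷ concatMap o es)))
             (cong (_++ false ∷ concatMap o es) (ones-++ nU nV))))
      (trans (sym (List.++-assoc (ones (suc (nU + nV))) (false ∷ []) (concatMap o es)))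
        (cong₂ _++_ (sym (List.++-identityʳ (unary (suc (nU + nV))))) (sym (trans
          (cong (recordsWord fields) (starred-concatMap (hub nU nV) α₀ arcIfPositive es))
          (concatMap-concatMap g (starred (hub nU nV) α₀ ∘ arcIfPositive) es))))))
    where
    g : Arc (suc (nU + nV)) q → Word
    g a = fieldsWord (1 ∷ fields a)
    o : Edge nU nV q → Word
    o e = concatMap g (starred (hub nU nV) α₀ (arcIfPositive e))

-- Values, rounded weights and the reduction

open Machines using (⟦_⟧; polyTime-⟦⟧)
open Amplification
open Formats
open Arc

open import Data.Bool.Base using (Bool; true; false; if_then_else_)
open import Data.Empty using (⊥-elim)
open import Data.Fin.Base using (Fin; zero; suc; toℕ; fromℕ<; inject≤; finToFun; funToFin)
import Data.Fin.Properties as Fin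
import Data.Integer.Base as ℤ
import Data.Integer.Properties as ℤ
open import Data.List.Base as List using (List; []; _∷_; allFin; map; cartesianProductWith)
import Data.List.Extrema
open import Data.List.Membership.Propositional using (_∈_)
open import Data.List.Membership.Propositional.Properties
  using (∈-++⁻; ∈-allFin; ∈-cartesianProductWith⁺; ∈-cartesianProductWith⁻)
open import Data.List.Relation.Unary.All as All using ()
open import Data.List.Relation.Unary.Any using (here; there)
open import Data.Nat.Base as ℕ using (ℕ; zero; suc; _^_; z≤n; s≤s)
import Data.Nat.Properties as ℕ
open import Data.Nat.Binary.Base as ℕᵇ using (ℕᵇ; 2[1+_]; 1+[2_])
import Data.Nat.Binary.Properties as ℕᵇ
open import Data.Product.Base using (∃-syntax; _×_; _,_; proj₁; proj₂)
open import Data.Rational.Base using (ℚ; 0ℚ; _<_)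
open import Data.Rational.Base as ℚ using (1ℚ; ½; _+_; _*_; -_; _-_; _≤_; 1/_)
import Data.Rational.Properties as ℚ
open import Data.Rational.Solver using (module +-*-Solver)
import Data.Rational.Unnormalised.Base as ℚᵘ
import Data.Rational.Unnormalised.Properties as ℚᵘ
open import Data.Sum.Base using (_⊎_; inj₁; inj₂)
open import Data.Vec.Base as Vec using (lookup; []; _∷_)
import Data.Vec.Properties as Vec
open import Function.Base using (_∘_; id)
open import Relation.Binary.Bundles using (DecTotalOrder)
open import Relation.Binary.PropositionalEquality
open import Relation.Nullary using (yes; no)
open +-*-Solver using (solve; _:+_; _:*_; _:-_; _:=_; con; :-_)

module Extrema = Data.List.Extrema (DecTotalOrder.totalOrder ℚ.≤-decTotalOrder)

-- The value of a game

module _ {nU nV q : ℕ} where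

  entryAt : (Fin nU → Fin q) → (Fin nV → Fin q) → Edge nU nV q → Bool
  entryAt f g e = entryOf e (g (Edge.v e) , f (Edge.u e))

  satWeight : (Fin nU → Fin q) → (Fin nV → Fin q) → List (Edge nU nV q) → ℚ
  satWeight f g es = ∑ es λ e → Edge.weight e * indicator (entryAt f g e)

  totalWeight≡ : ∀ (es : List (Edge nU nV q)) → totalWeight es ≡ ∑ es Edge.weight
  totalWeight≡ []       = refl
  totalWeight≡ (e ∷ es) = cong (Edge.weight e +_) (totalWeight≡ es)

  0≤weight : ∀ (e : Edge nU nV q) → 0ℚ ≤ Edge.weight e
  0≤weight record { num = num ; den = den ; den≢0 = den≢0 } =
    ℚ.nonNegative⁻¹ _ {{ℚ.normalize-nonNeg num den {{den≢0}}}}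

  satWeight-cong : ∀ {f f′ g g′} → (∀ i → f i ≡ f′ i) → (∀ j → g j ≡ g′ j) → ∀ es →
                   satWeight f g es ≡ satWeight f′ g′ es
  satWeight-cong f≡ g≡ es = ∑-cong es λ e → cong₂ (λ α β → Edge.weight e * indicator (entryOf e (β , α)))
    (f≡ (Edge.u e)) (g≡ (Edge.v e))

  satWeight≤ : ∀ f g es → satWeight f g es ≤ ∑ es Edge.weight
  satWeight≤ f g es = ∑-mono es λ e → ℚ.≤-trans (*-mono-≤ˡ (0≤weight e) (indicator≤1 (entryAt f g e)))
    (ℚ.≤-reflexive (ℚ.*-identityʳ (Edge.weight e)))
    where
    indicator≤1 : ∀ b → indicator b ≤ 1ℚ
    indicator≤1 true  = ℚ.≤-refl
    indicator≤1 false = 0≤1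

module _ (G : Game) where
  open Game G

  total⁺ : 0ℚ < totalWeight edges
  total⁺ = positive G
    where
    positive : ∀ G → 0ℚ < totalWeight (Game.edges G)
    positive record { edges = es ; total = t } = ℚ.positive⁻¹ (totalWeight es) {{t}}

  filtered≡ : ∀ f g es → totalWeight (List.filter (satisfied? f g) es) ≡ satWeight f g es
  filtered≡ f g [] = refl
  filtered≡ f g (e ∷ es) with satisfied? f g e | entryAt f g e in eq
  ... | yes _ | true  = cong₂ _+_ (sym (ℚ.*-identityʳ (Edge.weight e))) (filtered≡ f g es)
  ... | yes α∈ | false with () ← trans (sym (Vec.[]=⇒lookup α∈)) eq
  ... | no α∉ | true  = ⊥-elim (α∉ (Vec.lookup⇒[]= _ _ eq))
  ... | no _  | false = trans (filtered≡ f g es)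
    (sym (trans (cong (_+ satWeight f g es) (ℚ.*-zeroʳ (Edge.weight e))) (ℚ.+-identityˡ _)))

  Pr*total : ∀ f g → Pr[satisfied] f g * totalWeight edges ≡ satWeight f g edges
  Pr*total f g = trans (cancel G f g) (filtered≡ f g edges)
    where
    cancel : ∀ G f g → Game.Pr[satisfied] G f g * totalWeight (Game.edges G) ≡
                       totalWeight (List.filter (Game.satisfied? G f g) (Game.edges G))
    cancel G@record { edges = es ; total = t } f g = trans
      (ℚ.*-assoc (totalWeight (List.filter (Game.satisfied? G f g) es)) _ (totalWeight es))
      (trans (cong (totalWeight (List.filter (Game.satisfied? G f g) es) *_)
        (ℚ.*-inverseˡ (totalWeight es) {{ℚ.pos⇒nonZero (totalWeight es) {{t}}}}))
      (ℚ.*-identityʳ _))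

  Pr≤ : ∀ {c} f g → satWeight f g edges ≤ c * totalWeight edges → Pr[satisfied] f g ≤ c
  Pr≤ f g le = ℚ.*-cancelʳ-≤-pos (totalWeight edges) {{ℚ.positive total⁺}}
    (ℚ.≤-trans (ℚ.≤-reflexive (Pr*total f g)) le)

  private
    values : List ℚ
    values = cartesianProductWith (λ i j → Pr[satisfied] (finToFun i) (finToFun j))
      (allFin (q ^ nU)) (allFin (q ^ nV))

  attained : ∀ {p} → p ∈ values → ∃[ f ] ∃[ g ] p ≡ Pr[satisfied] f g
  attained p∈ =
    let i , j , _ , _ , eq = ∈-cartesianProductWith⁻ (λ i j → Pr[satisfied] (finToFun i) (finToFun j))
                               (allFin (q ^ nU)) (allFin (q ^ nV)) p∈
    in finToFun i , finToFun j , eq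

  val≤ : ∀ {c} → 0ℚ ≤ c → (∀ f g → satWeight f g edges ≤ c * totalWeight edges) → val ≤ c
  val≤ {c} 0≤c le = Extrema.max≤v⁺ {⊥ = 0ℚ} {xs = values} 0≤c (All.tabulate λ p∈ →
    let f , g , p≡ = attained p∈ in ℚ.≤-trans (ℚ.≤-reflexive p≡) (Pr≤ f g (le f g)))

  satWeight≤val : ∀ f g → satWeight f g edges ≤ val * totalWeight edges
  satWeight≤val f g = begin
    satWeight f g edges
      ≡⟨ satWeight-cong (λ i → sym (Fin.finToFun-funToFin f i)) (λ j → sym (Fin.finToFun-funToFin g j)) edges ⟩
    satWeight (finToFun (funToFin f)) (finToFun (funToFin g)) edges
      ≡⟨ Pr*total _ _ ⟨
    Pr[satisfied] (finToFun (funToFin f)) (finToFun (funToFin g)) * totalWeight edges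
      ≤⟨ *-mono-≤ʳ (ℚ.<⇒≤ total⁺) (All.lookup (Extrema.xs≤max 0ℚ values)
           (∈-cartesianProductWith⁺ (λ i j → Pr[satisfied] (finToFun i) (finToFun j))
             (∈-allFin (funToFin f)) (∈-allFin (funToFin g)))) ⟩
    val * totalWeight edges ∎
    where open ℚ.≤-Reasoning

  -- A maximum over a list is one of the entries or the default value, and the default 0 is not 1.
  val≡1⇒ : val ≡ 1ℚ → ∃[ f ] ∃[ g ] satWeight f g edges ≡ totalWeight edges
  val≡1⇒ val≡1 = go (Extrema.argmax-sel id 0ℚ values)
    where
    go : val ≡ 0ℚ ⊎ val ∈ values → ∃[ f ] ∃[ g ] satWeight f g edges ≡ totalWeight edges
    go (inj₁ val≡0) = ⊥-elim (ℚ.1≢0 (trans (sym val≡1) val≡0))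
    go (inj₂ val∈)  =
      let f , g , val≡ = attained val∈
      in f , g , trans (sym (Pr*total f g))
           (trans (cong (_* totalWeight edges) (trans (sym val≡) val≡1)) (ℚ.*-identityˡ (totalWeight edges)))

  val≡1⇐ : ∀ f g → satWeight f g edges ≡ totalWeight edges → val ≡ 1ℚ
  val≡1⇐ f g eq = ℚ.≤-antisym
    (val≤ 0≤1 λ f g → ℚ.≤-trans (satWeight≤ f g edges)
      (ℚ.≤-reflexive (trans (sym (totalWeight≡ edges)) (sym (ℚ.*-identityˡ _)))))
    (ℚ.*-cancelʳ-≤-pos (totalWeight edges) {{ℚ.positive total⁺}} (ℚ.≤-trans
      (ℚ.≤-reflexive (trans (ℚ.*-identityˡ _) (sym eq))) (satWeight≤val f g)))

-- Fractions

ι : ℕ → ℚ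
ι k = (ℤ.+ k) ℚ./ 1

fraction : ∀ m d .{{_ : ℕ.NonZero d}} → (ℤ.+ m) ℚ./ d * ι d ≡ ι m
fraction m (suc d) = ℚ.toℚᵘ-injective (begin
  ℚ.toℚᵘ ((ℤ.+ m) ℚ./ suc d * ι (suc d))
    ≈⟨ ℚ.toℚᵘ-homo-* ((ℤ.+ m) ℚ./ suc d) (ι (suc d)) ⟩
  ℚ.toℚᵘ ((ℤ.+ m) ℚ./ suc d) ℚᵘ.* ℚ.toℚᵘ (ι (suc d))
    ≈⟨ ℚᵘ.*-cong (ℚ.toℚᵘ-fromℚᵘ (ℚᵘ.mkℚᵘ (ℤ.+ m) d)) (ℚ.toℚᵘ-fromℚᵘ (ℚᵘ.mkℚᵘ (ℤ.+ suc d) 0)) ⟩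
  ℚᵘ.mkℚᵘ (ℤ.+ m) d ℚᵘ.* ℚᵘ.mkℚᵘ (ℤ.+ suc d) 0
    ≈⟨ ℚᵘ.*≡* (trans (ℤ.*-identityʳ _) (cong (ℤ._*_ (ℤ.+ m)) (cong (λ x → ℤ.+ suc x) (sym (ℕ.*-identityʳ d))))) ⟩
  ℚᵘ.mkℚᵘ (ℤ.+ m) 0
    ≈⟨ ℚ.toℚᵘ-fromℚᵘ (ℚᵘ.mkℚᵘ (ℤ.+ m) 0) ⟨
  ℚ.toℚᵘ (ι m) ∎)
  where open ℚᵘ.≃-Reasoning

ι-+ : ∀ m k → ι (m ℕ.+ k) ≡ ι m + ι k
ι-+ zero    k = sym (ℚ.+-identityˡ (ι k))
ι-+ (suc m) k = trans (/1-suc (m ℕ.+ k)) (trans (cong (1ℚ +_) (ι-+ m k))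
  (trans (sym (ℚ.+-assoc 1ℚ (ι m) (ι k))) (cong (_+ ι k) (sym (/1-suc m)))))

0≤ι : ∀ k → 0ℚ ≤ ι k
0≤ι zero    = ℚ.≤-refl
0≤ι (suc k) = subst (0ℚ ≤_) (sym (/1-suc k)) (0≤+ 0≤1 (0≤ι k))

0<ι : ∀ k .{{_ : ℕ.NonZero k}} → 0ℚ < ι k
0<ι (suc k) = ℚ.<-≤-trans (ℚ.positive⁻¹ 1ℚ) (≤-by (ι k) (0≤ι k) (sym (/1-suc k)))

ι-mono : ∀ {m k} → m ℕ.≤ k → ι m ≤ ι k
ι-mono {m} {k} m≤k = ≤-by (ι (k ℕ.∸ m)) (0≤ι (k ℕ.∸ m))
  (trans (sym (ι-+ m (k ℕ.∸ m))) (cong ι (ℕ.m+[n∸m]≡n m≤k)))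

ι-double : ∀ k → ι (2 ℕ.* k) ≡ 2ℚ * ι k
ι-double k = trans (ι-+ k (k ℕ.+ 0)) (trans (cong (λ x → ι k + ι x) (ℕ.+-identityʳ k))
  (solve 1 (λ x → x :+ x := con 2ℚ :* x) refl (ι k)))

ι-2^ : ∀ k → ι (2 ^ k) ≡ pow 2ℚ k
ι-2^ zero    = refl
ι-2^ (suc k) = trans (ι-double (2 ^ k)) (cong (2ℚ *_) (ι-2^ k))

pow-½ : ∀ k → pow ½ k * pow 2ℚ k ≡ 1ℚ
pow-½ zero    = refl
pow-½ (suc k) = trans
  (solve 2 (λ a b → con ½ :* a :* (con 2ℚ :* b) := a :* b) refl (pow ½ k) (pow 2ℚ k)) (pow-½ k)

wt*2^down : ∀ {n q} (e : Arc n q) → wt e * pow 2ℚ (down e) ≡ pow 2ℚ (up e)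
wt*2^down e = trans (ℚ.*-assoc (pow 2ℚ (up e)) _ _)
  (trans (cong (pow 2ℚ (up e) *_) (pow-½ (down e))) (ℚ.*-identityʳ _))

*-cancel-≡ : ∀ {r} p q → 0ℚ < r → p * r ≡ q * r → p ≡ q
*-cancel-≡ {r} p q 0<r eq = ℚ.≤-antisym
  (ℚ.*-cancelʳ-≤-pos r {{ℚ.positive 0<r}} (ℚ.≤-reflexive eq))
  (ℚ.*-cancelʳ-≤-pos r {{ℚ.positive 0<r}} (ℚ.≤-reflexive (sym eq)))

weight-toEdge : ∀ {n q} (e : Arc n q) → Edge.weight (toEdge e) ≡ wt e
weight-toEdge e = *-cancel-≡ _ _ (0<ι (2 ^ suc (down e)) {{ℕ.m^n≢0 2 (suc (down e))}})
  (trans (fraction (2 ^ suc (up e)) (2 ^ suc (down e)) {{ℕ.m^n≢0 2 (suc (down e))}})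
    (trans (ι-2^ (suc (up e))) (sym (trans (cong (wt e *_) (ι-2^ (suc (down e))))
      (trans (solve 2 (λ w p → w :* (con 2ℚ :* p) := con 2ℚ :* (w :* p)) refl (wt e) (pow 2ℚ (down e)))
        (cong (2ℚ *_) (wt*2^down e)))))))

-- Games from arcs

entry-toEdge : ∀ {n q} (e : Arc n q) β α → entryOf (toEdge e) (β , α) ≡ allowed e α β
entry-toEdge e β α = trans
  (cong (λ r → lookup r α) (Vec.lookup∘tabulate (λ β → Vec.tabulate λ α → allowed e α β) β))
  (Vec.lookup∘tabulate (λ α → allowed e α β) α)

module _ {n q : ℕ} .{{q≢0 : ℕ.NonZero q}} (es : List (Arc n q)) (0<W : 0ℚ < W es) where

  total-toEdge : totalWeight (map toEdge es) ≡ W es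
  total-toEdge = trans (totalWeight≡ (map toEdge es))
    (trans (∑-map toEdge es) (∑-cong es weight-toEdge))

  game : Game
  game = record
    { nU = n ; nV = n ; q = q
    ; edges = map toEdge es
    ; total = ℚ.positive (subst (0ℚ <_) (sym total-toEdge) 0<W)
    }

  satWeight-toEdge : ∀ f g → satWeight f g (map toEdge es) ≡ sat es f g
  satWeight-toEdge f g = trans (∑-map toEdge es) (∑-cong es λ e →
    cong₂ _*_ (weight-toEdge e) (cong indicator (entry-toEdge e (g (v e)) (f (u e)))))

  val-game≤ : ∀ {c} → 0ℚ ≤ c → (∀ f g → sat es f g ≤ c * W es) → Game.val game ≤ c
  val-game≤ {c} 0≤c le = val≤ game 0≤c λ f g →
    ℚ.≤-trans (ℚ.≤-reflexive (satWeight-toEdge f g))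
      (ℚ.≤-trans (le f g) (ℚ.≤-reflexive (cong (c *_) (sym total-toEdge))))

  val-game≡1 : Satisfiable es → Game.val game ≡ 1ℚ
  val-game≡1 (f , g , ok) = val≡1⇐ game f g (trans (satWeight-toEdge f g) (trans
    (∑-cong-∈ es λ e e∈ → trans (cong (λ b → wt e * indicator b) (ok e e∈)) (ℚ.*-identityʳ (wt e)))
    (sym total-toEdge)))

-- Rounding weights to powers of two: a number with k digits in bijective base 2
-- lies between 2 ^ k - 1 and 2 (2 ^ k - 1).

2^digits≤ : ∀ b → 2 ^ digits b ℕ.≤ suc (ℕᵇ.toℕ b)
2^digits≤ ℕᵇ.zero  = ℕ.≤-refl
2^digits≤ 2[1+ b ] = ℕ.≤-trans (ℕ.*-monoʳ-≤ 2 (2^digits≤ b)) (ℕ.n≤1+n _)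
2^digits≤ 1+[2 b ] = ℕ.≤-trans (ℕ.*-monoʳ-≤ 2 (2^digits≤ b)) (ℕ.≤-reflexive (ℕ.*-suc 2 (ℕᵇ.toℕ b)))

≤2*2^digits : ∀ b → suc (suc (ℕᵇ.toℕ b)) ℕ.≤ 2 ℕ.* 2 ^ digits b
≤2*2^digits ℕᵇ.zero  = ℕ.≤-refl
≤2*2^digits 2[1+ b ] = ℕ.≤-trans (ℕ.≤-reflexive (sym (ℕ.*-suc 2 (suc (ℕᵇ.toℕ b)))))
  (ℕ.*-monoʳ-≤ 2 (≤2*2^digits b))
≤2*2^digits 1+[2 b ] = ℕ.≤-trans (ℕ.n≤1+n _) (ℕ.≤-trans
  (ℕ.≤-reflexive (sym (trans (ℕ.*-suc 2 (suc (ℕᵇ.toℕ b))) (cong (2 ℕ.+_) (ℕ.*-suc 2 (ℕᵇ.toℕ b))))))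
  (ℕ.*-monoʳ-≤ 2 (≤2*2^digits b)))

digits≡0 : ∀ b → digits b ≡ 0 → b ≡ ℕᵇ.zero
digits≡0 ℕᵇ.zero eq = refl

module _ (m : ℕ) .{{_ : ℕ.NonZero m}} where
  private
    len : ℕ
    len = digits (ℕᵇ.fromℕ m)

  -- Here m ≥ 1 enters: 2 ^ `len` ≤ m + 1 ≤ 2 m.
  2^≤2ι : pow 2ℚ len ≤ 2ℚ * ι m
  2^≤2ι = begin
    pow 2ℚ len                            ≡⟨ ι-2^ len ⟨
    ι (2 ^ len)                           ≤⟨ ι-mono (2^digits≤ (ℕᵇ.fromℕ m)) ⟩
    ι (suc (ℕᵇ.toℕ (ℕᵇ.fromℕ m)))       ≡⟨ cong (ι ∘ suc) (ℕᵇ.toℕ-fromℕ m) ⟩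
    ι (suc m)                           ≤⟨ ι-mono (ℕ.+-mono-≤ (ℕ.>-nonZero⁻¹ m) (ℕ.m≤m+n m 0)) ⟩
    ι (2 ℕ.* m)                         ≡⟨ ι-double m ⟩
    2ℚ * ι m                            ∎
    where open ℚ.≤-Reasoning

  ι≤2*2^ : ι m ≤ 2ℚ * pow 2ℚ len
  ι≤2*2^ = begin
    ι m                                 ≡⟨ cong ι (ℕᵇ.toℕ-fromℕ m) ⟨
    ι (ℕᵇ.toℕ (ℕᵇ.fromℕ m))             ≤⟨ ι-mono (ℕ.≤-trans (ℕ.m≤n+m _ 2) (≤2*2^digits (ℕᵇ.fromℕ m))) ⟩
    ι (2 ℕ.* 2 ^ len)                     ≡⟨ ι-double (2 ^ len) ⟩
    2ℚ * ι (2 ^ len)                      ≡⟨ cong (2ℚ *_) (ι-2^ len) ⟩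
    2ℚ * pow 2ℚ len                       ∎
    where open ℚ.≤-Reasoning

4ℚ : ℚ
4ℚ = 2ℚ * 2ℚ

0≤2 : 0ℚ ≤ 2ℚ
0≤2 = ℚ.nonNegative⁻¹ 2ℚ

0≤4 : 0ℚ ≤ 4ℚ
0≤4 = ℚ.nonNegative⁻¹ 4ℚ

-- Here w = a / d and w′ = a′ / d′.
quotient≤ : ∀ {w w′ a a′ d d′} → 0ℚ < d → 0ℚ ≤ w′ → w * d ≡ a → w′ * d′ ≡ a′ →
            a ≤ 2ℚ * a′ → d′ ≤ 2ℚ * d → w ≤ 4ℚ * w′
quotient≤ {w} {w′} {a} {a′} {d} {d′} 0<d 0≤w′ a≡ a′≡ a≤ d′≤ =
  ℚ.*-cancelʳ-≤-pos d {{ℚ.positive 0<d}} (begin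
    w * d              ≡⟨ a≡ ⟩
    a                  ≤⟨ a≤ ⟩
    2ℚ * a′            ≡⟨ cong (2ℚ *_) a′≡ ⟨
    2ℚ * (w′ * d′)     ≤⟨ *-mono-≤ˡ 0≤2 (*-mono-≤ˡ 0≤w′ d′≤) ⟩
    2ℚ * (w′ * (2ℚ * d)) ≡⟨ solve 2 (λ w d → con 2ℚ :* (w :* (con 2ℚ :* d)) := con 2ℚ :* con 2ℚ :* w :* d) refl w′ d ⟩
    4ℚ * w′ * d        ∎)
  where open ℚ.≤-Reasoning

module _ {nU nV q : ℕ} where

  weight*den : ∀ (e : Edge nU nV q) → Edge.weight e * ι (Edge.den e) ≡ ι (Edge.num e)
  weight*den record { num = num ; den = den ; den≢0 = nz } = fraction num den {{nz}}

  0<den : ∀ (e : Edge nU nV q) → 0 ℕ.< Edge.den e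
  0<den record { den = den ; den≢0 = nz } = ℕ.>-nonZero⁻¹ den {{nz}}

  rounded : Edge nU nV q → ℚ
  rounded e = if positive? e then wt (arc e) else 0ℚ

  positive⇒ : ∀ (e : Edge nU nV q) → positive? e ≡ true → 0 ℕ.< Edge.num e
  positive⇒ e eq with Edge.num e
  ... | suc _ = s≤s z≤n
  positive⇒ e () | zero

  nonPositive⇒ : ∀ e → positive? e ≡ false → Edge.weight e ≡ 0ℚ
  nonPositive⇒ e eq = *-cancel-≡ _ _ (0<ι (Edge.den e) {{ℕ.>-nonZero (0<den e)}})
    (trans (weight*den e) (trans (cong ι num≡0) (sym (ℚ.*-zeroˡ (ι (Edge.den e))))))
    where
    none : ∀ k → (0 ℕ.<ᵇ k) ≡ false → k ≡ 0
    none zero _ = refl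
    num≡0 : Edge.num e ≡ 0
    num≡0 = trans (sym (ℕᵇ.toℕ-fromℕ (Edge.num e)))
      (cong ℕᵇ.toℕ (digits≡0 (ℕᵇ.fromℕ (Edge.num e)) (none _ eq)))

  module _ (e : Edge nU nV q) (0<num : 0 ℕ.< Edge.num e) where
    private
      instance
        num≢0 : ℕ.NonZero (Edge.num e)
        num≢0 = ℕ.>-nonZero 0<num
        den≢0 : ℕ.NonZero (Edge.den e)
        den≢0 = ℕ.>-nonZero (0<den e)

    weight≤wt : Edge.weight e ≤ 4ℚ * wt (arc e)
    weight≤wt = quotient≤ (0<ι (Edge.den e)) (0≤wt (arc e)) (weight*den e) (wt*2^down (arc e))
      (ι≤2*2^ (Edge.num e)) (2^≤2ι (Edge.den e))

    wt≤weight : wt (arc e) ≤ 4ℚ * Edge.weight e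
    wt≤weight = quotient≤ (0<pow 2ℚ (ℚ.positive⁻¹ 2ℚ) (down (arc e))) (0≤weight e)
      (wt*2^down (arc e)) (weight*den e) (2^≤2ι (Edge.num e)) (ι≤2*2^ (Edge.den e))

  weight≤rounded : ∀ e → Edge.weight e ≤ 4ℚ * rounded e
  weight≤rounded e with positive? e in eq
  ... | true  = weight≤wt e (positive⇒ e eq)
  ... | false = ℚ.≤-reflexive (nonPositive⇒ e eq)

  rounded≤weight : ∀ e → rounded e ≤ 4ℚ * Edge.weight e
  rounded≤weight e with positive? e in eq
  ... | true  = wt≤weight e (positive⇒ e eq)
  ... | false = 0≤* 0≤4 (0≤weight e)

  ∑-arcs : ∀ (es : List (Edge nU nV q)) k → ∑ (arcs es) k ≡ ∑ es λ e → if positive? e then k (arc e) else 0ℚ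
  ∑-arcs es k = trans (∑-concatMap arcIfPositive es) (∑-cong es one)
    where
    one : ∀ e → ∑ (arcIfPositive e) k ≡ (if positive? e then k (arc e) else 0ℚ)
    one e with positive? e
    ... | true  = ℚ.+-identityʳ (k (arc e))
    ... | false = refl

  module _ (es : List (Edge nU nV q)) where

    total≤ : ∑ es Edge.weight ≤ 4ℚ * W (arcs es)
    total≤ = ℚ.≤-trans (∑-mono es weight≤rounded)
      (ℚ.≤-reflexive (trans (sym (*-∑ es 4ℚ rounded)) (cong (4ℚ *_) (sym (∑-arcs es wt)))))

    0<W-arcs : 0ℚ < ∑ es Edge.weight → 0ℚ < W (arcs es)
    0<W-arcs 0<total = ℚ.*-cancelˡ-<-nonNeg 4ℚ (ℚ.<-≤-trans 0<total total≤)

    module _ (f g : Fin (suc (nU ℕ.+ nV)) → Fin q) where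
      private
        f′ : Fin nU → Fin q
        f′ i = f (inject≤ i (ℕ.≤-trans (ℕ.m≤m+n nU nV) (ℕ.n≤1+n _)))
        g′ : Fin nV → Fin q
        g′ j = g (inject≤ j (ℕ.≤-trans (ℕ.m≤n+m nV nU) (ℕ.n≤1+n _)))

        violated : Edge nU nV q → ℚ
        violated e = 1ℚ - indicator (entryAt f′ g′ e)

        0≤violated : ∀ e → 0ℚ ≤ violated e
        0≤violated e with entryAt f′ g′ e
        ... | true  = ℚ.≤-refl
        ... | false = 0≤1

        complement : ∀ (w : Edge nU nV q → ℚ) →
          ∑ es (λ e → w e * indicator (entryAt f′ g′ e)) + ∑ es (λ e → w e * violated e) ≡ ∑ es w
        complement w = trans (sym (∑-+ es _ _)) (∑-cong es λ e →
          solve 2 (λ w b → w :* b :+ w :* (con 1ℚ :- b) := w) refl (w e) (indicator (entryAt f′ g′ e)))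

        sat≡ : sat (arcs es) f g ≡ ∑ es λ e → rounded e * indicator (entryAt f′ g′ e)
        sat≡ = trans (∑-arcs es _) (∑-cong es one)
          where
          one : ∀ e → (if positive? e then wt (arc e) * A (arc e) (f (u (arc e))) (g (v (arc e))) else 0ℚ) ≡
                      rounded e * indicator (entryAt f′ g′ e)
          one e with positive? e
          ... | true  = refl
          ... | false = sym (ℚ.*-zeroˡ (indicator (entryAt f′ g′ e)))

        T T′ U U′ : ℚ
        T  = ∑ es Edge.weight
        T′ = ∑ es rounded
        U  = ∑ es λ e → Edge.weight e * violated e
        U′ = ∑ es λ e → rounded e * violated e

      -- The satisfied weight could grow fourfold by rounding, so the argument concerns the violated
      -- weight, for which a lower bound survives: U′ ≥ U/4 ≥ ε T/4 ≥ ε T′/16.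
      rounding-loss : ∀ {ε} → 0ℚ ≤ ε → satWeight f′ g′ es ≤ (1ℚ - ε) * T →
                      sat (arcs es) f g ≤ (1ℚ - ε * (¼ℚ * ¼ℚ)) * W (arcs es)
      rounding-loss {ε} 0≤ε le = begin
        sat (arcs es) f g
          ≡⟨ sat≡ ⟩
        S′
          ≡⟨ solve 2 (λ s u → s := s :+ u :- con ¼ℚ :* con ¼ℚ :* (con 4ℚ :* (con 4ℚ :* u))) refl S′ U′ ⟩
        S′ + U′ - ¼ℚ * ¼ℚ * (4ℚ * (4ℚ * U′))
          ≤⟨ ℚ.+-mono-≤ (ℚ.≤-reflexive (complement rounded)) (ℚ.neg-antimono-≤
               (*-mono-≤ˡ (ℚ.nonNegative⁻¹ (¼ℚ * ¼ℚ)) (ℚ.≤-trans εT′≤ (*-mono-≤ˡ 0≤4 U≤)))) ⟩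
        T′ - ¼ℚ * ¼ℚ * (ε * T′)
          ≡⟨ solve 2 (λ ε t → t :- con ¼ℚ :* con ¼ℚ :* (ε :* t) := (con 1ℚ :- ε :* (con ¼ℚ :* con ¼ℚ)) :* t) refl ε T′ ⟩
        (1ℚ - ε * (¼ℚ * ¼ℚ)) * T′
          ≡⟨ cong ((1ℚ - ε * (¼ℚ * ¼ℚ)) *_) (∑-arcs es wt) ⟨
        (1ℚ - ε * (¼ℚ * ¼ℚ)) * W (arcs es) ∎
        where
        open ℚ.≤-Reasoning
        S′ : ℚ
        S′ = ∑ es λ e → rounded e * indicator (entryAt f′ g′ e)
        U≤ : U ≤ 4ℚ * U′
        U≤ = ℚ.≤-trans (∑-mono es λ e → *-mono-≤ʳ (0≤violated e) (weight≤rounded e))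
          (ℚ.≤-reflexive (trans (∑-cong es λ e → ℚ.*-assoc 4ℚ (rounded e) (violated e)) (sym (*-∑ es 4ℚ _))))
        εT≤U : ε * T ≤ U
        εT≤U = begin
          ε * T             ≡⟨ solve 2 (λ ε t → ε :* t := t :- (con 1ℚ :- ε) :* t) refl ε T ⟩
          T - (1ℚ - ε) * T  ≤⟨ ℚ.+-monoʳ-≤ T (ℚ.neg-antimono-≤ le) ⟩
          T - satWeight f′ g′ es
            ≡⟨ cong (_- satWeight f′ g′ es) (complement Edge.weight) ⟨
          satWeight f′ g′ es + U - satWeight f′ g′ es
            ≡⟨ solve 2 (λ s u → s :+ u :- s := u) refl (satWeight f′ g′ es) U ⟩
          U                 ∎
        εT′≤ : ε * T′ ≤ 4ℚ * U
        εT′≤ = begin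
          ε * T′         ≤⟨ *-mono-≤ˡ 0≤ε (∑-mono es rounded≤weight) ⟩
          ε * ∑ es (λ e → 4ℚ * Edge.weight e) ≡⟨ cong (ε *_) (*-∑ es 4ℚ Edge.weight) ⟨
          ε * (4ℚ * T)   ≡⟨ solve 2 (λ ε t → ε :* (con 4ℚ :* t) := con 4ℚ :* (ε :* t)) refl ε T ⟩
          4ℚ * (ε * T)   ≤⟨ *-mono-≤ˡ 0≤4 εT≤U ⟩
          4ℚ * U         ∎

    arcs-elim : ∀ (P : Arc (suc (nU ℕ.+ nV)) q → Set) →
      (∀ e → e ∈ es → positive? e ≡ true → P (arc e)) → ∀ a → a ∈ arcs es → P a
    arcs-elim P h a a∈ = go es (λ e e∈ → h e e∈) a∈
      where
      go : ∀ (es : List (Edge nU nV q)) → (∀ e → e ∈ es → positive? e ≡ true → P (arc e)) → a ∈ arcs es → P a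
      go (e ∷ es) h a∈ with positive? e in eq | ∈-++⁻ (arcIfPositive e) a∈
      ... | true  | inj₁ (here refl) = h e (here refl) eq
      ... | true  | inj₂ a∈′         = go es (λ e′ → h e′ ∘ there) a∈′
      ... | false | inj₂ a∈′         = go es (λ e′ → h e′ ∘ there) a∈′

    hub-fresh : ∀ a → a ∈ arcs es → u a ≢ hub nU nV
    hub-fresh = arcs-elim (λ a → u a ≢ hub nU nV) λ e _ _ eq → ℕ.<-irrefl
      (trans (sym (Fin.toℕ-inject≤ (Edge.u e) _)) (trans (cong toℕ eq) (Fin.toℕ-fromℕ< _)))
      (Fin.toℕ<n (Edge.u e))

    -- The violated weights are nonnegative with sum 0, so every edge of positive weight is
    -- satisfied, and only these became arcs. The label α₀ fills the vertex numbers that the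
    -- original game does not have.
    satisfiable-arcs : Fin q → ∀ f g → satWeight f g es ≡ ∑ es Edge.weight → Satisfiable (arcs es)
    satisfiable-arcs α₀ f g sat≡total = extend f , extend g , arcs-elim _ allowed-arc
      where
      extend : ∀ {m n} → (Fin m → Fin q) → Fin n → Fin q
      extend {m} h i with toℕ i ℕ.<? m
      ... | yes lt = h (fromℕ< lt)
      ... | no _   = α₀
      extend-inject : ∀ {m n} (h : Fin m → Fin q) (le : m ℕ.≤ n) i → extend h (inject≤ i le) ≡ h i
      extend-inject {m} h le i with toℕ (inject≤ i le) ℕ.<? m
      ... | yes lt = cong h (Fin.toℕ-injective (trans (Fin.toℕ-fromℕ< lt) (Fin.toℕ-inject≤ i le)))
      ... | no ≮   = ⊥-elim (≮ (subst (ℕ._< m) (sym (Fin.toℕ-inject≤ i le)) (Fin.toℕ<n i)))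
      violation : Edge nU nV q → ℚ
      violation e = Edge.weight e * (1ℚ - indicator (entryAt f g e))
      0≤violation : ∀ e → 0ℚ ≤ violation e
      0≤violation e = 0≤* (0≤weight e) (0≤violated (entryAt f g e))
        where
        0≤violated : ∀ b → 0ℚ ≤ 1ℚ - indicator b
        0≤violated true  = ℚ.≤-refl
        0≤violated false = 0≤1
      no-violation : ∑ es violation ≡ 0ℚ
      no-violation = trans
        (trans (∑-cong es λ e → solve 2 (λ w b → w :* (con 1ℚ :- b) := w :+ con (- 1ℚ) :* (w :* b)) refl
                 (Edge.weight e) (indicator (entryAt f g e)))
          (trans (∑-+ es _ _) (cong (∑ es Edge.weight +_) (sym (*-∑ es (- 1ℚ) _)))))
        (trans (cong (λ z → ∑ es Edge.weight + - 1ℚ * z) sat≡total)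
          (solve 1 (λ t → t :+ con (- 1ℚ) :* t := con 0ℚ) refl (∑ es Edge.weight)))
      satisfied : ∀ e → e ∈ es → positive? e ≡ true → entryAt f g e ≡ true
      satisfied e e∈ pos with entryAt f g e in eq
      ... | true  = refl
      ... | false = ⊥-elim (ℚ.<⇒≢ (0<wt (arc e)) (sym (ℚ.≤-antisym wt≤0 (0≤wt (arc e)))))
        where
        weight≤0 : Edge.weight e ≤ 0ℚ
        weight≤0 = ℚ.≤-trans (ℚ.≤-reflexive (sym (trans
            (cong (λ b → Edge.weight e * (1ℚ - indicator b)) eq) (ℚ.*-identityʳ (Edge.weight e)))))
          (ℚ.≤-trans (term≤∑ 0≤violation e∈) (ℚ.≤-reflexive no-violation))
        wt≤0 : wt (arc e) ≤ 0ℚ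
        wt≤0 = ℚ.≤-trans (wt≤weight e (positive⇒ e pos)) (*-mono-≤ˡ 0≤4 weight≤0)
      allowed-arc : ∀ e → e ∈ es → positive? e ≡ true →
        allowed (arc e) (extend f (u (arc e))) (extend g (v (arc e))) ≡ true
      allowed-arc e e∈ pos = trans
        (cong₂ (λ α β → entryOf e (β , α))
          (extend-inject f (ℕ.≤-trans (ℕ.m≤m+n nU nV) (ℕ.n≤1+n _)) (Edge.u e))
          (extend-inject g (ℕ.≤-trans (ℕ.m≤n+m nV nU) (ℕ.n≤1+n _)) (Edge.v e)))
        (satisfied e e∈ pos)

-- The reduction

tower-nonZero : ∀ l q .{{_ : ℕ.NonZero q}} → ℕ.NonZero (tower l q)
tower-nonZero zero    (suc q) = _
tower-nonZero (suc l) (suc q) = tower-nonZero l (suc q ℕ.* suc q)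

-- The stages are attached to a function rather than applied to a word, in the form that
-- `polyTime-⟦⟧` accepts. Each stage is a different program, as the alphabet has grown.
iterateSquare : ℕ → ℕ → (Word → Word) → Word → Word
iterateSquare zero    q h = h
iterateSquare (suc l) q h = iterateSquare l (q ℕ.* q) λ w → ⟦ square q ⟧ (h w ∷ [])

polyTime-iterateSquare : ∀ l q {h} → PolyTime h → PolyTime (iterateSquare l q h)
polyTime-iterateSquare zero    q p = p
polyTime-iterateSquare (suc l) q p = polyTime-iterateSquare l (q ℕ.* q) (polyTime-⟦⟧ (square q) p)

iterateSquare-correct : ∀ l {n q} h w (es : List (Arc n q)) → h w ≡ gameWord es →
                        iterateSquare l q h w ≡ gameWord (power l es)
iterateSquare-correct zero    h w es eq = eq
iterateSquare-correct (suc l) {q = q} h w es eq =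
  iterateSquare-correct l (λ w → ⟦ square q ⟧ (h w ∷ [])) w (es ⊠ es)
    (trans (cong (λ x → ⟦ square q ⟧ (x ∷ [])) eq) (⟦square⟧ es))

amplify : ∀ {q} → Fin q → ℕ → (Word → Word) → Word → Word
amplify {q} α₀ l h w = ⟦ finish (tower l q) ⟧
  (iterateSquare l q (λ w → ⟦ addStar α₀ ⟧ (⟦ Parser.parse (q ℕ.* q) ⟧ (h w ∷ []) ∷ [])) w ∷ [])

polyTime-amplify : ∀ {q} (α₀ : Fin q) l {h} → PolyTime h → PolyTime (amplify α₀ l h)
polyTime-amplify {q} α₀ l p = polyTime-⟦⟧ (finish (tower l q))
  (polyTime-iterateSquare l q (polyTime-⟦⟧ (addStar α₀) (polyTime-⟦⟧ (Parser.parse (q ℕ.* q)) p)))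

expanded : ∀ G → Fin (Game.q G) → List (Arc (suc (Game.nU G ℕ.+ Game.nV G)) (Game.q G))
expanded G α₀ = starred (hub (Game.nU G) (Game.nV G)) α₀ (arcs (Game.edges G))

0<total : ∀ G → 0ℚ < ∑ (Game.edges G) Edge.weight
0<total G = subst (0ℚ <_) (totalWeight≡ (Game.edges G)) (total⁺ G)

alphabet≢0 : ∀ G → Game.q G ≢ 0
alphabet≢0 record { q = q ; q≢0 = nz } = ℕ.≢-nonZero⁻¹ q {{nz}}

0<W-expanded : ∀ G α₀ → 0ℚ < W (expanded G α₀)
0<W-expanded G α₀ = subst (0ℚ <_) (sym (W-starred (hub (Game.nU G) (Game.nV G)) α₀ (arcs (Game.edges G))))
  (ℚ.+-mono-< 0<W 0<W)
  where
  0<W : 0ℚ < W (arcs (Game.edges G))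
  0<W = 0<W-arcs (Game.edges G) (0<total G)

amplified : ∀ G → Fin (Game.q G) → ℕ → Game
amplified G α₀ l = game {{tower-nonZero l (Game.q G) {{ℕ.≢-nonZero (alphabet≢0 G)}}}} (power l (expanded G α₀))
  (0<W-power l (expanded G α₀) (0<W-expanded G α₀))

amplify-correct : ∀ G α₀ l h w → h w ≡ encode G → amplify α₀ l h w ≡ encode (amplified G α₀ l)
amplify-correct G α₀ l h w eq = trans
  (cong (λ x → ⟦ finish (tower l q) ⟧ (x ∷ []))
    (iterateSquare-correct l (λ w → ⟦ addStar α₀ ⟧ (⟦ Parser.parse (q ℕ.* q) ⟧ (h w ∷ []) ∷ [])) w (expanded G α₀) (trans
      (cong (λ x → ⟦ addStar α₀ ⟧ (x ∷ []))
        (trans (cong (λ x → ⟦ Parser.parse (q ℕ.* q) ⟧ (x ∷ [])) eq) (⟦parse⟧-encode G)))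
      (⟦addStar⟧ α₀ edges))))
  (⟦finish⟧ (power l (expanded G α₀)))
  where open Game G

amplify-yes : ∀ G α₀ l → Game.val G ≡ 1ℚ → Game.val (amplified G α₀ l) ≡ 1ℚ
amplify-yes G α₀ l val≡1 =
  let f , g , eq = val≡1⇒ G val≡1
  in val-game≡1 {{tower-nonZero l q {{ℕ.≢-nonZero (alphabet≢0 G)}}}} (power l (expanded G α₀))
       (0<W-power l (expanded G α₀) (0<W-expanded G α₀))
       (satisfiable-power l (satisfiable-starred (hub nU nV) α₀ (hub-fresh edges)
         (satisfiable-arcs edges α₀ f g (trans eq (totalWeight≡ edges)))))
  where open Game G

-- Rounding changes every weight by a factor of at most 4, and so the gap by a
-- factor of at most 16.
lossy : ℚ → ℚ
lossy ε = ε * (¼ℚ * ¼ℚ)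

0<lossy : ∀ {ε} → 0ℚ < ε → 0ℚ < lossy ε
0<lossy 0<ε = 0<* 0<ε (ℚ.positive⁻¹ (¼ℚ * ¼ℚ))

lossy≤1 : ∀ {ε} → ε ≤ 1ℚ → lossy ε ≤ 1ℚ
lossy≤1 ε≤1 = ℚ.≤-trans (*-mono-≤ʳ (ℚ.nonNegative⁻¹ (¼ℚ * ¼ℚ)) ε≤1)
  (≤-by (1ℚ - ¼ℚ * ¼ℚ) (ℚ.nonNegative⁻¹ (1ℚ - ¼ℚ * ¼ℚ)) refl)

0<gap : ∀ {ε} → 0ℚ < ε → 0ℚ < gap ε
0<gap 0<ε = 0<* (0<* (0<* 0<ε 0<ε) 0<ε) (ℚ.positive⁻¹ ¼ℚ)

gap≤1 : ∀ {ε} → 0ℚ ≤ ε → ε ≤ 1ℚ → gap ε ≤ 1ℚ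
gap≤1 {ε} 0≤ε ε≤1 = begin
  ε * ε * ε * ¼ℚ   ≤⟨ *-mono-≤ˡ (0≤* (0≤² ε) 0≤ε) (≤-by (1ℚ - ¼ℚ) (ℚ.nonNegative⁻¹ (1ℚ - ¼ℚ)) refl) ⟩
  ε * ε * ε * 1ℚ   ≡⟨ ℚ.*-identityʳ _ ⟩
  ε * ε * ε        ≤⟨ *-mono-≤ˡ (0≤² ε) ε≤1 ⟩
  ε * ε * 1ℚ       ≡⟨ ℚ.*-identityʳ _ ⟩
  ε * ε            ≤⟨ *-mono-≤ˡ 0≤ε ε≤1 ⟩
  ε * 1ℚ           ≡⟨ ℚ.*-identityʳ ε ⟩
  ε                ≤⟨ ε≤1 ⟩
  1ℚ               ∎
  where open ℚ.≤-Reasoning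

amplify-no : ∀ G α₀ l {ε d} → 0ℚ < ε → ε ≤ 1ℚ → 0ℚ < d → squares l (1ℚ - gap (lossy ε)) ≤ d * d →
             Game.val G ≤ 1ℚ - ε → Game.val (amplified G α₀ l) ≤ d
amplify-no G α₀ l {ε} {d} 0<ε ε≤1 0<d small val≤ =
  val-game≤ {{tower-nonZero l q {{q-nonZero}}}} (power l (expanded G α₀))
    (0<W-power l (expanded G α₀) (0<W-expanded G α₀)) (ℚ.<⇒≤ 0<d)
    (contracts⇒sat≤ (power l (expanded G α₀)) 0<d small
      (contracts-power l (expanded G α₀) (0≤difference (gap≤1 0≤ε′ ε′≤1))
        (starred-contracts {{q-nonZero}} (hub nU nV) α₀ (arcs edges) {ε′} {1/ε′} 0≤ε′ ε′≤1
          (ℚ.*-inverseʳ ε′ {{ε′≢0}}) 0≤1/ε′ (0<W-arcs edges (0<total G)) bound)))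
  where
  open Game G
  q-nonZero : ℕ.NonZero q
  q-nonZero = ℕ.≢-nonZero (alphabet≢0 G)
  ε′ : ℚ
  ε′ = lossy ε
  0<ε′ : 0ℚ < ε′
  0<ε′ = 0<lossy 0<ε
  0≤ε′ : 0ℚ ≤ ε′
  0≤ε′ = ℚ.<⇒≤ 0<ε′
  ε′≤1 : ε′ ≤ 1ℚ
  ε′≤1 = lossy≤1 ε≤1
  ε′≢0 : ℚ.NonZero ε′
  ε′≢0 = ℚ.pos⇒nonZero ε′ {{ℚ.positive 0<ε′}}
  1/ε′ : ℚ
  1/ε′ = (1/ ε′) {{ε′≢0}}
  0≤1/ε′ : 0ℚ ≤ 1/ε′
  0≤1/ε′ = ℚ.<⇒≤ (ℚ.positive⁻¹ 1/ε′ {{ℚ.1/pos⇒pos ε′ {{ℚ.positive 0<ε′}}}})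
  bound : ∀ f g → sat (arcs edges) f g ≤ (1ℚ - ε′) * W (arcs edges)
  bound f g = rounding-loss edges f g (ℚ.<⇒≤ 0<ε) (ℚ.≤-trans (satWeight≤val G _ _)
    (ℚ.≤-trans (*-mono-≤ʳ (ℚ.<⇒≤ (total⁺ G)) val≤)
      (ℚ.≤-reflexive (cong ((1ℚ - ε) *_) (totalWeight≡ edges)))))

-- `PCPTheorem` allows any positive ε, while the mixing weight and 1 - `gap` are under control for ε
-- ≤ 1. Shrinking ε only relaxes the bound on the value in the no case.
belowOne : ∀ {ε} → 0ℚ < ε → ∃[ ε′ ] 0ℚ < ε′ × ε′ ≤ 1ℚ × ε′ ≤ ε
belowOne {ε} 0<ε with ℚ.≤-total ε 1ℚ
... | inj₁ ε≤1 = ε , 0<ε , ε≤1 , ℚ.≤-refl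
... | inj₂ 1≤ε = 1ℚ , ℚ.positive⁻¹ 1ℚ , ℚ.≤-refl , 1≤ε

mainTheorem12 : PCPTheorem → ∀ (δ : ℚ) → 0ℚ < δ → NPHard LabelCover⟨1, δ ⟩
mainTheorem12 (ε , 0<ε , zero , hard) δ 0<δ A np = record
  { reduce   = reduce
  ; polyTime = polyTime
  -- Games have a nonempty alphabet, so for alphabet size 0 the promise of `hard` is contradictory
  -- on every input, and the given reduction can be returned as it is.
  ; yes      = λ x a → let G , q≡0 , _ = yes′ x a in ⊥-elim (alphabet≢0 G q≡0)
  ; no       = λ x ¬a → let G , q≡0 , _ = no′ x ¬a in ⊥-elim (alphabet≢0 G q≡0)
  }
  where open _≤ₚ_ (hard A np) renaming (yes to yes′; no to no′)
mainTheorem12 (ε , 0<ε , suc q , hard) δ 0<δ A np = record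
  { reduce   = amplify {suc q} zero l reduce
  ; polyTime = polyTime-amplify {suc q} zero l polyTime
  ; yes      = λ x a → accept x (yes′ x a)
  ; no       = λ x ¬a → reject x (no′ x ¬a)
  }
  where
  open _≤ₚ_ (hard A np) renaming (yes to yes′; no to no′)
  ε₀ : ℚ
  ε₀ = proj₁ (belowOne 0<ε)
  0<ε₀ : 0ℚ < ε₀
  0<ε₀ = proj₁ (proj₂ (belowOne 0<ε))
  ε₀≤1 : ε₀ ≤ 1ℚ
  ε₀≤1 = proj₁ (proj₂ (proj₂ (belowOne 0<ε)))
  ε₀≤ε : ε₀ ≤ ε
  ε₀≤ε = proj₂ (proj₂ (proj₂ (belowOne 0<ε)))
  enough : ∃[ l ] squares l (1ℚ - gap (lossy ε₀)) ≤ δ * δ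
  enough = squares-small (0<gap (0<lossy 0<ε₀)) (gap≤1 (ℚ.<⇒≤ (0<lossy 0<ε₀)) (lossy≤1 ε₀≤1)) 0<δ
  l : ℕ
  l = proj₁ enough
  accept : ∀ x → ∃[ G ] Game.q G ≡ suc q × reduce x ≡ encode G × Game.val G ≡ 1ℚ →
           ∃[ G ] amplify {suc q} zero l reduce x ≡ encode G × Game.val G ≡ 1ℚ
  accept x (G , refl , eq , val≡1) =
    amplified G zero l , amplify-correct G zero l reduce x eq , amplify-yes G zero l val≡1
  reject : ∀ x → ∃[ G ] Game.q G ≡ suc q × reduce x ≡ encode G × Game.val G ≤ 1ℚ - ε →
           ∃[ G ] amplify {suc q} zero l reduce x ≡ encode G × Game.val G ≤ δ
  reject x (G , refl , eq , val≤) =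
    amplified G zero l , amplify-correct G zero l reduce x eq ,
    amplify-no G zero l 0<ε₀ ε₀≤1 0<δ (proj₂ enough)
      (ℚ.≤-trans val≤ (ℚ.+-monoʳ-≤ 1ℚ (ℚ.neg-antimono-≤ ε₀≤ε)))
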